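{- Let $a\le b$ be positive integers. Let $M_{a,b}=M_{a,b}^1\cup M_{a,b}^2$ (union of multisets, adding multiplicities) be the multiset of $a$-colored degrees where $$M_{a,b}^1=\{(\delta_1,\dots,\delta_a) : \exists\, i\in[a],\ \delta_i=b \text{ and } \delta_j=0 \text{ for all } j\ne i\}$$ and $M_{a,b}^2$ consists of the all-ones tuple $(1,\dots,1)$ of length $a$ with multiplicity $b$. Then $M_{a,b}$ is an extended profile of $\mathcal{S}(K_{a,b})$, where $K_{a,b}$ is the complete bipartite graph with parts of $a$ and $b$ vertices. Moreover, for a host graph $G$ with ordered edges $e_1,\dots,e_m$ and maximum frontier size $w=\max_{i\in[m]}|F_i|$, there is an algorithm to construct an $(a+1)$-DD $\mathbf{Z}^{a+1}(\mathcal{C}_{M_{a,b}}^*)$ over $E(G)$, i.e. one representing the family of all $a$-colored subgraphs of $G$ satisfying $\mathcal{C}_{M_{a,b}}^*$, with width at most $$2^{O(a\,w\log w)}\,(2^a+ab)^{w}\,(b+1).$$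
   Context: All graphs are finite and simple; $[k]=\{1,\dots,k\}$; $\mathbb{N}$ is the set of non-negative integers; the number $c$ of colors is always a positive integer; $O(\cdot)$ is the usual big-O notation. Subdivisions. Subdividing an edge $\{u,v\}$ means removing it, adding a new vertex $x$ and the edges $\{u,x\},\{v,x\}$. A subdivision of $H$ is any graph obtained from $H$ by subdividing edges an arbitrary number (possibly zero) of times. $\mathcal{S}(H)$ is the family of subdivisions of $H$ (considered up to isomorphism). Colored graphs. A $c$-colored subset over a finite set $E$ is a $c$-tuple $(D_1,\dots,D_c)$ of pairwise disjoint subsets of $E$. A $c$-colored graph is a finite vertex set $U$ together with a $c$-colored subset $(D_1,\dots,D_c)$ over the set of unordered pairs of distinct elements of $U$; edges in $D_i$ have color $i$. Its underlying graph is obtained by forgetting colors; it is a $c$-colorized graph of $F$ if its underlying graph is isomorphic to $F$. A $c$-colored degree is a tuple in $\mathbb{N}^c$. The colored degree of a vertex $u$ is the $c$-tuple $(\delta_1,\dots,\delta_c)$ where $\delta_i$ is the number of color-$i$ edges incident to $u$. $\mathrm{DS}(F^c)$ is the multiset of colored degrees of all vertices of $F^c$. The color-$i$ subgraph of $F^c$ consists of the color-$i$ edges and their endpoints. Extended profile. Let $\Delta^c$ be the set of the $c$ tuples in $\mathbb{N}^c$ with one entry equal to $2$ and all other entries $0$. For a multiset $M$ of $c$-colored degrees, a $c$-colored graph $F^c$ satisfies $\mathcal{C}_M^*$ if and only if (a) $\mathrm{DS}(F^c)$ is obtained by adding to $M$ an arbitrary number (possibly zero) of elements of $\Delta^c$,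 repetitions allowed, and (b) for each $i\in[c]$ the color-$i$ subgraph of $F^c$ is connected. $M$ is an extended profile of $\mathcal{S}(H)$ if for every graph $F$: $F$ belongs to $\mathcal{S}(H)$ if and only if there exists a $c$-colorized graph $F^c$ of $F$ satisfying $\mathcal{C}_M^*$. Colored subgraphs of $G$. A $c$-colored subgraph of $G$ is identified with a $c$-colored subset $(D_1,\dots,D_c)$ over $E(G)$; it stands for the edge-induced $c$-colored graph whose vertices are the endpoints of edges in $D_1\cup\dots\cup D_c$. Frontier. The $i$-th frontier $F_i$ is the set of vertices of $G$ incident both to some edge in $\{e_1,\dots,e_{i-1}\}$ and to some edge in $\{e_i,\dots,e_m\}$. Decision diagrams. A $(c+1)$-DD over $E=\{e_1,\dots,e_m\}$ is a finite directed acyclic graph with a unique root node and two terminal nodes $\top,\bot$ (no outgoing arcs). Each non-terminal node $\alpha$ has a label $\ell(\alpha)\in[m]$ and exactly $c+1$ outgoing arcs, called its $0$-arc, $1$-arc, ..., $c$-arc; each arc from $\alpha$ points to a terminal node or to a non-terminal node with label $\ell(\alpha)+1$. A directed path from the root to $\top$ represents the $c$-colored subset $(B_1,\dots,B_c)$ with $B_j=\{e_{\ell(\beta)} : \text{the path uses the } j\text{ -arc of } \beta\}$. The DD represents the family of all $c$-colored subsets represented by its root-to-$\top$ paths. Its width is the maximum number of nodes with the same label. -}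

module Defs where

open import Data.Bool.Base using (if_then_else_)
open import Data.Empty using (⊥)
open import Data.Fin.Base as Fin using (Fin; zero; suc; toℕ; splitAt)
open import Data.Fin.Properties using (any?; _≟_; _<?_; _≤?_)
open import Data.Fin.Subset using (Subset; _∈_; _∉_)
open import Data.Fin.Subset.Properties using (_∈?_)
open import Data.List.Base using (List; length; filter; map; allFin; lookup; replicate; _++_)
open import Data.List.Extrema.Nat using (max)
open import Data.List.Relation.Binary.Permutation.Propositional using (_↭_)
open import Data.List.Relation.Unary.All using (All)
open import Data.Nat.Base using (ℕ; suc; _+_; _*_; _^_)
open import Data.Nat.Logarithm using (⌈log₂_⌉)
open import Data.Product.Base using (∃; _×_; _,_; proj₁; proj₂; uncurry)
open import Data.Sum.Base using (_⊎_; inj₁; inj₂; [_,_]′)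
open import Data.Vec.Base as Vec using (Vec; tabulate)
open import Function.Base using (_∘_)
open import Function.Bundles using (_⇔_; _↔_; Inverse)
open import Level using (0ℓ)
open import Relation.Binary.Construct.Closure.ReflexiveTransitive using (Star)
open import Relation.Binary.Core using (Rel)
open import Relation.Binary.Definitions using (Symmetric) renaming (Decidable to Decidable₂)
open import Relation.Binary.PropositionalEquality using (_≡_; _≢_; refl; sym; subst₂)
open import Relation.Nullary.Decidable using (does; _×-dec_; _⊎-dec_; ¬?; yes; no)
open import Relation.Nullary.Negation using (¬_)
open import Relation.Unary using (Pred; Decidable)

count : ∀ {n} {P : Pred (Fin n) 0ℓ} → Decidable P → ℕ
count {n} P? = length (filter P? (allFin n))

maximum : ∀ {n} → (Fin n → ℕ) → ℕ
maximum {n} f = max 0 (map f (allFin n))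

-- {p, q} = {u, v} as unordered pairs.
_≐_ : ∀ {n} → Rel (Fin n × Fin n) 0ℓ
(p , q) ≐ (u , v) = (p ≡ u × q ≡ v) ⊎ (p ≡ v × q ≡ u)

_≐?_ : ∀ {n} → Decidable₂ (_≐_ {n})
(p , q) ≐? (u , v) = (p ≟ u ×-dec q ≟ v) ⊎-dec (p ≟ v ×-dec q ≟ u)

≐-swapʳ : ∀ {n} {e : Fin n × Fin n} {u v} → e ≐ (u , v) → e ≐ (v , u)
≐-swapʳ (inj₁ x) = inj₂ x
≐-swapʳ (inj₂ x) = inj₁ x

≐-swapˡ : ∀ {n} {p q : Fin n} {e} → (p , q) ≐ e → (q , p) ≐ e
≐-swapˡ (inj₁ (x , y)) = inj₂ (y , x)
≐-swapˡ (inj₂ (x , y)) = inj₁ (y , x)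

≐-joinʳ : ∀ {n} {e f g : Fin n × Fin n} → e ≐ g → f ≐ g → e ≐ f
≐-joinʳ (inj₁ (refl , refl)) (inj₁ (refl , refl)) = inj₁ (refl , refl)
≐-joinʳ (inj₁ (refl , refl)) (inj₂ (refl , refl)) = inj₂ (refl , refl)
≐-joinʳ (inj₂ (refl , refl)) (inj₁ (refl , refl)) = inj₂ (refl , refl)
≐-joinʳ (inj₂ (refl , refl)) (inj₂ (refl , refl)) = inj₁ (refl , refl)

record Graph : Set₁ where
  field
    order  : ℕ
    Adj    : Rel (Fin order) 0ℓ
    adj?   : Decidable₂ Adj
    symm   : Symmetric Adj
    irrefl : ∀ {u} → ¬ Adj u u

record _≅_ (G H : Graph) : Set where
  field
    vertices : Fin (Graph.order G) ↔ Fin (Graph.order H)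
    edges    : ∀ u v → Graph.Adj G u v ⇔ Graph.Adj H (Inverse.to vertices u) (Inverse.to vertices v)

-- The new vertex is zero; an old vertex w becomes suc w.
SubdivAdj : (G : Graph) (u v : Fin (Graph.order G)) → Rel (Fin (suc (Graph.order G))) 0ℓ
SubdivAdj G u v zero    zero    = ⊥
SubdivAdj G u v zero    (suc q) = q ≡ u ⊎ q ≡ v
SubdivAdj G u v (suc p) zero    = p ≡ u ⊎ p ≡ v
SubdivAdj G u v (suc p) (suc q) = Graph.Adj G p q × ¬ ((p , q) ≐ (u , v))

subdivide : (G : Graph) (u v : Fin (Graph.order G)) → Graph
subdivide G u v = record
  { order  = suc (Graph.order G)
  ; Adj    = SubdivAdj G u v
  ; adj?   = dec
  ; symm   = λ {x} {y} → sy x y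
  ; irrefl = λ {x} → irr x
  }
  where
  dec : Decidable₂ (SubdivAdj G u v)
  dec zero    zero    = no λ ()
  dec zero    (suc q) = q ≟ u ⊎-dec q ≟ v
  dec (suc p) zero    = p ≟ u ⊎-dec p ≟ v
  dec (suc p) (suc q) = Graph.adj? G p q ×-dec ¬? ((p , q) ≐? (u , v))

  sy : ∀ x y → SubdivAdj G u v x y → SubdivAdj G u v y x
  sy zero    (suc q) h       = h
  sy (suc p) zero    h       = h
  sy (suc p) (suc q) (h , k) = Graph.symm G h , k ∘ ≐-swapˡ

  irr : ∀ x → ¬ SubdivAdj G u v x x
  irr (suc p) (h , _) = Graph.irrefl G h

data Subdivision (H : Graph) : Graph → Set₁ where
  none : Subdivision H H
  more : ∀ {F} → Subdivision H F → ∀ u v → Graph.Adj F u v →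
         Subdivision H (subdivide F u v)

_∈𝒮_ : Graph → Graph → Set₁
F ∈𝒮 H = ∃ λ F′ → Subdivision H F′ × F ≅ F′

data Side : Set where
  left right : Side

side : ∀ a b → Fin (a + b) → Side
side a b u = [ (λ _ → left) , (λ _ → right) ]′ (splitAt a u)

K : ℕ → ℕ → Graph
K a b = record
  { order  = a + b
  ; Adj    = λ u v → side a b u ≢ side a b v
  ; adj?   = λ u v → ¬? (side a b u ≟ₛ side a b v)
  ; symm   = λ ne eq → ne (sym eq)
  ; irrefl = λ ne → ne refl
  }
  where
  _≟ₛ_ : Decidable₂ {A = Side} _≡_
  left  ≟ₛ left  = yes refl
  left  ≟ₛ right = no λ ()
  right ≟ₛ left  = no λ ()
  right ≟ₛ right = yes refl

-- Color i is the set D_i of unordered pairs, given as a symmetric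
-- irreflexive relation.
record ColoredGraph (c : ℕ) : Set₁ where
  field
    order    : ℕ
    Color    : Fin c → Rel (Fin order) 0ℓ
    color?   : ∀ i → Decidable₂ (Color i)
    symm     : ∀ i → Symmetric (Color i)
    irrefl   : ∀ i {u} → ¬ Color i u u
    disjoint : ∀ {i j} → i ≢ j → ∀ {u v} → Color i u v → ¬ Color j u v

underlying : ∀ {c} → ColoredGraph c → Graph
underlying F = record
  { order  = order
  ; Adj    = λ u v → ∃ λ i → Color i u v
  ; adj?   = λ u v → any? λ i → color? i u v
  ; symm   = λ (i , h) → i , symm i h
  ; irrefl = λ (i , h) → irrefl i h
  }
  where open ColoredGraph F

_colorizes_ : ∀ {c} → ColoredGraph c → Graph → Set
Fᶜ colorizes F = underlying Fᶜ ≅ F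

ColoredDegree : ℕ → Set
ColoredDegree c = Vec ℕ c

-- The edges at u correspond to the neighbours of u, as graphs are simple.
coloredDegree : ∀ {c} (F : ColoredGraph c) → Fin (ColoredGraph.order F) → ColoredDegree c
coloredDegree F u = tabulate λ i → count (color? i u)
  where open ColoredGraph F

-- Multisets are lists, compared up to permutation.
DS : ∀ {c} → ColoredGraph c → List (ColoredDegree c)
DS F = map (coloredDegree F) (allFin (ColoredGraph.order F))

-- The vertices of the color-i subgraph are the ends of the color-i edges.
ColorConnected : ∀ {c} → ColoredGraph c → Fin c → Set
ColorConnected F i = ∀ {u u′ v v′} → Color i u u′ → Color i v v′ → Star (Color i) u v
  where open ColoredGraph F

_∈Δ : ∀ {c} → Pred (ColoredDegree c) 0ℓ
δ ∈Δ = ∃ λ i → Vec.lookup δ i ≡ 2 × (∀ j → j ≢ i → Vec.lookup δ j ≡ 0)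

record C* {c : ℕ} (M : List (ColoredDegree c)) (F : ColoredGraph c) : Set where
  field
    degrees   : ∃ λ X → All _∈Δ X × DS F ↭ M ++ X
    connected : ∀ i → ColorConnected F i

IsExtendedProfile : ∀ {c} → List (ColoredDegree c) → Graph → Set₁
IsExtendedProfile {c} M H =
  ∀ F → F ∈𝒮 H ⇔ ∃ λ (Fᶜ : ColoredGraph c) → Fᶜ colorizes F × C* M Fᶜ

-- One tuple for each i; they are pairwise distinct when b > 0.
M¹ : ∀ a (b : ℕ) → List (ColoredDegree a)
M¹ a b = map (λ i → tabulate λ j → if does (j ≟ i) then b else 0) (allFin a)

M² : ∀ a (b : ℕ) → List (ColoredDegree a)
M² a b = replicate b (Vec.replicate a 1)

M⟨_,_⟩ : ∀ a (b : ℕ) → List (ColoredDegree a)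
M⟨ a , b ⟩ = M¹ a b ++ M² a b

-- e₁, …, eₘ are indexed by Fin m; the orientation of each pair is arbitrary.
record EdgeOrdering (G : Graph) (m : ℕ) : Set where
  field
    ends     : Fin m → Fin (Graph.order G) × Fin (Graph.order G)
    isEdge   : ∀ k → uncurry (Graph.Adj G) (ends k)
    distinct : ∀ {k l} → ends k ≐ ends l → k ≡ l
    covers   : ∀ {u v} → Graph.Adj G u v → ∃ λ k → ends k ≐ (u , v)

  Incident : Fin (Graph.order G) → Pred (Fin m) 0ℓ
  Incident v k = v ≡ proj₁ (ends k) ⊎ v ≡ proj₂ (ends k)

  incident? : ∀ v → Decidable (Incident v)
  incident? v k = v ≟ proj₁ (ends k) ⊎-dec v ≟ proj₂ (ends k)

  Frontier : Fin m → Pred (Fin (Graph.order G)) 0ℓ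
  Frontier i v = (∃ λ k → k Fin.< i × Incident v k) × (∃ λ k → i Fin.≤ k × Incident v k)

  frontier? : ∀ i → Decidable (Frontier i)
  frontier? i v = any? (λ k → k <? i ×-dec incident? v k)
            ×-dec any? (λ k → i ≤? k ×-dec incident? v k)

  maxFrontier : ℕ
  maxFrontier = maximum λ i → count (frontier? i)

-- A c-colored subset over {e₁, …, eₘ}.
record ColoredSubset (c m : ℕ) : Set where
  field
    D        : Fin c → Subset m
    disjoint : ∀ {i j} → i ≢ j → ∀ {k} → k ∈ D i → k ∉ D j

-- All vertices of G, with the edges in D_i colored i.
spanning : ∀ {c m G} → EdgeOrdering G m → ColoredSubset c m → ColoredGraph c
spanning {G = G} O B = record
  { order    = Graph.order G
  ; Color    = λ i u v → ∃ λ k → k ∈ D i × ends k ≐ (u , v)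
  ; color?   = λ i u v → any? λ k → k ∈? D i ×-dec ends k ≐? (u , v)
  ; symm     = λ i (k , k∈ , h) → k , k∈ , ≐-swapʳ h
  ; irrefl   = λ i (k , _ , h) → irr k h
  ; disjoint = λ i≢j (k , k∈ , h) (l , l∈ , h′) →
                 disj i≢j k∈ l∈ (distinct (≐-joinʳ h h′))
  }
  where
  open EdgeOrdering O
  open ColoredSubset B

  irr : ∀ k {u} → ¬ (ends k ≐ (u , u))
  irr k (inj₁ (p , q)) = Graph.irrefl G (subst₂ (Graph.Adj G) p q (isEdge k))
  irr k (inj₂ (p , q)) = Graph.irrefl G (subst₂ (Graph.Adj G) p q (isEdge k))

  disj : ∀ {i j k l} → i ≢ j → k ∈ D i → l ∈ D j → ¬ (k ≡ l)
  disj i≢j k∈ l∈ refl = disjoint i≢j k∈ l∈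

-- Discards the isolated vertices and renumbers the others in increasing order.
dropIsolated : ∀ {c} → ColoredGraph c → ColoredGraph c
dropIsolated {c} F = record
  { order    = length endpoints
  ; Color    = λ i x y → Color i (vertex x) (vertex y)
  ; color?   = λ i x y → color? i (vertex x) (vertex y)
  ; symm     = λ i → symm i
  ; irrefl   = λ i → irrefl i
  ; disjoint = λ i≢j → disjoint i≢j
  }
  where
  open ColoredGraph F

  endpoints : List (Fin order)
  endpoints = filter (λ u → any? λ i → any? λ v → color? i u v) (allFin order)

  vertex : Fin (length endpoints) → Fin order
  vertex = lookup endpoints

edgeInduced : ∀ {c m G} → EdgeOrdering G m → ColoredSubset c m → ColoredGraph c
edgeInduced O B = dropIsolated (spanning O B)

data Node (N : ℕ) : Set where
  ⊤ₜ ⊥ₜ : Node N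
  inner : Fin N → Node N

-- A (c+1)-DD over {e₁, …, eₘ}. Acyclicity follows from `level`. The root may
-- be a terminal, as needed when m = 0; `unique` says that it is the only node,
-- terminals aside, without incoming arcs.
record DD (c m : ℕ) : Set where
  field
    size   : ℕ
    label  : Fin size → Fin m
    arc    : Fin size → Fin (suc c) → Node size
    level  : ∀ {α j β} → arc α j ≡ inner β → toℕ (label β) ≡ suc (toℕ (label α))
    root   : Node size
    unique : ∀ α → root ≡ inner α ⇔ (∀ β j → arc β j ≢ inner α)

  data Path : Node size → Set where
    end  : Path ⊤ₜ
    step : ∀ α j → Path (arc α j) → Path (inner α)

  Uses : ∀ {x} → Path x → Fin (suc c) → Fin m → Set
  Uses end          j k = ⊥
  Uses (step α i p) j k = (i ≡ j × label α ≡ k) ⊎ Uses p j k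

  _represents_ : Path root → ColoredSubset c m → Set
  p represents B = ∀ j k → k ∈ ColoredSubset.D B j ⇔ Uses p (suc j) k

  width : ℕ
  width = maximum λ k → count λ α → label α ≟ k

  RepresentsFamily : (ColoredSubset c m → Set) → Set
  RepresentsFamily P = ∀ B → (∃ λ (p : Path root) → p represents B) ⇔ P B

-- 2^{C a w log w} (2^a + ab)^w (b + 1). For w ≤ 1 both w log w and its rounded
-- version are 0, and log₂ w ≤ ⌈log₂ w⌉ ≤ 2 log₂ w for w ≥ 2, so the rounding only
-- affects the constant C.
widthBound : (C a b w : ℕ) → ℕ
widthBound C a b w = 2 ^ (C * (a * w * ⌈log₂ w ⌉)) * (2 ^ a + a * b) ^ w * (b + 1)

{-# OPTIONS --safe #-}

-- Extended profile. In a subdivision of K a b, color every edge by the left vertex whose star it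
-- subdivides. Conversely, let a colored graph have the prescribed degrees and connected colors. If
-- it has extra vertices, of degree in Δ beyond the profile, then some vertex of degree (1, …, 1) has
-- an extra neighbor y: otherwise a color at an extra vertex would have a component without extra
-- vertices. The two neighbors of y are not adjacent, so y can be suppressed, which keeps the degrees
-- and the connectedness; without extra vertices the graph is K a b by counting neighbors.
--
-- Decision diagram. The nodes at level i are the Nerode classes of the colorings of the edges before
-- the i-th that have an acceptable completion, so the width is bounded by the number of values of any
-- invariant that determines the class. For a frontier of size w ≥ 2 such an invariant consists of
-- the degrees at the frontier ((2 ^ a + a b) ^ w values, as a partial degree is a 0/1-vector or
-- concentrated on one color), the partition of the frontier by the components of each color
-- (w ^ (a w)), the number of finished vertices of degree (1, …, 1) modulo b + 1, and two bits for
-- each color: whether it has occurred and whether its center is finished. For w ≤ 1 the bound leaves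
-- no room for these bits. But then, if both the coloring so far and some completion of it are
-- nonempty, a single color passes through the only frontier vertex, and every other color lies
-- entirely on the side of the vertices of degree (1, …, 1); so the bits of the other colors are
-- determined, and the remaining one is absorbed by the degree code.

module Submission where

open import Data.Bool.Base using (if_then_else_)
open import Data.Empty using (⊥; ⊥-elim)
open import Data.Fin.Base as Fin using (Fin; zero; suc; toℕ; _↑ˡ_; _↑ʳ_; splitAt)
open import Data.Fin.Subset using (_∈_)
open import Data.Fin.Subset.Properties using (_∈?_)
open import Data.Fin.Properties as Fin using (any?; all?; _≟_; _<?_; _≤?_; injective⇒≤)
open import Data.List.Base as List using (List; []; _∷_; length; filter; map; allFin; lookup; replicate; _++_)
open import Data.List.Extrema.Nat using (max≤v⁺; xs≤max)
open import Data.List.Membership.Propositional using () renaming (_∈_ to _∈ₗ_)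
open import Data.List.Membership.Propositional.Properties using (∈-filter⁺; ∈-filter⁻; ∈-lookup; ∈-allFin; ∈-map⁺; ∈-∃++)
import Data.List.Properties as List
open import Data.List.Relation.Binary.Permutation.Propositional using (_↭_; ↭⇒↭ₛ; ↭-refl; ↭-sym; ↭-trans; ↭-prep; ↭-reflexive)
import Data.List.Relation.Binary.Permutation.Propositional.Properties as ↭
import Data.List.Relation.Binary.Permutation.Setoid.Properties as ↭ₛ
open import Data.List.Relation.Unary.All as All using (All; []; _∷_)
import Data.List.Relation.Unary.All.Properties as All
open import Data.List.Relation.Unary.AllPairs using ([]; _∷_)
open import Data.List.Relation.Unary.Any as Any using (Any; here; there)
import Data.List.Relation.Unary.Any.Properties as Any
open import Data.List.Relation.Unary.Unique.Propositional using (Unique)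
import Data.List.Relation.Unary.Unique.Propositional.Properties as Unique
open import Data.Nat.Base using (ℕ; zero; suc; _+_; _*_; _^_; _∸_; _≤_; _<_; z≤n; s≤s; ⌊_/2⌋; ⌈_/2⌉)
open import Data.Nat.DivMod using (_%_; m<n⇒m%n≡m; m%n<n)
open import Data.Nat.Induction using (<-wellFounded)
open import Data.Nat.Logarithm using (⌈log₂_⌉; ⌈log₂⌉-mono-≤; ⌈log₂⌈n/2⌉⌉≡⌈log₂n⌉∸1)
import Data.Nat.Properties as ℕ
open import Induction.WellFounded using (Acc; acc)
open import Data.Product.Base using (∃; ∃₂; _×_; _,_; proj₁; proj₂)
open import Data.Sum.Base using (_⊎_; inj₁; inj₂; [_,_]′)
open import Data.Unit.Base using (⊤; tt)
open import Data.Vec.Base as Vec using (Vec; tabulate)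
import Data.Vec.Properties as Vec
open import Function.Base using (_∘_; id; const)
open import Function.Bundles using (_⇔_; _↔_; Inverse; Equivalence; mk⇔; mk↔ₛ′)
open import Level using (0ℓ)
open import Relation.Binary.Construct.Closure.ReflexiveTransitive as Star using (Star; ε; _◅_; _◅◅_)
open import Relation.Binary.Core using (Rel)
open import Relation.Binary.Definitions using (Symmetric; Tri; tri<; tri≈; tri>) renaming (Decidable to Decidable₂)
open import Relation.Binary.PropositionalEquality using (_≡_; _≢_; refl; sym; trans; cong; cong₂; subst; subst₂; setoid; resp₂; ≢-sym; module ≡-Reasoning)
open import Relation.Nullary.Decidable using (Dec; does; _×-dec_; _⊎-dec_; _→-dec_; ¬?; yes; no; map′; decidable-stable)
open import Relation.Nullary.Negation using (¬_; contradiction)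
open import Relation.Unary using (Pred; Decidable)
open import Defs

-- Two coincidences of degrees shape both halves: for `b = 2` a center has a degree in Δ, and for
-- `a = b = 1` centers and units both have degree (1). Degrees therefore do not determine roles. The
-- profile half fixes a bijection between vertices and roles once and then argues with roles only;
-- the diagram half separates these cases when it compares multiplicities. The suppressed vertex is
-- chosen next to a unit because a unit has a single edge of each color. This makes the
-- non-adjacency of its two neighbors a local argument that does not pass through the color classes
-- being trees. Liveness is essential to the states: a component of the past that misses the
-- frontier leaves no trace at the frontier, and only an acceptable completion tells that it is
-- either absent or all of its color. Liveness also bounds the number of finished units by `b`, so
-- that the residue modulo `b + 1` is the number itself. Only for `a = b = 1` can two finished
-- vertices have degree (1), and there the center bit separates 0 from 2.

⇔-to : ∀ {A B : Set} → A ⇔ B → A → B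
⇔-to = Equivalence.to

⇔-from : ∀ {A B : Set} → A ⇔ B → B → A
⇔-from = Equivalence.from

-- Enumerating and counting decidable subsets of `Fin n`.

lookup-injective : ∀ {A : Set} {xs : List A} → Unique xs → ∀ {i j} → lookup xs i ≡ lookup xs j → i ≡ j
lookup-injective (_ ∷ _) {zero}  {zero}  _  = refl
lookup-injective {xs = _ ∷ xs} (px ∷ _) {zero}  {suc j} eq = contradiction eq (All.lookup px (∈-lookup j))
lookup-injective {xs = _ ∷ xs} (px ∷ _) {suc i} {zero}  eq = contradiction (sym eq) (All.lookup px (∈-lookup i))
lookup-injective (_ ∷ u) {suc i} {suc j} eq = cong suc (lookup-injective u eq)

module Enumeration {n} {P : Pred (Fin n) 0ℓ} (P? : Decidable P) where

  enum : Fin (count P?) → Fin n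
  enum = lookup (filter P? (allFin n))

  enum-injective : ∀ {i j} → enum i ≡ enum j → i ≡ j
  enum-injective = lookup-injective (Unique.filter⁺ P? (Unique.allFin⁺ n))

  enum-∈ : ∀ i → P (enum i)
  enum-∈ i = proj₂ (∈-filter⁻ P? {xs = allFin n} (∈-lookup i))

  index : ∀ {x} → P x → Fin (count P?)
  index {x} p = Any.index (∈-filter⁺ P? (∈-allFin x) p)

  enum-index : ∀ {x} (p : P x) → enum (index p) ≡ x
  enum-index {x} p = sym (Any.lookup-index (∈-filter⁺ P? (∈-allFin x) p))

count-inj : ∀ {m n} {P : Pred (Fin m) 0ℓ} {Q : Pred (Fin n) 0ℓ} (P? : Decidable P) (Q? : Decidable Q)
            (f : ∀ x → P x → Fin n) → (∀ x p → Q (f x p)) →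
            (∀ x y p q → f x p ≡ f y q → x ≡ y) → count P? ≤ count Q?
count-inj {m} {n} {P} {Q} P? Q? f fQ inj = injective⇒≤ {f = g} g-inj
  where
  g : Fin (count P?) → Fin (count Q?)
  g i = Enumeration.index Q? (fQ (Enumeration.enum P? i) (Enumeration.enum-∈ P? i))

  g-inj : ∀ {i j} → g i ≡ g j → i ≡ j
  g-inj {i} {j} eq = Enumeration.enum-injective P? (inj _ _ _ _
    (trans (sym (Enumeration.enum-index Q? _)) (trans (cong (Enumeration.enum Q?) eq) (Enumeration.enum-index Q? _))))

count-⊆ : ∀ {n} {P Q : Pred (Fin n) 0ℓ} (P? : Decidable P) (Q? : Decidable Q) →
          (∀ {x} → P x → Q x) → count P? ≤ count Q?
count-⊆ P? Q? h = count-inj P? Q? (λ x _ → x) (λ _ → h) (λ _ _ _ _ e → e)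

count-≐ : ∀ {n} {P Q : Pred (Fin n) 0ℓ} (P? : Decidable P) (Q? : Decidable Q) →
          (∀ {x} → P x → Q x) → (∀ {x} → Q x → P x) → count P? ≡ count Q?
count-≐ P? Q? h k = ℕ.≤-antisym (count-⊆ P? Q? h) (count-⊆ Q? P? k)

count-↔ : ∀ {m n} {P : Pred (Fin m) 0ℓ} {Q : Pred (Fin n) 0ℓ} (P? : Decidable P) (Q? : Decidable Q)
          (f : Fin m → Fin n) (g : Fin n → Fin m) → (∀ {x} → P x → Q (f x)) → (∀ {y} → Q y → P (g y)) →
          (∀ {x} → P x → g (f x) ≡ x) → (∀ {y} → Q y → f (g y) ≡ y) → count P? ≡ count Q?
count-↔ P? Q? f g fQ gP gf fg = ℕ.≤-antisym
  (count-inj P? Q? (λ x _ → f x) (λ _ → fQ) (λ x y p q e → trans (sym (gf p)) (trans (cong g e) (gf q))))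
  (count-inj Q? P? (λ x _ → g x) (λ _ → gP) (λ x y p q e → trans (sym (fg p)) (trans (cong f e) (fg q))))

count-full : ∀ n {P : Pred (Fin n) 0ℓ} (P? : Decidable P) → (∀ x → P x) → count P? ≡ n
count-full n P? all = trans (cong length (List.filter-all P? {xs = allFin n} (All.tabulate λ {x} _ → all x)))
  (List.length-tabulate {n = n} id)

count-∃ : ∀ {n} {P : Pred (Fin n) 0ℓ} (P? : Decidable P) → 1 ≤ count P? → ∃ P
count-∃ P? h with count P? in eq
... | suc k = _ , Enumeration.enum-∈ P? (subst Fin (sym eq) zero)

count-pos : ∀ {n} {P : Pred (Fin n) 0ℓ} (P? : Decidable P) {x} → P x → 1 ≤ count P?
count-pos P? p with count P? | Enumeration.index P? p
... | suc k | _ = s≤s z≤n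

count-none : ∀ {n} {P : Pred (Fin n) 0ℓ} (P? : Decidable P) → (∀ x → ¬ P x) → count P? ≡ 0
count-none P? empty with count P? in eq
... | zero  = refl
... | suc k = ⊥-elim (empty _ (Enumeration.enum-∈ P? (subst Fin (sym eq) zero)))

count-0 : ∀ {n} {P : Pred (Fin n) 0ℓ} (P? : Decidable P) → count P? ≡ 0 → ∀ {x} → ¬ P x
count-0 P? eq p with () ← subst (1 ≤_) eq (count-pos P? p)

-- `R` and `S` need only be equivalent to the two parts into which `Q` cuts `P`: the main use splits
-- a degree into past and future edges, which are not literally conjunctions.
count-split : ∀ {n} {P Q R S : Pred (Fin n) 0ℓ} (P? : Decidable P) (R? : Decidable R) (S? : Decidable S) (Q? : Decidable Q) →
              (∀ {x} → P x → Q x → R x) → (∀ {x} → P x → ¬ Q x → S x) →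
              (∀ {x} → R x → P x × Q x) → (∀ {x} → S x → P x × ¬ Q x) →
              count P? ≡ count R? + count S?
count-split {n} {P} {Q} {R} {S} P? R? S? Q? toR toS fromR fromS = go (allFin n)
  where
  go : ∀ xs → length (filter P? xs) ≡ length (filter R? xs) + length (filter S? xs)
  go [] = refl
  go (x ∷ xs) with P? x | R? x | S? x
  ... | yes p | yes r | yes s = contradiction (proj₂ (fromR r)) (proj₂ (fromS s))
  ... | yes p | yes r | no ¬s = cong suc (go xs)
  ... | yes p | no ¬r | yes s = trans (cong suc (go xs)) (sym (ℕ.+-suc _ _))
  ... | yes p | no ¬r | no ¬s = ⊥-elim (¬s (toS p λ q → ¬r (toR p q)))
  ... | no ¬p | yes r | _     = contradiction (proj₁ (fromR r)) ¬p
  ... | no ¬p | no ¬r | yes s = contradiction (proj₁ (fromS s)) ¬p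
  ... | no ¬p | no ¬r | no ¬s = go xs

count-remove : ∀ {n} {P : Pred (Fin n) 0ℓ} (P? : Decidable P) {x} → P x →
               count P? ≡ suc (count λ y → P? y ×-dec ¬? (y ≟ x))
count-remove {n} P? {x} p = trans
  (count-split P? (_≟ x) (λ y → P? y ×-dec ¬? (y ≟ x)) (_≟ x)
    (λ _ e → e) _,_ (λ { refl → p , refl }) id)
  (cong (_+ count (λ y → P? y ×-dec ¬? (y ≟ x))) one)
  where
  one : count (_≟ x) ≡ 1
  one = sym (count-↔ {1} {n} {λ _ → ⊤} (λ _ → yes tt) (_≟ x) (λ _ → x) (λ _ → zero)
          (λ _ → refl) (λ _ → tt) (λ { {zero} _ → refl }) sym)

count-1-unique : ∀ {n} {P : Pred (Fin n) 0ℓ} (P? : Decidable P) → count P? ≡ 1 → ∀ {x y} → P x → P y → y ≡ x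
count-1-unique P? eq {x} {y} p q with y ≟ x
... | yes e = e
... | no ne = contradiction (q , ne) (count-0 (λ y → P? y ×-dec ¬? (y ≟ x))
                (ℕ.suc-injective (trans (sym (count-remove P? p)) eq)))

count-≤1-unique : ∀ {n} {P : Pred (Fin n) 0ℓ} (P? : Decidable P) → count P? ≤ 1 → ∀ {x y} → P x → P y → y ≡ x
count-≤1-unique P? le p q = count-1-unique P? (ℕ.≤-antisym le (count-pos P? p)) p q

count-unique-1 : ∀ {n} {P : Pred (Fin n) 0ℓ} (P? : Decidable P) {x} → P x → (∀ {y} → P y → y ≡ x) → count P? ≡ 1
count-unique-1 P? {x} p u = trans (count-remove P? p)
  (cong suc (count-none (λ y → P? y ×-dec ¬? (y ≟ x)) λ y (q , ne) → ne (u q)))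

count-2 : ∀ {n} {P : Pred (Fin n) 0ℓ} (P? : Decidable P) → count P? ≡ 2 → ∀ {x} → P x →
          ∃ λ y → y ≢ x × P y × (∀ {z} → P z → z ≡ x ⊎ z ≡ y)
count-2 {n} {P} P? eq {x} p = y , ne , q , only
  where
  P′? = λ y → P? y ×-dec ¬? (y ≟ x)
  one : count P′? ≡ 1
  one = ℕ.suc-injective (trans (sym (count-remove P? p)) eq)
  hit = count-∃ P′? (ℕ.≤-reflexive (sym one))
  y  = proj₁ hit
  q  = proj₁ (proj₂ hit)
  ne = proj₂ (proj₂ hit)
  only : ∀ {z} → P z → z ≡ x ⊎ z ≡ y
  only {z} r with z ≟ x
  ... | yes e = inj₁ e
  ... | no ne′ = inj₂ (count-1-unique P′? one (q , ne) (r , ne′))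

count-two : ∀ {n} {P : Pred (Fin n) 0ℓ} (P? : Decidable P) {x y} → x ≢ y → P x → P y → 2 ≤ count P?
count-two P? {x} {y} ne p q = subst (2 ≤_) (sym (count-remove P? p))
  (s≤s (count-pos (λ z → P? z ×-dec ¬? (z ≟ x)) (q , ne ∘ sym)))

-- An element of `Q` missed by `P` would leave `P` inside a set with one element fewer than `Q`.
-- This pigeonhole argument compares the neighbors of a center with the units.
count-⊇ : ∀ {n} {P Q : Pred (Fin n) 0ℓ} (P? : Decidable P) (Q? : Decidable Q) →
          (∀ {x} → P x → Q x) → count Q? ≤ count P? → ∀ {x} → Q x → P x
count-⊇ P? Q? sub le {x} q with P? x
... | yes p = p
... | no ¬p = contradiction (subst (_≤ count P?) (count-remove Q? q) le)
                (ℕ.<⇒≱ (s≤s (count-⊆ P? _ λ p → sub p , λ { refl → ¬p p })))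

count-image : ∀ {m n} {P : Pred (Fin n) 0ℓ} (P? : Decidable P) (f : Fin m → Fin n) → (∀ {x y} → f x ≡ f y → x ≡ y) →
              (∀ x → P (f x)) → (∀ {y} → P y → ∃ λ x → f x ≡ y) → count P? ≡ m
count-image {m} P? f inj Pf onto = ℕ.≤-antisym
  (subst (count P? ≤_) full (count-inj P? (λ _ → yes tt) (λ _ → proj₁ ∘ onto) (λ _ _ → tt)
    λ x y p q e → trans (sym (proj₂ (onto p))) (trans (cong f e) (proj₂ (onto q)))))
  (subst (_≤ count P?) full (count-inj {P = λ _ → ⊤} (λ _ → yes tt) P? (λ x _ → f x) (λ x _ → Pf x) λ _ _ _ _ → inj))
  where
  full : count {m} {λ _ → ⊤} (λ _ → yes tt) ≡ m
  full = count-full m (λ _ → yes tt) λ _ → tt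

-- Colored graphs on a given number of vertices, and subdivision of a colored edge.

record Coloring (c n : ℕ) : Set₁ where
  field
    Color    : Fin c → Rel (Fin n) 0ℓ
    color?   : ∀ i → Decidable₂ (Color i)
    symm     : ∀ i → Symmetric (Color i)
    irrefl   : ∀ i {u} → ¬ Color i u u
    disjoint : ∀ {i j} → i ≢ j → ∀ {u v} → Color i u v → ¬ Color j u v

  degree : Fin c → Fin n → ℕ
  degree i u = count (color? i u)

  Connected : Fin c → Set
  Connected i = ∀ {u u′ v v′} → Color i u u′ → Color i v v′ → Star (Color i) u v

  pos-degree : ∀ {i u v} → Color i u v → degree i u ≢ 0
  pos-degree {i} {u} h eq = count-0 (color? i u) eq h

-- The order is a parameter of `Coloring` but a field of `ColoredGraph`: as a parameter it can be
-- given the forms `suc n` and `k + (a + b)` on which the constructions below rely.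
graph : ∀ {c n} → Coloring c n → ColoredGraph c
graph F = record { Coloring F }

coloring : ∀ {c} (F : ColoredGraph c) → Coloring c (ColoredGraph.order F)
coloring F = record { ColoredGraph F }


-- F arises from F′ by subdividing the color-i edge {u, v}; zero is the new vertex.
record _Subdivides_along_,_,_ {c n} (F : Coloring c (suc n)) (F′ : Coloring c n) (i : Fin c) (u v : Fin n) : Set where
  private
    module F  = Coloring F
    module F′ = Coloring F′
  field
    edge     : F′.Color i u v
    new      : ∀ {q} → F.Color i zero (suc q) ⇔ (q ≡ u ⊎ q ≡ v)
    new-else : ∀ {j x} → j ≢ i → ¬ F.Color j zero x
    old      : ∀ {p q} → F.Color i (suc p) (suc q) ⇔ (F′.Color i p q × ¬ (p , q) ≐ (u , v))
    old-else : ∀ {j p q} → j ≢ i → F.Color j (suc p) (suc q) ⇔ F′.Color j p q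

module Subdivided {c n} {F : Coloring c (suc n)} {F′ : Coloring c n} {i u v} (S : F Subdivides F′ along i , u , v) where
  private
    module F  = Coloring F
    module F′ = Coloring F′
  open _Subdivides_along_,_,_ S

  u≢v : u ≢ v
  u≢v refl = F′.irrefl i edge

  from-old : ∀ {j p q} → F.Color j (suc p) (suc q) → F′.Color j p q
  from-old {j} h with j ≟ i
  ... | yes refl = proj₁ (⇔-to old h)
  ... | no ne    = ⇔-to (old-else ne) h

  new-color : ∀ {j x} → F.Color j zero x → j ≡ i
  new-color {j} h with j ≟ i
  ... | yes e = e
  ... | no ne = contradiction h (new-else ne)

  degree-zero : F.degree i zero ≡ 2
  degree-zero = trans (count-remove (F.color? i zero) (⇔-from new (inj₁ refl)))
    (cong suc (count-unique-1 (λ y → F.color? i zero y ×-dec ¬? (y ≟ suc u)) (⇔-from new (inj₂ refl) , λ { refl → u≢v refl }) only))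
    where
    only : ∀ {y} → F.Color i zero y × y ≢ suc u → y ≡ suc v
    only {zero}  (h , _)  = ⊥-elim (F.irrefl i h)
    only {suc q} (h , ne) with ⇔-to new h
    ... | inj₁ refl = ⊥-elim (ne refl)
    ... | inj₂ refl = refl

  degree-zero-else : ∀ {j} → j ≢ i → F.degree j zero ≡ 0
  degree-zero-else ne = count-none (F.color? _ zero) λ x → new-else ne

  -- At an end of the subdivided edge the new vertex replaces the other end as a neighbor, and all
  -- other neighbors stay; `f` and `g` are this replacement.
  degree-suc : ∀ j p → F.degree j (suc p) ≡ F′.degree j p
  degree-suc j p = count-↔ (F.color? j (suc p)) (F′.color? j p) f g fQ gP gf fg
    where
    -- The other end of the edge if `p` is an end. For the remaining `p` the value is a default: by
    -- `at-new`, only ends have `zero` as a neighbor.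
    w : Fin n
    w = if does (p ≟ u) then v else u

    w-end : (p , w) ≐ (u , v) ⊎ p ≢ u × p ≢ v
    w-end with p ≟ u
    ... | yes refl = inj₁ (inj₁ (refl , refl))
    ... | no ne with p ≟ v
    ... | yes refl = inj₁ (inj₂ (refl , refl))
    ... | no ne′ = inj₂ (ne , ne′)

    w-unique : ∀ {q} → (p , q) ≐ (u , v) → w ≡ q
    w-unique h with p ≟ u
    w-unique (inj₁ (e , f)) | yes _ = sym f
    w-unique (inj₂ (e , f)) | yes refl = contradiction e u≢v
    w-unique (inj₁ (e , f)) | no ne = contradiction e ne
    w-unique (inj₂ (e , f)) | no _ = sym f

    subdivided? : ∀ q → Dec (j ≡ i × (p , q) ≐ (u , v))
    subdivided? q = j ≟ i ×-dec (p , q) ≐? (u , v)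

    f : Fin (suc n) → Fin n
    f zero    = w
    f (suc q) = q

    g : Fin n → Fin (suc n)
    g q with subdivided? q
    ... | yes _ = zero
    ... | no _  = suc q

    edge≐ : ∀ {q} → (p , q) ≐ (u , v) → F′.Color i p q
    edge≐ (inj₁ (refl , refl)) = edge
    edge≐ (inj₂ (refl , refl)) = F′.symm i edge

    at-new : F.Color j (suc p) zero → j ≡ i × (p , w) ≐ (u , v)
    at-new h with new-color (F.symm j h)
    ... | refl with w-end
    ... | inj₁ e = refl , e
    ... | inj₂ (ne , ne′) with ⇔-to new (F.symm i h)
    ... | inj₁ e = contradiction e ne
    ... | inj₂ e = contradiction e ne′

    fQ : ∀ {x} → F.Color j (suc p) x → F′.Color j p (f x)
    fQ {zero} h with at-new h
    ... | refl , e = edge≐ e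
    fQ {suc q} h = from-old h

    gP : ∀ {q} → F′.Color j p q → F.Color j (suc p) (g q)
    gP {q} h with subdivided? q
    ... | yes (refl , inj₁ (refl , _)) = F.symm i (⇔-from new (inj₁ refl))
    ... | yes (refl , inj₂ (refl , _)) = F.symm i (⇔-from new (inj₂ refl))
    ... | no ¬s with j ≟ i
    ... | yes refl = ⇔-from old (h , λ e → ¬s (refl , e))
    ... | no ne = ⇔-from (old-else ne) h

    gf : ∀ {x} → F.Color j (suc p) x → g (f x) ≡ x
    gf {zero} h with subdivided? w
    ... | yes _ = refl
    ... | no ¬s = contradiction (at-new h) ¬s
    gf {suc q} h with subdivided? q
    ... | no _ = refl
    ... | yes (refl , e) = contradiction e (proj₂ (⇔-to old h))

    fg : ∀ {q} → F′.Color j p q → f (g q) ≡ q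
    fg {q} h with subdivided? q
    ... | yes (_ , e) = w-unique e
    ... | no _ = refl

  expand : ∀ j {p q} → F′.Color j p q → Star (F.Color j) (suc p) (suc q)
  expand j {p} {q} h with j ≟ i
  ... | no ne = ⇔-from (old-else ne) h ◅ ε
  ... | yes refl with (p , q) ≐? (u , v)
  ... | no ne = ⇔-from old (h , ne) ◅ ε
  ... | yes (inj₁ (refl , refl)) = F.symm i (⇔-from new (inj₁ refl)) ◅ ⇔-from new (inj₂ refl) ◅ ε
  ... | yes (inj₂ (refl , refl)) = F.symm i (⇔-from new (inj₂ refl)) ◅ ⇔-from new (inj₁ refl) ◅ ε

  expands : ∀ j {p q} → Star (F′.Color j) p q → Star (F.Color j) (suc p) (suc q)
  expands j ε       = ε
  expands j (h ◅ s) = expand j h ◅◅ expands j s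

  -- Sending the new vertex to `u` contracts the half edge between them, so each edge becomes an
  -- edge or an empty path.
  retract : Fin (suc n) → Fin n
  retract zero    = u
  retract (suc p) = p

  contract : ∀ j {x y} → F.Color j x y → Star (F′.Color j) (retract x) (retract y)
  contract j {zero}  {zero}  h = ε
  contract j {zero}  {suc q} h with new-color h
  ... | refl with ⇔-to new h
  ... | inj₁ refl = ε
  ... | inj₂ refl = edge ◅ ε
  contract j {suc p} {zero}  h with new-color (F.symm j h)
  ... | refl with ⇔-to new (F.symm j h)
  ... | inj₁ refl = ε
  ... | inj₂ refl = F′.symm i edge ◅ ε
  contract j {suc p} {suc q} h = from-old h ◅ ε

  contracts : ∀ j {x y} → Star (F.Color j) x y → Star (F′.Color j) (retract x) (retract y)
  contracts j ε       = ε
  contracts j (h ◅ s) = contract j h ◅◅ contracts j s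

  -- A path may start or end at the new vertex, which has no counterpart in `F′`. So `touch` first
  -- moves each end to an old vertex touched by the same color, with paths in both directions.
  connected-up : ∀ j → F′.Connected j → F.Connected j
  connected-up j conn {x} {x′} {y} {y′} h k with touch h | touch k
    where
    touch : ∀ {x x′} → F.Color j x x′ → ∃₂ λ p p′ → F′.Color j p p′ × Star (F.Color j) x (suc p) × Star (F.Color j) (suc p) x
    touch {zero} h with new-color h
    ... | refl = u , v , edge , ⇔-from new (inj₁ refl) ◅ ε , F.symm i (⇔-from new (inj₁ refl)) ◅ ε
    touch {suc p} {suc q} h = p , q , from-old h , ε , ε
    touch {suc p} {zero} h with new-color (F.symm j h)
    ... | refl with ⇔-to new (F.symm j h)
    ... | inj₁ refl = u , v , edge , ε , ε
    ... | inj₂ refl = v , u , F′.symm i edge , ε , ε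
  ... | _ , _ , hp , to , _ | _ , _ , hq , _ , from = to ◅◅ expands j (conn hp hq) ◅◅ from

  connected-down : ∀ j → F.Connected j → F′.Connected j
  connected-down j conn h k = contracts j (conn (proj₂ (touch h)) (proj₂ (touch k)))
    where
    touch : ∀ {p p′} → F′.Color j p p′ → ∃ λ x → F.Color j (suc p) x
    touch h with expand j h
    ... | e ◅ _ = _ , e
    ... | ε = ⊥-elim (F′.irrefl j h)

-- Isomorphisms of graphs and of colorings

module _ {n m : ℕ} where
  ↔-to : Fin n ↔ Fin m → Fin n → Fin m
  ↔-to = Inverse.to

  ↔-from : Fin n ↔ Fin m → Fin m → Fin n
  ↔-from = Inverse.from

  to-from : ∀ (π : Fin n ↔ Fin m) y → ↔-to π (↔-from π y) ≡ y
  to-from π y = Inverse.inverseˡ π refl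

  from-to : ∀ (π : Fin n ↔ Fin m) x → ↔-from π (↔-to π x) ≡ x
  from-to π x = Inverse.inverseʳ π refl

≅-sym : ∀ {G H} → G ≅ H → H ≅ G
≅-sym {G} {H} I = record
  { vertices = mk↔ₛ′ (↔-from π) (↔-to π) (from-to π) (to-from π)
  ; edges = λ u v → mk⇔
      (λ h → ⇔-from (edges _ _) (subst₂ (Graph.Adj H) (sym (to-from π u)) (sym (to-from π v)) h))
      (λ h → subst₂ (Graph.Adj H) (to-from π u) (to-from π v) (⇔-to (edges _ _) h)) }
  where open _≅_ I renaming (vertices to π)

≅-trans : ∀ {G H J} → G ≅ H → H ≅ J → G ≅ J
≅-trans I J = record
  { vertices = mk↔ₛ′ (↔-to ρ ∘ ↔-to π) (↔-from π ∘ ↔-from ρ)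
      (λ y → trans (cong (↔-to ρ) (to-from π _)) (to-from ρ y))
      (λ x → trans (cong (↔-from π) (from-to ρ _)) (from-to π x))
  ; edges = λ u v → mk⇔ (⇔-to (_≅_.edges J _ _) ∘ ⇔-to (_≅_.edges I u v)) (⇔-from (_≅_.edges I u v) ∘ ⇔-from (_≅_.edges J _ _)) }
  where π = _≅_.vertices I ; ρ = _≅_.vertices J

subdivide-≅ : ∀ {G H} (I : G ≅ H) u v → subdivide G u v ≅ subdivide H (↔-to (_≅_.vertices I) u) (↔-to (_≅_.vertices I) v)
subdivide-≅ {G} {H} I u v = record
  { vertices = mk↔ₛ′ (lift (↔-to π)) (lift (↔-from π))
      (λ { zero → refl ; (suc y) → cong suc (to-from π y) })
      (λ { zero → refl ; (suc x) → cong suc (from-to π x) })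
  ; edges = λ x y → mk⇔ (forth x y) (back x y) }
  where
  open _≅_ I renaming (vertices to π)
  lift : ∀ {n m} → (Fin n → Fin m) → Fin (suc n) → Fin (suc m)
  lift f zero    = zero
  lift f (suc x) = suc (f x)

  inj : ∀ {x y} → ↔-to π x ≡ ↔-to π y → x ≡ y
  inj {x} {y} e = trans (sym (from-to π x)) (trans (cong (↔-from π) e) (from-to π y))

  forth : ∀ x y → SubdivAdj G u v x y → SubdivAdj H _ _ (lift (↔-to π) x) (lift (↔-to π) y)
  forth zero    (suc q) (inj₁ refl) = inj₁ refl
  forth zero    (suc q) (inj₂ refl) = inj₂ refl
  forth (suc p) zero    (inj₁ refl) = inj₁ refl
  forth (suc p) zero    (inj₂ refl) = inj₂ refl
  forth (suc p) (suc q) (h , k) = ⇔-to (edges p q) h , λ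
    { (inj₁ (e , f)) → k (inj₁ (inj e , inj f)) ; (inj₂ (e , f)) → k (inj₂ (inj e , inj f)) }

  back : ∀ x y → SubdivAdj H _ _ (lift (↔-to π) x) (lift (↔-to π) y) → SubdivAdj G u v x y
  back zero    (suc q) (inj₁ e) = inj₁ (inj e)
  back zero    (suc q) (inj₂ e) = inj₂ (inj e)
  back (suc p) zero    (inj₁ e) = inj₁ (inj e)
  back (suc p) zero    (inj₂ e) = inj₂ (inj e)
  back (suc p) (suc q) (h , k) = ⇔-from (edges p q) h , λ
    { (inj₁ (refl , refl)) → k (inj₁ (refl , refl)) ; (inj₂ (refl , refl)) → k (inj₂ (refl , refl)) }

-- Only color `i` loses the pair {u, v}; since colors are disjoint, no other color contains it, and
-- so the underlying graph loses it too.
underlying-subdivided : ∀ {c n} {F : Coloring c (suc n)} {F′ : Coloring c n} {i u v} →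
  F Subdivides F′ along i , u , v → underlying (graph F) ≅ subdivide (underlying (graph F′)) u v
underlying-subdivided {F = F} {F′} {i} {u} {v} S = record
  { vertices = mk↔ₛ′ id id (λ _ → refl) (λ _ → refl) ; edges = λ x y → mk⇔ (forth x y) (back x y) }
  where
  module F  = Coloring F
  module F′ = Coloring F′
  open _Subdivides_along_,_,_ S
  open Subdivided S
  forth : ∀ x y → Graph.Adj (underlying (graph F)) x y → SubdivAdj (underlying (graph F′)) u v x y
  forth zero    zero    (j , h) = F.irrefl j h
  forth zero    (suc q) (j , h) with new-color h
  ... | refl = ⇔-to new h
  forth (suc p) zero    (j , h) with new-color (F.symm j h)
  ... | refl = ⇔-to new (F.symm j h)
  forth (suc p) (suc q) (j , h) = (j , from-old h) , λ e → ¬edge e h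
    where
    ¬edge : (p , q) ≐ (u , v) → ¬ F.Color j (suc p) (suc q)
    ¬edge e h with j ≟ i
    ... | yes refl = proj₂ (⇔-to old h) e
    ¬edge (inj₁ (refl , refl)) h | no ne = F′.disjoint ne (from-old h) edge
    ¬edge (inj₂ (refl , refl)) h | no ne = F′.disjoint ne (from-old h) (F′.symm i edge)

  back : ∀ x y → SubdivAdj (underlying (graph F′)) u v x y → Graph.Adj (underlying (graph F)) x y
  back zero    (suc q) h = i , ⇔-from new h
  back (suc p) zero    h = i , F.symm i (⇔-from new h)
  back (suc p) (suc q) ((j , h) , k) with j ≟ i
  ... | yes refl = i , ⇔-from old (h , k)
  ... | no ne = j , ⇔-from (old-else ne) h

-- Subdividing a colored edge, and suppressing a vertex.

module _ {c n} (F : Coloring c n) where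
  open Coloring F

  subdivideᶜ : ∀ {i u v} → Color i u v → Coloring c (suc n)
  subdivideᶜ {i} {u} {v} uv = record
    { Color    = C
    ; color?   = dec
    ; symm     = λ j {x} {y} → sy j x y
    ; irrefl   = λ j {x} → irr j x
    ; disjoint = λ ne {x} {y} → dis ne x y }
    where
    C : Fin c → Rel (Fin (suc n)) 0ℓ
    C j zero    zero    = ⊥
    C j zero    (suc q) = j ≡ i × (q ≡ u ⊎ q ≡ v)
    C j (suc p) zero    = j ≡ i × (p ≡ u ⊎ p ≡ v)
    -- The pair is taken out of all colors uniformly. By disjointness this changes color `i` only,
    -- which is what `old-else` checks.
    C j (suc p) (suc q) = Color j p q × ¬ (p , q) ≐ (u , v)

    dec : ∀ j → Decidable₂ (C j)
    dec j zero    zero    = no λ ()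
    dec j zero    (suc q) = j ≟ i ×-dec (q ≟ u ⊎-dec q ≟ v)
    dec j (suc p) zero    = j ≟ i ×-dec (p ≟ u ⊎-dec p ≟ v)
    dec j (suc p) (suc q) = color? j p q ×-dec ¬? ((p , q) ≐? (u , v))

    sy : ∀ j x y → C j x y → C j y x
    sy j zero    (suc q) h = h
    sy j (suc p) zero    h = h
    sy j (suc p) (suc q) (h , k) = symm j h , k ∘ ≐-swapˡ

    irr : ∀ j x → ¬ C j x x
    irr j (suc p) (h , _) = irrefl j h

    dis : ∀ {i j} → i ≢ j → ∀ x y → C i x y → ¬ C j x y
    dis ne zero    (suc q) (refl , _) (refl , _) = ne refl
    dis ne (suc p) zero    (refl , _) (refl , _) = ne refl
    dis ne (suc p) (suc q) (h , _) (k , _) = disjoint ne h k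

  subdivideᶜ-subdivides : ∀ {i u v} (uv : Color i u v) → subdivideᶜ uv Subdivides F along i , u , v
  subdivideᶜ-subdivides {i} {u} {v} uv = record
    { edge     = uv
    ; new      = mk⇔ proj₂ (refl ,_)
    ; new-else = λ { {x = suc q} ne (e , _) → ne e }
    ; old      = mk⇔ id id
    ; old-else = λ ne → mk⇔ proj₁ λ h → h , λ
        { (inj₁ (refl , refl)) → disjoint ne h uv ; (inj₂ (refl , refl)) → disjoint ne h (symm i uv) } }

-- `nonadj` ranges over all colors: an edge {u, v} of color `i` would merge with the restored edge,
-- and one of another color would violate disjointness.
module Unsubdivide {c n} (F : Coloring c (suc n)) {i : Fin c} {u v : Fin n}
  (zu : Coloring.Color F i zero (suc u)) (zv : Coloring.Color F i zero (suc v)) (u≢v : u ≢ v)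
  (only : ∀ {j q} → Coloring.Color F j zero (suc q) → j ≡ i × (q ≡ u ⊎ q ≡ v))
  (nonadj : ∀ {j} → ¬ Coloring.Color F j (suc u) (suc v)) where
  open Coloring F

  private
    ¬uv : ∀ {j p q} → Color j (suc p) (suc q) → ¬ (p , q) ≐ (u , v)
    ¬uv h (inj₁ (refl , refl)) = nonadj h
    ¬uv h (inj₂ (refl , refl)) = nonadj (symm _ h)

  unsubdivide : Coloring c n
  unsubdivide = record
    { Color    = λ j p q → Color j (suc p) (suc q) ⊎ j ≡ i × (p , q) ≐ (u , v)
    ; color?   = λ j p q → color? j (suc p) (suc q) ⊎-dec (j ≟ i ×-dec (p , q) ≐? (u , v))
    ; symm     = λ j → λ { (inj₁ h) → inj₁ (symm j h) ; (inj₂ (e , h)) → inj₂ (e , ≐-swapˡ h) }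
    ; irrefl   = λ j → λ { (inj₁ h) → irrefl j h ; (inj₂ (_ , inj₁ (refl , refl))) → u≢v refl ; (inj₂ (_ , inj₂ (refl , refl))) → u≢v refl }
    ; disjoint = λ ne → λ
        { (inj₁ h) (inj₁ k) → disjoint ne h k
        ; (inj₁ h) (inj₂ (_ , e)) → ¬uv h e
        ; (inj₂ (_ , e)) (inj₁ k) → ¬uv k e
        ; (inj₂ (refl , _)) (inj₂ (refl , _)) → ne refl } }

  subdivides-unsubdivide : F Subdivides unsubdivide along i , u , v
  subdivides-unsubdivide = record
    { edge     = inj₂ (refl , inj₁ (refl , refl))
    ; new      = mk⇔ (proj₂ ∘ only) λ { (inj₁ refl) → zu ; (inj₂ refl) → zv }
    ; new-else = λ { {x = zero} ne h → irrefl _ h ; {x = suc q} ne h → ne (proj₁ (only h)) }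
    ; old      = mk⇔ (λ h → inj₁ h , ¬uv h) λ { (inj₁ h , _) → h ; (inj₂ (_ , e) , ne) → ⊥-elim (ne e) }
    ; old-else = λ ne → mk⇔ inj₁ λ { (inj₁ h) → h ; (inj₂ (e , _)) → ⊥-elim (ne e) } }

-- Colored degrees

module _ {c : ℕ} where
  -- Written with the same conditional as `M¹`, so that `M¹ a b` is `map (mono b) (allFin a)` by
  -- computation. For `t = 2` these are the elements of Δ.
  mono : ℕ → Fin c → ColoredDegree c
  mono t i = tabulate λ j → if does (j ≟ i) then t else 0

  ones : ColoredDegree c
  ones = Vec.replicate c 1

  lookup-mono : ∀ t i → Vec.lookup (mono t i) i ≡ t
  lookup-mono t i with i ≟ i | Vec.lookup∘tabulate (λ j → if does (j ≟ i) then t else 0) i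
  ... | yes _ | e = e
  ... | no ne | _ = ⊥-elim (ne refl)

  lookup-mono-else : ∀ t {i j} → j ≢ i → Vec.lookup (mono t i) j ≡ 0
  lookup-mono-else t {i} {j} ne with j ≟ i | Vec.lookup∘tabulate (λ j → if does (j ≟ i) then t else 0) j
  ... | yes e | _ = ⊥-elim (ne e)
  ... | no _  | e = e

  lookup-ones : ∀ i → Vec.lookup ones i ≡ 1
  lookup-ones i = Vec.lookup-replicate i 1

  vec-ext : ∀ {x y : ColoredDegree c} → (∀ i → Vec.lookup x i ≡ Vec.lookup y i) → x ≡ y
  vec-ext {x} {y} h = trans (sym (Vec.tabulate∘lookup x)) (trans (Vec.tabulate-cong h) (Vec.tabulate∘lookup y))

  is-mono : ∀ {x : ColoredDegree c} {t} i → Vec.lookup x i ≡ t → (∀ j → j ≢ i → Vec.lookup x j ≡ 0) → x ≡ mono t i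
  is-mono {x} {t} i e z = vec-ext h
    where
    h : ∀ j → Vec.lookup x j ≡ Vec.lookup (mono t i) j
    h j with j ≟ i
    ... | yes refl = trans e (sym (lookup-mono t i))
    ... | no ne = trans (z j ne) (sym (lookup-mono-else t ne))

  mono∈Δ : ∀ i → mono 2 i ∈Δ
  mono∈Δ i = i , lookup-mono 2 i , λ j → lookup-mono-else 2

  lookup-degree : ∀ {n} (F : Coloring c n) u i → Vec.lookup (coloredDegree (graph F) u) i ≡ Coloring.degree F i u
  lookup-degree F u i = Vec.lookup∘tabulate _ i

map-allFin-+ : ∀ {A : Set} a b (f : Fin (a + b) → A) →
               map f (allFin (a + b)) ≡ map (f ∘ (_↑ˡ b)) (allFin a) ++ map (f ∘ (a ↑ʳ_)) (allFin b)
map-allFin-+ a b f = begin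
  map f (allFin (a + b))                                          ≡⟨ List.map-tabulate id f ⟩
  List.tabulate f                                                 ≡⟨ go a f ⟩
  List.tabulate (f ∘ (_↑ˡ b)) ++ List.tabulate (f ∘ (a ↑ʳ_))      ≡⟨ cong₂ _++_ (List.map-tabulate id (f ∘ (_↑ˡ b))) (List.map-tabulate id (f ∘ (a ↑ʳ_))) ⟨
  map (f ∘ (_↑ˡ b)) (allFin a) ++ map (f ∘ (a ↑ʳ_)) (allFin b)    ∎
  where
  open ≡-Reasoning
  go : ∀ {A : Set} a (f : Fin (a + b) → A) → List.tabulate f ≡ List.tabulate (f ∘ (_↑ˡ b)) ++ List.tabulate (f ∘ (a ↑ʳ_))
  go zero    f = refl
  go (suc a) f = cong (f zero ∷_) (go a (f ∘ suc))

map-const : ∀ {A : Set} (x : A) n → map (const x) (allFin n) ≡ replicate n x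
map-const x n = trans (List.map-tabulate {n = n} id (const x)) (go n)
  where
  go : ∀ n → List.tabulate {n = n} (const x) ≡ replicate n x
  go zero    = refl
  go (suc n) = cong (x ∷_) (go n)

↑ˡ≢↑ʳ : ∀ {a b} (i : Fin a) (l : Fin b) → i ↑ˡ b ≢ a ↑ʳ l
↑ˡ≢↑ʳ {a} {b} i l e with () ← trans (sym (Fin.splitAt-↑ˡ a i b)) (trans (cong (splitAt a) e) (Fin.splitAt-↑ʳ a b l))

-- The numbering of vertices by role: `k` extra vertices, then the `a` centers, then the `b` units.
-- Extra vertices come first so that suppressing vertex `zero` turns `suc k` into `k` by
-- computation; for `k = 0` this is the numbering of `K a b`.
data Kind (k a b : ℕ) : Fin (k + (a + b)) → Set where
  extra  : ∀ (x : Fin k) → Kind k a b (x ↑ˡ (a + b))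
  center : ∀ i → Kind k a b (k ↑ʳ (i ↑ˡ b))
  unit   : ∀ l → Kind k a b (k ↑ʳ (a ↑ʳ l))

kind : ∀ k a b x → Kind k a b x
kind k a b x with splitAt k x in e
... | inj₁ y rewrite sym (Fin.splitAt⁻¹-↑ˡ e) = extra y
... | inj₂ y with splitAt a y in e′
... | inj₁ i rewrite sym (Fin.splitAt⁻¹-↑ʳ e) | sym (Fin.splitAt⁻¹-↑ˡ e′) = center i
... | inj₂ l rewrite sym (Fin.splitAt⁻¹-↑ʳ e) | sym (Fin.splitAt⁻¹-↑ʳ e′) = unit l

side-↑ˡ : ∀ a b i → side a b (i ↑ˡ b) ≡ left
side-↑ˡ a b i rewrite Fin.splitAt-↑ˡ a i b = refl

side-↑ʳ : ∀ a b l → side a b (a ↑ʳ l) ≡ right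
side-↑ʳ a b l rewrite Fin.splitAt-↑ʳ a b l = refl

-- The coloring of K a b in which the edges at the i-th left vertex get color i.
module _ (a b : ℕ) where
  StarColor : Fin a → Rel (Fin (a + b)) 0ℓ
  StarColor i u v = (u ≡ i ↑ˡ b × side a b v ≡ right) ⊎ (v ≡ i ↑ˡ b × side a b u ≡ right)

  private
    left≢right : ∀ {i : Fin a} → side a b (i ↑ˡ b) ≢ right
    left≢right {i} e with () ← trans (sym (side-↑ˡ a b i)) e

    right⇒↑ʳ : ∀ y → side a b y ≡ right → ∃ λ l → a ↑ʳ l ≡ y
    right⇒↑ʳ y e with kind 0 a b y
    ... | center i = contradiction e left≢right
    ... | unit l   = l , refl

    right? : ∀ s → Dec (s ≡ right)
    right? left  = no λ ()
    right? right = yes refl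

  starColoring : Coloring a (a + b)
  starColoring = record
    { Color    = StarColor
    ; color?   = λ i u v → (u ≟ i ↑ˡ b ×-dec right? (side a b v)) ⊎-dec (v ≟ i ↑ˡ b ×-dec right? (side a b u))
    ; symm     = λ i → λ { (inj₁ h) → inj₂ h ; (inj₂ h) → inj₁ h }
    ; irrefl   = λ i → λ { (inj₁ (refl , e)) → left≢right {i} e ; (inj₂ (refl , e)) → left≢right {i} e }
    ; disjoint = λ ne → λ
        { (inj₁ (refl , _)) (inj₁ (e , _)) → ne (Fin.↑ˡ-injective b _ _ e)
        ; (inj₁ (refl , _)) (inj₂ (_ , e)) → left≢right e
        ; (inj₂ (refl , _)) (inj₁ (_ , e)) → left≢right e
        ; (inj₂ (refl , _)) (inj₂ (e , _)) → ne (Fin.↑ˡ-injective b _ _ e) } }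

  open Coloring starColoring using (degree; Connected)

  star-edge : ∀ {i l} → StarColor i (a ↑ʳ l) (i ↑ˡ b)
  star-edge {i} {l} = inj₂ (refl , side-↑ʳ a b l)

  star-nbr : ∀ {i l v} → StarColor i (a ↑ʳ l) v → v ≡ i ↑ˡ b
  star-nbr {i} {l} (inj₁ (e , _)) = contradiction (sym e) (↑ˡ≢↑ʳ i l)
  star-nbr (inj₂ (e , _)) = e

  star-degree-center : ∀ i → degree i (i ↑ˡ b) ≡ b
  star-degree-center i = count-image (Coloring.color? starColoring i (i ↑ˡ b)) (a ↑ʳ_) (Fin.↑ʳ-injective a _ _)
    (λ l → inj₁ (refl , side-↑ʳ a b l)) λ
      { {y} (inj₁ (_ , e)) → right⇒↑ʳ y e
      ; (inj₂ (_ , e)) → contradiction e left≢right }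

  star-degree-center-else : ∀ {i j} → j ≢ i → degree j (i ↑ˡ b) ≡ 0
  star-degree-center-else {i} {j} ne = count-none (Coloring.color? starColoring j (i ↑ˡ b)) λ
    { y (inj₁ (e , _)) → ne (sym (Fin.↑ˡ-injective b i j e))
    ; y (inj₂ (_ , e)) → left≢right e }

  star-degree-unit : ∀ i l → degree i (a ↑ʳ l) ≡ 1
  star-degree-unit i l = count-unique-1 (Coloring.color? starColoring i (a ↑ʳ l)) (star-edge {i} {l}) (star-nbr {i} {l})

  star-DS : DS (graph starColoring) ≡ M⟨ a , b ⟩
  star-DS = begin
    map deg (allFin (a + b))
      ≡⟨ map-allFin-+ a b deg ⟩
    map (deg ∘ (_↑ˡ b)) (allFin a) ++ map (deg ∘ (a ↑ʳ_)) (allFin b)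
      ≡⟨ cong₂ _++_ (List.map-cong deg-center (allFin a)) (trans (List.map-cong deg-unit (allFin b)) (map-const ones b)) ⟩
    M⟨ a , b ⟩ ∎
    where
    open ≡-Reasoning
    deg = coloredDegree (graph starColoring)
    deg-center : ∀ i → deg (i ↑ˡ b) ≡ mono b i
    deg-center i = is-mono i (trans (lookup-degree starColoring _ i) (star-degree-center i))
      λ j ne → trans (lookup-degree starColoring _ j) (star-degree-center-else ne)
    deg-unit : ∀ l → deg (a ↑ʳ l) ≡ ones
    deg-unit l = vec-ext λ i → trans (lookup-degree starColoring _ i) (trans (star-degree-unit i l) (sym (lookup-ones i)))

  star-connected : ∀ i → Connected i
  star-connected i h k = to-center h ◅◅ Star.reverse (Coloring.symm starColoring i) (to-center k)
    where
    to-center : ∀ {u v} → StarColor i u v → Star (StarColor i) u (i ↑ˡ b)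
    to-center (inj₁ (refl , _)) = ε
    to-center (inj₂ (refl , e)) = inj₂ (refl , e) ◅ ε

  underlying-star : ∀ {u v} → Graph.Adj (underlying (graph starColoring)) u v ⇔ Graph.Adj (K a b) u v
  underlying-star {u} {v} = mk⇔ to from
    where
    to : Graph.Adj (underlying (graph starColoring)) u v → side a b u ≢ side a b v
    to (i , inj₁ (refl , e)) eq = left≢right {i} (trans eq e)
    to (i , inj₂ (refl , e)) eq = left≢right {i} (trans (sym eq) e)
    from : side a b u ≢ side a b v → Graph.Adj (underlying (graph starColoring)) u v
    from ne with kind 0 a b u | kind 0 a b v
    ... | center i | center j = contradiction (trans (side-↑ˡ a b i) (sym (side-↑ˡ a b j))) ne
    ... | center i | unit l   = i , inj₁ (refl , side-↑ʳ a b l)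
    ... | unit l   | center i = i , inj₂ (refl , side-↑ʳ a b l)
    ... | unit l   | unit l′  = contradiction (trans (side-↑ʳ a b l) (sym (side-↑ʳ a b l′))) ne

-- Induction along the subdivision: the two halves of a subdivided edge keep its color `i`, so the
-- degree multiset gains `mono 2 i` and is otherwise unchanged. The isomorphism carries the edge
-- back to the colored graph built so far.
subdivision-colorable : ∀ a b {F} → Subdivision (K a b) F →
  ∃ λ Fᶜ → Fᶜ colorizes F × C* M⟨ a , b ⟩ Fᶜ
subdivision-colorable a b none = graph (starColoring a b)
  , record { vertices = mk↔ₛ′ id id (λ _ → refl) (λ _ → refl) ; edges = λ u v → underlying-star a b }
  , record { degrees = [] , [] , ↭-reflexive (trans (star-DS a b) (sym (List.++-identityʳ _)))
           ; connected = star-connected a b }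
subdivision-colorable a b (more {F} s u v uv) with subdivision-colorable a b s
... | Fᶜ , I , record { degrees = X , X∈Δ , ρ ; connected = conn } = graph F₁
  , ≅-trans (underlying-subdivided S) (subst₂ (λ x y → subdivide (underlying Fᶜ) u′ v′ ≅ subdivide F x y) (to-from π u) (to-from π v) (subdivide-≅ I u′ v′))
  , record { degrees = mono 2 i ∷ X , mono∈Δ i ∷ X∈Δ , ↭-trans (↭-trans (↭-reflexive DS-eq) (↭-prep _ ρ)) (↭-sym (↭.shift (mono 2 i) M⟨ a , b ⟩ X))
           ; connected = λ j → connected-up j (conn j) }
  where
  π = _≅_.vertices I
  u′ = ↔-from π u
  v′ = ↔-from π v
  edge : Graph.Adj (underlying Fᶜ) u′ v′
  edge = ⇔-from (_≅_.edges I u′ v′) (subst₂ (Graph.Adj F) (sym (to-from π u)) (sym (to-from π v)) uv)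
  i = proj₁ edge
  F₁ = subdivideᶜ (coloring Fᶜ) (proj₂ edge)
  S : F₁ Subdivides coloring Fᶜ along i , u′ , v′
  S = subdivideᶜ-subdivides (coloring Fᶜ) (proj₂ edge)
  open Subdivided S
  deg = coloredDegree (graph F₁)
  DS-eq : DS (graph F₁) ≡ mono 2 i ∷ DS Fᶜ
  DS-eq = cong₂ _∷_
    (is-mono i (trans (lookup-degree F₁ zero i) degree-zero) λ j ne → trans (lookup-degree F₁ zero j) (degree-zero-else ne))
    (trans (List.map-tabulate suc deg) (trans (List.tabulate-cong λ p → Vec.tabulate-cong λ j → degree-suc j p)
      (sym (List.map-tabulate id (coloredDegree Fᶜ)))))

-- Colored graphs with the profile are subdivisions of `K a b`.

relabel : ∀ {c n m} → Coloring c n → Fin m ↔ Fin n → Coloring c m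
relabel F π = record
  { Color    = λ i x y → Color i (↔-to π x) (↔-to π y)
  ; color?   = λ i x y → color? i (↔-to π x) (↔-to π y)
  ; symm     = λ i → symm i
  ; irrefl   = λ i → irrefl i
  ; disjoint = λ ne → disjoint ne }
  where open Coloring F

module Relabel {c n m} (F : Coloring c n) (π : Fin m ↔ Fin n) where
  open Coloring F
  private module F₁ = Coloring (relabel F π)

  degree-relabel : ∀ i x → F₁.degree i x ≡ degree i (↔-to π x)
  degree-relabel i x = count-↔ (F₁.color? i x) (color? i (↔-to π x)) (↔-to π) (↔-from π) id
    (λ {y} → subst (Color i (↔-to π x)) (sym (to-from π y))) (λ {y} _ → from-to π y) (λ {y} _ → to-from π y)

  connected-relabel : ∀ i → Connected i → F₁.Connected i
  connected-relabel i conn {u} {_} {v} h k = lifts (conn h k) refl refl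
    where
    lifts : ∀ {x y u v} → Star (Color i) x y → x ≡ ↔-to π u → y ≡ ↔-to π v → Star (F₁.Color i) u v
    lifts {v = v} ε e f = subst (Star (F₁.Color i) _) (trans (sym (from-to π _)) (trans (cong (↔-from π) (trans (sym e) f)) (from-to π v))) ε
    lifts (_◅_ {j = z} h s) e f = subst₂ (Color i) e (sym (to-from π z)) h ◅ lifts s (sym (to-from π z)) f

  underlying-relabel : underlying (graph F) ≅ underlying (graph (relabel F π))
  underlying-relabel = ≅-sym record { vertices = π ; edges = λ u v → mk⇔ id id }

-- The tool for refuting connectedness: a closed set that contains one vertex touched by a color
-- must contain all of them.
Closed-Star : ∀ {n} {R : Rel (Fin n) 0ℓ} (S : Pred (Fin n) 0ℓ) → (∀ {x y} → S x → R x y → S y) →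
              ∀ {x y} → S x → Star R x y → S y
Closed-Star S cl p ε       = p
Closed-Star S cl p (h ◅ s) = Closed-Star S cl (cl p h) s

module Vertices (k a b : ℕ) where
  ext : Fin k → Fin (k + (a + b))
  ext x = x ↑ˡ (a + b)

  cen : Fin a → Fin (k + (a + b))
  cen i = k ↑ʳ (i ↑ˡ b)

  uni : Fin b → Fin (k + (a + b))
  uni l = k ↑ʳ (a ↑ʳ l)

  ext≢cen : ∀ x i → ext x ≢ cen i
  ext≢cen x i = ↑ˡ≢↑ʳ x _

  ext≢uni : ∀ x l → ext x ≢ uni l
  ext≢uni x l = ↑ˡ≢↑ʳ x _

  cen≢uni : ∀ i l → cen i ≢ uni l
  cen≢uni i l e = ↑ˡ≢↑ʳ i l (Fin.↑ʳ-injective k _ _ e)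

  uni-injective : ∀ {l l′} → uni l ≡ uni l′ → l ≡ l′
  uni-injective e = Fin.↑ʳ-injective a _ _ (Fin.↑ʳ-injective k _ _ e)

-- Roles are attached to positions and not to degrees, since for `b = 2` and for `a = b = 1`
-- different roles share a degree.
record Profiled (k a b : ℕ) (F : Coloring a (k + (a + b))) : Set where
  open Coloring F
  open Vertices k a b
  field
    deg-ext      : ∀ x → ∃ λ i → degree i (ext x) ≡ 2 × (∀ j → j ≢ i → degree j (ext x) ≡ 0)
    deg-cen      : ∀ i → degree i (cen i) ≡ b
    deg-cen-else : ∀ i {j} → j ≢ i → degree j (cen i) ≡ 0
    deg-uni      : ∀ i l → degree i (uni l) ≡ 1
    connected    : ∀ i → Connected i

  at-cen : ∀ j {i y} → Color i (cen j) y → j ≡ i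
  at-cen j {i} h with j ≟ i
  ... | yes e = e
  ... | no ne = ⊥-elim (pos-degree h (deg-cen-else j (ne ∘ sym)))

  at-ext : ∀ x {i y} → Color i (ext x) y → degree i (ext x) ≡ 2 × (∀ j → j ≢ i → degree j (ext x) ≡ 0)
  at-ext x {i} h with deg-ext x
  ... | i′ , two , zer with i ≟ i′
  ... | yes refl = two , zer
  ... | no ne = ⊥-elim (pos-degree h (zer i ne))

  at-uni : ∀ l {i y z} → Color i (uni l) y → Color i (uni l) z → z ≡ y
  at-uni l {i} = count-1-unique (color? i (uni l)) (deg-uni i l)

  uni-nbr : ∀ i l → ∃ (Color i (uni l))
  uni-nbr i l = count-∃ (color? i (uni l)) (ℕ.≤-reflexive (sym (deg-uni i l)))

  -- Centers and extra vertices meet edges of a single color.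
  two-colors : ∀ {i j w y y′} → j ≢ i → Color i w y → Color j w y′ → ∃ λ l → w ≡ uni l
  two-colors {i} {j} {w} ne h e with kind k a b w
  ... | unit l   = l , refl
  ... | extra x  = ⊥-elim (pos-degree e (proj₂ (at-ext x h) j ne))
  ... | center q = contradiction (trans (sym (at-cen q e)) (at-cen q h)) ne

  is-uni? : Decidable (λ y → ∃ λ l → uni l ≡ y)
  is-uni? y = any? λ l → uni l ≟ y

  count-uni : count is-uni? ≡ b
  count-uni = count-image is-uni? uni uni-injective (λ l → l , refl) id

module _ {a b : ℕ} {F : Coloring a (0 + (a + b))} (P : Profiled 0 a b F) where
  open Coloring F
  open Vertices 0 a b
  open Profiled P

  -- A center sees only its own color, so without extra vertices the `b` neighbors of a center are
  -- units, hence all the units. This uses up the one edge that each unit has in each color, and no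
  -- edge between two units is left.
  underlying-K : underlying (graph F) ≅ K a b
  underlying-K = record { vertices = mk↔ₛ′ id id (λ _ → refl) (λ _ → refl) ; edges = λ u v → mk⇔ (to u v) (from u v) }
    where
    complete : ∀ i l → Color i (cen i) (uni l)
    complete i l = count-⊇ (color? i (cen i)) is-uni? sub
      (ℕ.≤-reflexive (trans count-uni (sym (deg-cen i)))) (l , refl)
      where
      sub : ∀ {y} → Color i (cen i) y → ∃ λ l → uni l ≡ y
      sub {y} h with kind 0 a b y
      ... | unit l = l , refl
      ... | center j with at-cen j (symm i h)
      ... | refl = ⊥-elim (irrefl i h)
    to : ∀ u v → (∃ λ i → Color i u v) → side a b u ≢ side a b v
    to u v (i , h) e with kind 0 a b u | kind 0 a b v
    ... | center p | unit l   with () ← trans (sym (side-↑ˡ a b p)) (trans e (side-↑ʳ a b l))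
    ... | unit l   | center p with () ← trans (sym (side-↑ˡ a b p)) (trans (sym e) (side-↑ʳ a b l))
    ... | unit l   | unit l′  = cen≢uni i l′ (at-uni l h (symm i (complete i l)))
    ... | center p | center q with at-cen p h | at-cen q (symm i h)
    ... | refl | refl = irrefl i h
    from : ∀ u v → side a b u ≢ side a b v → ∃ λ i → Color i u v
    from u v ne with kind 0 a b u | kind 0 a b v
    ... | center i | center j = contradiction (trans (side-↑ˡ a b i) (sym (side-↑ˡ a b j))) ne
    ... | center i | unit l   = i , complete i l
    ... | unit l   | center i = i , symm i (complete i l)
    ... | unit l   | unit l′  = contradiction (trans (side-↑ʳ a b l) (sym (side-↑ʳ a b l′))) ne

module _ {k a b : ℕ} (1≤b : 1 ≤ b) {F : Coloring a (suc k + (a + b))} (P : Profiled (suc k) a b F) where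
  open Coloring F
  open Vertices (suc k) a b
  open Profiled P

  -- Otherwise color i, which occurs at the extra vertex zero, has a component without
  -- extra vertices: either a pair of units, or the center of color i with all units.
  uni-ext-edge : ∃ λ i → ∃₂ λ l x → Color i (uni l) (ext x)
  uni-ext-edge with deg-ext zero
  ... | i , two , _ with any? (λ l → any? λ x → color? i (uni l) (ext x))
  ... | yes found = i , found
  ... | no ¬found = ⊥-elim impossible
    where
    zero-edge : ∃ (Color i zero)
    zero-edge = count-∃ (color? i zero) (subst (1 ≤_) (sym two) (s≤s z≤n))

    reach : ∀ l → Star (Color i) (uni l) zero
    reach l = connected i (proj₂ (uni-nbr i l)) (proj₂ zero-edge)

    nbr : ∀ {l y} → Color i (uni l) y → y ≡ cen i ⊎ ∃ λ l′ → y ≡ uni l′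
    nbr {l} {y} h with kind (suc k) a b y
    ... | extra x = contradiction (l , x , h) ¬found
    ... | unit l′ = inj₂ (l′ , refl)
    ... | center j with at-cen j (symm i h)
    ... | refl = inj₁ refl

    no-pair : ∀ {l l′} → ¬ Color i (uni l) (uni l′)
    no-pair {l} {l′} h with Closed-Star (λ y → y ≡ uni l ⊎ y ≡ uni l′) closed (inj₁ refl) (reach l)
      where
      closed : ∀ {x y} → x ≡ uni l ⊎ x ≡ uni l′ → Color i x y → y ≡ uni l ⊎ y ≡ uni l′
      closed (inj₁ refl) e = inj₂ (at-uni l h e)
      closed (inj₂ refl) e = inj₁ (at-uni l′ (symm i h) e)
    ... | inj₁ e = ext≢uni zero l e
    ... | inj₂ e = ext≢uni zero l′ e

    complete : ∀ l → Color i (cen i) (uni l)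
    complete l with uni-nbr i l
    ... | y , h with nbr h
    ... | inj₁ refl = symm i h
    ... | inj₂ (_ , refl) = ⊥-elim (no-pair h)

    cen-nbr : ∀ {y} → Color i (cen i) y → ∃ λ l → uni l ≡ y
    cen-nbr = count-⊇ is-uni? (color? i (cen i)) (λ { (l , refl) → complete l })
      (ℕ.≤-reflexive (trans (deg-cen i) (sym count-uni)))

    impossible : ⊥
    impossible with Fin.fromℕ< 1≤b
    ... | l with Closed-Star (λ y → y ≡ cen i ⊎ ∃ λ l′ → y ≡ uni l′) closed (inj₂ (l , refl)) (reach l)
      where
      closed : ∀ {x y} → x ≡ cen i ⊎ (∃ λ l′ → x ≡ uni l′) → Color i x y → y ≡ cen i ⊎ ∃ λ l′ → y ≡ uni l′
      closed (inj₁ refl) e with cen-nbr e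
      ... | l′ , refl = inj₂ (l′ , refl)
      closed (inj₂ (_ , refl)) e = nbr e
    ... | inj₁ e = ext≢cen zero i e
    ... | inj₂ (l′ , e) = ext≢uni zero l′ e

  module _ {i} l (edge : Color i (uni l) zero) where
    private
      z = at-ext zero (symm i edge)
      other = count-2 (color? i zero) (proj₁ z) (symm i edge)
      u : Fin (k + (a + b))
      u = Vertices.uni k a b l

    unsubdivided : ∃ λ F′ → Profiled k a b F′ × ∃ λ v → F Subdivides F′ along i , u , v
    unsubdivided with other
    ... | zero , _ , h , _ = ⊥-elim (irrefl i h)
    ... | suc v , v≢u , h , only = unsubdivide , profiled , v , S
      where
      -- In color `i` the unit `suc u` has `zero` as its only neighbor. An edge of another color
      -- would give `suc v` two colors and make it a unit; then {suc u, zero, suc v} is closed under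
      -- color `i` and misses the center, which has an edge of color `i` because `b` is positive.
      nonadj : ∀ {j} → ¬ Color j (suc u) (suc v)
      nonadj {j} e with j ≟ i
      ... | yes refl with () ← at-uni l edge e
      ... | no ne = absurd
        where
        v-uni : ∃ λ l′ → suc v ≡ uni l′
        v-uni = two-colors ne (symm i h) (symm j e)

        S : Pred (Fin (suc k + (a + b))) 0ℓ
        S y = y ≡ suc u ⊎ y ≡ zero ⊎ y ≡ suc v

        closed : ∀ {x y} → S x → Color i x y → S y
        closed (inj₁ refl) f = inj₂ (inj₁ (at-uni l edge f))
        closed (inj₂ (inj₁ refl)) f with only f
        ... | inj₁ e = inj₁ e
        ... | inj₂ e = inj₂ (inj₂ e)
        closed (inj₂ (inj₂ refl)) f = inj₂ (inj₁ (at _ (proj₂ v-uni) (symm i h) f))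
          where
          at : ∀ {x y z} l → x ≡ uni l → Color i x y → Color i x z → z ≡ y
          at l refl = at-uni l

        absurd : ⊥
        absurd with Closed-Star S closed (inj₁ refl) (connected i edge (proj₂ (count-∃ (color? i (cen i)) (subst (1 ≤_) (sym (deg-cen i)) 1≤b))))
        ... | inj₁ e = cen≢uni i l e
        ... | inj₂ (inj₁ e) = ext≢cen zero i (sym e)
        ... | inj₂ (inj₂ e) = cen≢uni i _ (trans e (proj₂ v-uni))

      only′ : ∀ {j q} → Color j zero (suc q) → j ≡ i × (q ≡ u ⊎ q ≡ v)
      only′ {j} f with j ≟ i
      ... | no ne = ⊥-elim (pos-degree f (proj₂ z j ne))
      ... | yes refl with only f
      ... | inj₁ refl = refl , inj₁ refl
      ... | inj₂ refl = refl , inj₂ refl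

      open Unsubdivide F {i} {u} {v} (symm i edge) h (λ e → v≢u (cong suc (sym e))) only′ nonadj

      S : F Subdivides unsubdivide along i , u , v
      S = subdivides-unsubdivide

      open Subdivided S

      profiled : Profiled k a b unsubdivide
      profiled = record
        { deg-ext      = λ x → proj₁ (deg-ext (suc x))
                             , trans (sym (degree-suc _ _)) (proj₁ (proj₂ (deg-ext (suc x))))
                             , λ j ne → trans (sym (degree-suc _ _)) (proj₂ (proj₂ (deg-ext (suc x))) j ne)
        ; deg-cen      = λ j → trans (sym (degree-suc _ _)) (deg-cen j)
        ; deg-cen-else = λ j ne → trans (sym (degree-suc _ _)) (deg-cen-else j ne)
        ; deg-uni      = λ j l → trans (sym (degree-suc _ _)) (deg-uni j l)
        ; connected    = λ j → connected-down j (connected j) }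

module _ {n} (p q : Fin n) where
  abstract
    swap : Fin n → Fin n
    swap z with z ≟ p
    ... | yes _ = q
    ... | no _ with z ≟ q
    ... | yes _ = p
    ... | no _ = z

    swap-left : swap p ≡ q
    swap-left with p ≟ p
    ... | yes _ = refl
    ... | no ne = contradiction refl ne

    swap-right : swap q ≡ p
    swap-right with q ≟ p
    ... | yes e = e
    ... | no _ with q ≟ q
    ... | yes _ = refl
    ... | no ne = contradiction refl ne

    swap-else : ∀ {z} → z ≢ p → z ≢ q → swap z ≡ z
    swap-else {z} z≢p z≢q with z ≟ p
    ... | yes e = contradiction e z≢p
    ... | no _ with z ≟ q
    ... | yes e = contradiction e z≢q
    ... | no _ = refl

    swap-swap : ∀ z → swap (swap z) ≡ z
    swap-swap z = by-cases (z ≟ p) (z ≟ q)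
      where
      by-cases : Dec (z ≡ p) → Dec (z ≡ q) → swap (swap z) ≡ z
      by-cases (yes refl) _          = trans (cong swap swap-left) swap-right
      by-cases (no _)     (yes refl) = trans (cong swap swap-right) swap-left
      by-cases (no z≢p)   (no z≢q)   = trans (cong swap (swap-else z≢p z≢q)) (swap-else z≢p z≢q)

  transposition : Fin n ↔ Fin n
  transposition = mk↔ₛ′ swap swap swap-swap swap-swap

-- Suppression applies to vertex `zero`, so the extra vertex found next to a unit has to be moved
-- there. A transposition of two extra vertices does this and fixes all centers and units.
relabel-profiled : ∀ {k a b} {F : Coloring a (k + (a + b))} → Profiled k a b F → (x y : Fin k) →
  let open Vertices k a b in
  ∃ λ π → Profiled k a b (relabel F π) × ↔-to π (ext x) ≡ ext y × (∀ l → ↔-to π (uni l) ≡ uni l)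
relabel-profiled {k} {a} {b} {F} P x y = π , profiled , to-x , to-uni
  where
  open Coloring F
  open Profiled P
  open Vertices k a b
  n = k + (a + b)
  π : Fin n ↔ Fin n
  π = transposition (ext x) (ext y)
  open Relabel F π

  to-x : ↔-to π (ext x) ≡ ext y
  to-x = swap-left (ext x) (ext y)

  to-ext : ∀ z → ∃ λ z′ → ↔-to π (ext z) ≡ ext z′
  to-ext z with z ≟ x | z ≟ y
  ... | yes refl | _        = y , swap-left (ext x) (ext y)
  ... | no _     | yes refl = x , swap-right (ext x) (ext y)
  ... | no z≢x   | no z≢y   = z , swap-else (ext x) (ext y) (z≢x ∘ ext-injective) (z≢y ∘ ext-injective)
    where
    ext-injective : ∀ {z z′} → ext z ≡ ext z′ → z ≡ z′
    ext-injective = Fin.↑ˡ-injective (a + b) _ _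

  fixed : ∀ {z} → (∀ w → ext w ≢ z) → ↔-to π z ≡ z
  fixed ne = swap-else (ext x) (ext y) (ne x ∘ sym) (ne y ∘ sym)

  to-uni : ∀ l → ↔-to π (uni l) ≡ uni l
  to-uni l = fixed λ w → ext≢uni w l

  deg : ∀ j z {z′} → ↔-to π z ≡ z′ → Coloring.degree (relabel F π) j z ≡ degree j z′
  deg j z e = trans (degree-relabel j z) (cong (degree j) e)

  profiled : Profiled k a b (relabel F π)
  profiled = record
    { deg-ext      = λ z → let z′ , e = to-ext z ; i , two , zer = deg-ext z′ in
                           i , trans (deg i (ext z) e) two , λ j ne → trans (deg j (ext z) e) (zer j ne)
    ; deg-cen      = λ j → trans (deg j (cen j) (fixed λ w → ext≢cen w j)) (deg-cen j)
    ; deg-cen-else = λ i {j} ne → trans (deg j (cen i) (fixed λ w → ext≢cen w i)) (deg-cen-else i ne)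
    ; deg-uni      = λ j l → trans (deg j (uni l) (fixed λ w → ext≢uni w l)) (deg-uni j l)
    ; connected    = λ j {u} {u′} {v} {v′} → connected-relabel j (connected j) {u} {u′} {v} {v′} }

profiled-subdivision : ∀ k {a b} → 1 ≤ b → {F : Coloring a (k + (a + b))} → Profiled k a b F →
  ∃ λ G → Subdivision (K a b) G × underlying (graph F) ≅ G
profiled-subdivision zero    1≤b P = _ , none , underlying-K P
profiled-subdivision (suc k) {a} {b} 1≤b {F} P with uni-ext-edge 1≤b P
... | i , l , x , edge with relabel-profiled P zero x
... | π , P₁ , to-zero , to-uni with unsubdivided 1≤b P₁ l
        (subst₂ (Coloring.Color F i) (sym (to-uni l)) (sym to-zero) edge)
... | F′ , P′ , v , S with profiled-subdivision k 1≤b P′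
... | G , sub , I = _ , more sub _ _ (⇔-to (_≅_.edges I _ _) (i , _Subdivides_along_,_,_.edge S))
  , ≅-trans (Relabel.underlying-relabel F π) (≅-trans (underlying-subdivided S) (subdivide-≅ I _ v))

-- From degree multisets to roles of vertices.

unique-↭ : ∀ {A : Set} {xs ys : List A} → xs ↭ ys → Unique xs → Unique ys
unique-↭ ρ = ↭ₛ.AllPairs-resp-↭ (setoid _) ≢-sym (resp₂ _≢_) (↭⇒↭ₛ ρ)

-- The permutation of values lifts to a list `ys` of indices that permutes `allFin N`. As `ys` has
-- no repetitions, positions in `ys` give the bijection; where values repeat, this fixes one of
-- several possible matchings.
map-↭-bijection : ∀ {A : Set} {N n} (f : Fin N → A) (g : Fin n → A) → map f (allFin N) ↭ map g (allFin n) →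
  ∃ λ (π : Fin N ↔ Fin n) → ∀ x → f x ≡ g (↔-to π x)
map-↭-bijection {A} {N} {n} f g ρ with ↭.↭-map-inv f ρ
... | ys , eq , σ = mk↔ₛ′ to from to-from′ from-to′ , λ x → sym (trans (pointwise g ys eq′ (to x)) (cong f (from-to′ x)))
  where
  eq′ : List.tabulate g ≡ map f ys
  eq′ = trans (sym (List.map-tabulate id g)) eq
  len : length ys ≡ n
  len = trans (sym (List.length-map f ys)) (trans (cong length (sym eq′)) (List.length-tabulate g))
  pos : ∀ x → x ∈ₗ ys
  pos x = ↭.∈-resp-↭ σ (∈-allFin x)
  uniq : Unique ys
  uniq = unique-↭ σ (Unique.allFin⁺ N)
  to : Fin N → Fin n
  to x = Fin.cast len (Any.index (pos x))
  from : Fin n → Fin N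
  from y = lookup ys (Fin.cast (sym len) y)
  from-to′ : ∀ x → from (to x) ≡ x
  from-to′ x = trans (cong (lookup ys) (Fin.cast-involutive (sym len) len _)) (sym (Any.lookup-index (pos x)))
  to-from′ : ∀ y → to (from y) ≡ y
  to-from′ y = trans (cong (Fin.cast len) (lookup-injective uniq (sym (Any.lookup-index (pos (from y))))))
                     (Fin.cast-involutive len (sym len) y)
  pointwise : ∀ {n} (g : Fin n → A) ys (eq : List.tabulate g ≡ map f ys) .{len : n ≡ length ys} (x : Fin n) →
              g x ≡ f (lookup ys (Fin.cast len x))
  pointwise g (y ∷ ys) eq zero    = List.∷-injectiveˡ eq
  pointwise g (y ∷ ys) eq {len} (suc x) = pointwise (g ∘ suc) ys (List.∷-injectiveʳ eq) {ℕ.suc-injective len} x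

module _ {k a b : ℕ} (δ : Fin k → ColoredDegree a) where
  open Vertices k a b

  profileDegree : Fin (k + (a + b)) → ColoredDegree a
  profileDegree x = [ δ , (λ y → [ mono b , const ones ]′ (splitAt a y)) ]′ (splitAt k x)

  profileDegree-ext : ∀ x → profileDegree (ext x) ≡ δ x
  profileDegree-ext x rewrite Fin.splitAt-↑ˡ k x (a + b) = refl

  profileDegree-cen : ∀ i → profileDegree (cen i) ≡ mono b i
  profileDegree-cen i rewrite Fin.splitAt-↑ʳ k (a + b) (i ↑ˡ b) | Fin.splitAt-↑ˡ a i b = refl

  profileDegree-uni : ∀ l → profileDegree (uni l) ≡ ones
  profileDegree-uni l rewrite Fin.splitAt-↑ʳ k (a + b) (a ↑ʳ l) | Fin.splitAt-↑ʳ a b l = refl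

  map-profileDegree : map profileDegree (allFin (k + (a + b))) ≡ map δ (allFin k) ++ M⟨ a , b ⟩
  map-profileDegree = trans (map-allFin-+ k (a + b) profileDegree) (cong₂ _++_
    (List.map-cong profileDegree-ext (allFin k))
    (trans (map-allFin-+ a b (profileDegree ∘ (k ↑ʳ_))) (cong₂ _++_ (List.map-cong profileDegree-cen (allFin a))
      (trans (List.map-cong profileDegree-uni (allFin b)) (map-const ones b)))))

  profile-bijection : ∀ {n} (F : Coloring a n) → DS (graph F) ↭ M⟨ a , b ⟩ ++ map δ (allFin k) →
    ∃ λ (π : Fin (k + (a + b)) ↔ Fin n) → ∀ x → profileDegree x ≡ coloredDegree (graph F) (↔-to π x)
  profile-bijection F ρ = map-↭-bijection profileDegree (coloredDegree (graph F))
    (↭-sym (↭-trans ρ (↭-trans (↭.++-comm M⟨ a , b ⟩ (map δ (allFin k))) (↭-reflexive (sym map-profileDegree)))))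

  profile-profiled : ∀ {n} (F : Coloring a n) → (∀ x → δ x ∈Δ) → (∀ i → Coloring.Connected F i) →
    (π : Fin (k + (a + b)) ↔ Fin n) → (∀ x → profileDegree x ≡ coloredDegree (graph F) (↔-to π x)) →
    Profiled k a b (relabel F π)
  profile-profiled F δ∈Δ conn π same = record
    { deg-ext      = λ x → let i , two , zer = δ∈Δ x ; e = deg (ext x) (profileDegree-ext x) in
                           i , trans (e i) two , λ j ne → trans (e j) (zer j ne)
    ; deg-cen      = λ i → trans (deg (cen i) (profileDegree-cen i) i) (lookup-mono b i)
    ; deg-cen-else = λ i {j} ne → trans (deg (cen i) (profileDegree-cen i) j) (lookup-mono-else b ne)
    ; deg-uni      = λ i l → trans (deg (uni l) (profileDegree-uni l) i) (lookup-ones i)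
    ; connected    = λ i {u} {u′} {v} {v′} → connected-relabel i (conn i) {u} {u′} {v} {v′} }
    where
    open Relabel F π
    deg : ∀ {d} x → profileDegree x ≡ d → ∀ i → Coloring.degree (relabel F π) i x ≡ Vec.lookup d i
    deg x e i = trans (degree-relabel i x) (trans (sym (lookup-degree F (↔-to π x) i))
      (cong (λ d → Vec.lookup d i) (trans (sym (same x)) e)))

  profile-subdivision-fin : 1 ≤ b → ∀ {n} (F : Coloring a n) → DS (graph F) ↭ M⟨ a , b ⟩ ++ map δ (allFin k) →
    (∀ x → δ x ∈Δ) → (∀ i → Coloring.Connected F i) → ∃ λ G → Subdivision (K a b) G × underlying (graph F) ≅ G
  profile-subdivision-fin 1≤b {n} F ρ δ∈Δ conn = relabeled (profile-bijection F ρ)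
    where
    back : ∀ (π : Fin (k + (a + b)) ↔ Fin n) → (∃ λ G → Subdivision (K a b) G × underlying (graph (relabel F π)) ≅ G) →
           ∃ λ G → Subdivision (K a b) G × underlying (graph F) ≅ G
    back π (G , sub , I) = G , sub , ≅-trans (Relabel.underlying-relabel F π) I
    relabeled : (∃ λ (π : Fin (k + (a + b)) ↔ Fin n) → ∀ x → profileDegree x ≡ coloredDegree (graph F) (↔-to π x)) →
                ∃ λ G → Subdivision (K a b) G × underlying (graph F) ≅ G
    relabeled (π , same) = back π (profiled-subdivision k 1≤b (profile-profiled F δ∈Δ conn π same))

map-lookup-allFin : ∀ {A : Set} (xs : List A) → map (lookup xs) (allFin (length xs)) ≡ xs
map-lookup-allFin xs = trans (List.map-tabulate id (lookup xs)) (List.tabulate-lookup xs)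

profile-subdivision : ∀ a b → 1 ≤ b → ∀ (Fᶜ : ColoredGraph a) → C* M⟨ a , b ⟩ Fᶜ →
  ∃ λ G → Subdivision (K a b) G × underlying Fᶜ ≅ G
profile-subdivision a b 1≤b Fᶜ record { degrees = X , X∈Δ , ρ ; connected = conn } =
  profile-subdivision-fin (lookup X) 1≤b (coloring Fᶜ)
    (subst (λ Y → DS Fᶜ ↭ M⟨ a , b ⟩ ++ Y) (sym (map-lookup-allFin X)) ρ)
    (λ x → All.lookup X∈Δ (∈-lookup x)) conn

extended-profile : ∀ a b → 1 ≤ b → IsExtendedProfile M⟨ a , b ⟩ (K a b)
extended-profile a b 1≤b F = mk⇔
  (λ (F′ , sub , I) → transport-colorization I (subdivision-colorable a b sub))
  (λ (Fᶜ , J , C) → transport-subdivision J (profile-subdivision a b 1≤b Fᶜ C))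
  where
  transport-colorization : ∀ {F′} → F ≅ F′ → (∃ λ Fᶜ → Fᶜ colorizes F′ × C* M⟨ a , b ⟩ Fᶜ) →
                           ∃ λ Fᶜ → Fᶜ colorizes F × C* M⟨ a , b ⟩ Fᶜ
  transport-colorization I (Fᶜ , J , C) = Fᶜ , ≅-trans J (≅-sym I) , C
  transport-subdivision : ∀ {F′} → F′ ≅ F → (∃ λ G → Subdivision (K a b) G × F′ ≅ G) → F ∈𝒮 K a b
  transport-subdivision J (G , sub , I) = G , sub , ≅-trans (≅-sym J) I

-- Decidability of reachability in a finite relation (Floyd–Warshall)

module _ {n} {R : Rel (Fin n) 0ℓ} (R? : Decidable₂ R) where
  Via : ℕ → Rel (Fin n) 0ℓ
  Via zero    u v = u ≡ v ⊎ R u v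
  Via (suc k) u v = Via k u v ⊎ ∃ λ w → toℕ w ≡ k × Via k u w × Via k w v

  via? : ∀ k → Decidable₂ (Via k)
  via? zero    u v = u ≟ v ⊎-dec R? u v
  via? (suc k) u v = via? k u v ⊎-dec any? λ w → toℕ w ℕ.≟ k ×-dec via? k u w ×-dec via? k w v

  -- If `w` is the vertex numbered `k`, each half is cut at its visit to `w`, if any, which leaves
  -- paths through lower vertices. Otherwise the joint at `w` is handled recursively, and two visits
  -- to vertex `k` merge into one by dropping the loop between them.
  via-trans : ∀ k {u w v} → toℕ w < k → Via k u w → Via k w v → Via k u v
  via-trans (suc k) {u} {w} {v} w<k p q with toℕ w ℕ.≟ k
  ... | yes e = inj₂ (w , e , to p , from q)
    where
    to : Via (suc k) u w → Via k u w
    to (inj₁ h) = h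
    to (inj₂ (x , e′ , h , _)) = subst (Via k u) (Fin.toℕ-injective (trans e′ (sym e))) h
    from : Via (suc k) w v → Via k w v
    from (inj₁ h) = h
    from (inj₂ (x , e′ , _ , h)) = subst (λ y → Via k y v) (Fin.toℕ-injective (trans e′ (sym e))) h
  ... | no ne = join p q
    where
    w<k′ : toℕ w < k
    w<k′ = ℕ.≤∧≢⇒< (ℕ.≤-pred w<k) ne
    join : Via (suc k) u w → Via (suc k) w v → Via (suc k) u v
    join (inj₁ h) (inj₁ h′) = inj₁ (via-trans k w<k′ h h′)
    join (inj₁ h) (inj₂ (x , e , g , g′)) = inj₂ (x , e , via-trans k w<k′ h g , g′)
    join (inj₂ (x , e , g , g′)) (inj₁ h) = inj₂ (x , e , g , via-trans k w<k′ g′ h)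
    join (inj₂ (x , e , g , _)) (inj₂ (y , e′ , _ , g′)) =
      inj₂ (x , e , g , subst (λ z → Via k z v) (Fin.toℕ-injective (trans e′ (sym e))) g′)

  via⇒Star : ∀ k {u v} → Via k u v → Star R u v
  via⇒Star zero    (inj₁ refl) = ε
  via⇒Star zero    (inj₂ h) = h ◅ ε
  via⇒Star (suc k) (inj₁ h) = via⇒Star k h
  via⇒Star (suc k) (inj₂ (_ , _ , h , h′)) = via⇒Star k h ◅◅ via⇒Star k h′

  via-step : ∀ k {u v} → u ≡ v ⊎ R u v → Via k u v
  via-step zero    h = h
  via-step (suc k) h = inj₁ (via-step k h)

  Star⇒via : ∀ {u v} → Star R u v → Via n u v
  Star⇒via ε       = via-step n (inj₁ refl)
  Star⇒via (_◅_ {j = w} h s) = via-trans n (Fin.toℕ<n w) (via-step n (inj₂ h)) (Star⇒via s)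

  star? : Decidable₂ (Star R)
  star? u v = map′ (via⇒Star n) Star⇒via (via? n u v)

-- Connectedness across a separating set of vertices.

Touched : ∀ {n} → Rel (Fin n) 0ℓ → Pred (Fin n) 0ℓ
Touched R u = ∃ (R u)

ConnectedRel : ∀ {n} → Rel (Fin n) 0ℓ → Set
ConnectedRel R = ∀ {u u′ v v′} → R u u′ → R v v′ → Star R u v

infixr 6 _∪_
_∪_ : ∀ {n} → Rel (Fin n) 0ℓ → Rel (Fin n) 0ℓ → Rel (Fin n) 0ℓ
(A ∪ B) u v = A u v ⊎ B u v

connected-⇔ : ∀ {n} {R S : Rel (Fin n) 0ℓ} → (∀ {u v} → R u v → S u v) → (∀ {u v} → S u v → R u v) →
              ConnectedRel R → ConnectedRel S
connected-⇔ to from conn h k = Star.map to (conn (from h) (from k))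

star-touched : ∀ {n} {R : Rel (Fin n) 0ℓ} → Symmetric R → ∀ {u v} → Touched R u → Star R u v → Touched R v
star-touched sy t ε       = t
star-touched sy t (h ◅ s) = star-touched sy (_ , sy h) s

-- Replacing the past A by the past A′ while keeping the future B. The frontier Φ separates
-- past from future, and A and A′ agree on how they touch and connect the vertices of Φ.
module Exchange {n} {A A′ B B′ : Rel (Fin n) 0ℓ} {Φ : Pred (Fin n) 0ℓ}
  (symA : Symmetric A) (symA′ : Symmetric A′) (symB : Symmetric B)
  (sepAB : ∀ {u} → Touched A u → Touched B u → Φ u)
  (sepA′B : ∀ {u} → Touched A′ u → Touched B u → Φ u)
  (sepA′B′ : ∀ {u} → Touched A′ u → Touched B′ u → Φ u)
  (joined : ∀ {u v} → Φ u → Φ v → Star A u v → Star A′ u v)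
  (touched : ∀ {u} → Φ u → Touched A′ u → Touched A u)
  (touched′ : ∀ {u} → Φ u → Touched A u → Touched A′ u)
  (started : ∀ {u} → Touched A′ u → ∃ (Touched A))
  (meets? : Dec (∃ λ u → Φ u × Touched A′ u))
  (conn : ConnectedRel (A ∪ B)) (conn′ : ConnectedRel (A′ ∪ B′)) where

  private
    -- The vertices at which a stretch of the past inside a longer path can begin or end. If such a
    -- stretch is nonempty, its ends are touched by `A` and hence lie in Φ, where `joined` applies.
    Visible : Pred (Fin n) 0ℓ
    Visible u = Φ u ⊎ Touched B u

    visible-Φ : ∀ {u} → Visible u → Touched A u → Φ u
    visible-Φ (inj₁ φ) _ = φ
    visible-Φ (inj₂ b) a = sepAB a b

    segment : ∀ {u v} → Visible u → Visible v → Star A u v → Star A′ u v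
    segment vu vv ε = ε
    segment vu vv s@(h ◅ _) = joined (visible-Φ vu (_ , h)) (visible-Φ vv (star-touched symA (_ , h) s)) s

    -- `s` accumulates the current stretch in the old past, begun at `o`. Intermediate vertices may
    -- be unknown to `A′`, so the stretch is replaced as a whole, when an edge of `B` or the end of
    -- the path is reached.
    transfer : ∀ {o u v} → Visible o → Visible v → Star A o u → Star (A ∪ B) u v → Star (A′ ∪ B) o v
    transfer vo vv s ε = Star.map inj₁ (segment vo vv s)
    transfer vo vv s (inj₁ h ◅ t) = transfer vo vv (s ◅◅ h ◅ ε) t
    transfer vo vv s (inj₂ h ◅ t) = Star.map inj₁ (segment vo (inj₂ (_ , h)) s) ◅◅ inj₂ h ◅ transfer (inj₂ (_ , symB h)) vv ε t

    to-frontier : ∀ {C : Rel (Fin n) 0ℓ} → (∀ {u} → Touched A′ u → Touched C u → Φ u) →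
                  ∀ {u v} → Touched A′ u → Φ v → Star (A′ ∪ C) u v → ∃ λ w → Φ w × Star A′ u w
    to-frontier sep t φ ε = _ , φ , ε
    to-frontier sep t φ (inj₂ h ◅ s) = _ , sep t (_ , h) , ε
    to-frontier sep t φ (inj₁ h ◅ s) with to-frontier sep (_ , symA′ h) φ s
    ... | w , φw , s′ = w , φw , h ◅ s′

  -- Here the second future matters: since `A′ ∪ B′` is connected and `A′` meets Φ, every vertex
  -- touched by `A′` reaches Φ inside `A′`. A component of `A′` off the frontier, which no agreement
  -- on Φ could detect, is thereby excluded.
  module Meeting {φ} (φΦ : Φ φ) (φA′ : Touched A′ φ) where
    visit : ∀ {u u′} → (A′ ∪ B) u u′ → ∃ λ w → Visible w × Touched (A ∪ B) w × Star (A′ ∪ B) u w × Star (A′ ∪ B) w u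
    visit {u} (inj₂ h) = u , inj₂ (_ , h) , (_ , inj₂ h) , ε , ε
    visit {u} (inj₁ h) with to-frontier sepA′B′ (_ , h) φΦ (conn′ (inj₁ h) (inj₁ (proj₂ φA′)))
    ... | w , φw , s = w , inj₁ φw , (_ , inj₁ (proj₂ (touched φw (star-touched symA′ (_ , h) s))))
                     , Star.map inj₁ s , Star.map inj₁ (Star.reverse symA′ s)

    result : ConnectedRel (A′ ∪ B)
    result h k with visit h | visit k
    ... | w , vw , tw , to , _ | x , vx , tx , _ , from = to ◅◅ transfer vw vx ε (conn (proj₂ tw) (proj₂ tx)) ◅◅ from

  -- The color lies on one side of the frontier in each of the two unions. If `A′` is nonempty, so
  -- is `A` by `started`, and connectedness of `A ∪ B` then leaves `B` empty; so `A′` and `B` never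
  -- both contribute.
  module Apart (untouched : ∀ {u} → Φ u → ¬ Touched A′ u) where
    stay : ∀ {u v} → Touched A′ u → Star (A′ ∪ B′) u v → Star A′ u v
    stay t ε = ε
    stay t (inj₁ h ◅ s) = h ◅ stay (_ , symA′ h) s
    stay t (inj₂ h ◅ s) = ⊥-elim (untouched (sepA′B′ t (_ , h)) t)

    stayA : ∀ {u v} → Touched A u → Star (A ∪ B) u v → Touched A v
    stayA t ε = t
    stayA t (inj₁ h ◅ s) = stayA (_ , symA h) s
    stayA t (inj₂ h ◅ s) = ⊥-elim (let φ = sepAB t (_ , h) in untouched φ (touched′ φ t))

    stayB : ∀ {u v} → Touched B u → Star (A ∪ B) u v → Star B u v
    stayB t ε = ε
    stayB t (inj₁ h ◅ s) = ⊥-elim (let φ = sepAB (_ , h) t in untouched φ (touched′ φ (_ , h)))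
    stayB t (inj₂ h ◅ s) = h ◅ stayB (_ , symB h) s

    mixed : ∀ {u v} → Touched A′ u → ¬ Touched B v
    mixed t b with started t
    ... | _ , a = let tv = stayA a (conn (inj₁ (proj₂ a)) (inj₂ (proj₂ b)))
                      φ = sepAB tv b in untouched φ (touched′ φ tv)

    result : ConnectedRel (A′ ∪ B)
    result (inj₁ h) (inj₁ k) = Star.map inj₁ (stay (_ , h) (conn′ (inj₁ h) (inj₁ k)))
    result (inj₁ h) (inj₂ k) = ⊥-elim (mixed (_ , h) (_ , k))
    result (inj₂ h) (inj₁ k) = ⊥-elim (mixed (_ , k) (_ , h))
    result (inj₂ h) (inj₂ k) = Star.map inj₂ (stayB (_ , h) (conn (inj₂ h) (inj₂ k)))

  exchanged : ConnectedRel (A′ ∪ B)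
  exchanged = by-cases meets?
    where
    by-cases : Dec (∃ λ u → Φ u × Touched A′ u) → ConnectedRel (A′ ∪ B)
    by-cases (yes (_ , φ , t)) = Meeting.result φ t
    by-cases (no ¬m) = Apart.result λ φ t → ¬m (_ , φ , t)

-- Multiplicities of colored degrees

module _ {c : ℕ} where
  _≟ᵈ_ : Decidable₂ {A = ColoredDegree c} _≡_
  _≟ᵈ_ = Vec.≡-dec ℕ._≟_

  ∈Δ? : Decidable (_∈Δ {c})
  ∈Δ? δ = any? λ i → Vec.lookup δ i ℕ.≟ 2 ×-dec all? λ j → ¬? (j ≟ i) →-dec (Vec.lookup δ j ℕ.≟ 0)

  hit : ColoredDegree c → ColoredDegree c → ℕ
  hit d x = if does (x ≟ᵈ d) then 1 else 0

  mult : ColoredDegree c → List (ColoredDegree c) → ℕ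
  mult d [] = 0
  mult d (x ∷ xs) = hit d x + mult d xs

  mult-++ : ∀ d xs ys → mult d (xs ++ ys) ≡ mult d xs + mult d ys
  mult-++ d [] ys = refl
  mult-++ d (x ∷ xs) ys = trans (cong (i +_) (mult-++ d xs ys)) (sym (ℕ.+-assoc i (mult d xs) (mult d ys)))
    where i = hit d x

  mult-↭ : ∀ d {xs ys} → xs ↭ ys → mult d xs ≡ mult d ys
  mult-↭ d _↭_.refl = refl
  mult-↭ d (_↭_.prep x ρ) = cong (hit d x +_) (mult-↭ d ρ)
  mult-↭ d (_↭_.swap {xs} {ys} x y ρ) = trans (sym (ℕ.+-assoc i j (mult d xs)))
    (trans (cong₂ _+_ (ℕ.+-comm i j) (mult-↭ d ρ)) (ℕ.+-assoc j i (mult d ys)))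
    where i = hit d x
          j = hit d y
  mult-↭ d (_↭_.trans ρ σ) = trans (mult-↭ d ρ) (mult-↭ d σ)

  mult-here : ∀ d xs → mult d (d ∷ xs) ≡ suc (mult d xs)
  mult-here d xs with d ≟ᵈ d
  ... | yes _ = refl
  ... | no ne = contradiction refl ne

  mult-skip : ∀ {d x} xs → x ≢ d → mult d (x ∷ xs) ≡ mult d xs
  mult-skip {d} {x} xs ne with x ≟ᵈ d
  ... | yes e = contradiction e ne
  ... | no _ = refl

  mult-∈ : ∀ d {xs} → d ∈ₗ xs → 1 ≤ mult d xs
  mult-∈ d {x ∷ xs} (here refl) = subst (1 ≤_) (sym (mult-here d xs)) (s≤s z≤n)
  mult-∈ d {x ∷ xs} (there p) = ℕ.≤-trans (mult-∈ d p) (ℕ.m≤n+m _ _)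

  ∈-mult : ∀ d xs → 1 ≤ mult d xs → d ∈ₗ xs
  ∈-mult d (x ∷ xs) h with x ≟ᵈ d
  ... | yes refl = here refl
  ... | no _ = there (∈-mult d xs h)

  mult-none : ∀ d xs → (∀ {x} → x ∈ₗ xs → x ≢ d) → mult d xs ≡ 0
  mult-none d xs h with mult d xs in eq
  ... | zero = refl
  ... | suc _ = ⊥-elim (h (∈-mult d xs (subst (1 ≤_) (sym eq) (s≤s z≤n))) refl)

  -- The multiset condition in terms of multiplicities, which add up over finished and unfinished
  -- vertices, whereas a permutation of lists cannot be cut along that division.
  Fits : List (ColoredDegree c) → (ColoredDegree c → ℕ) → Set
  Fits M f = ∀ d → mult d M ≤ f d × (¬ d ∈Δ → f d ≤ mult d M)

  Extends : List (ColoredDegree c) → List (ColoredDegree c) → Set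
  Extends M xs = ∃ λ X → All _∈Δ X × xs ↭ M ++ X

  extends⇒fits : ∀ {M xs} → Extends M xs → Fits M (λ d → mult d xs)
  extends⇒fits {M} {xs} (X , X∈Δ , ρ) d = subst (mult d M ≤_) (sym eq) (ℕ.m≤m+n _ _)
    , λ ∉Δ → ℕ.≤-reflexive (trans eq (trans (cong (mult d M +_)
        (mult-none d X λ x∈ e → ∉Δ (subst _∈Δ e (All.lookup X∈Δ x∈)))) (ℕ.+-identityʳ _)))
    where
    eq : mult d xs ≡ mult d M + mult d X
    eq = trans (mult-↭ d ρ) (mult-++ d M X)

  -- The elements of `M` are removed from `xs` one at a time, which lowers both sides of every
  -- inequality equally. What remains at the end has multiplicity 0 outside Δ.
  fits⇒extends : ∀ M xs → Fits M (λ d → mult d xs) → Extends M xs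
  fits⇒extends [] xs fits = xs , All.tabulate (λ {x} x∈ → decidable-stable (∈Δ? x) λ ∉Δ →
    ℕ.<⇒≱ (mult-∈ x x∈) (proj₂ (fits x) ∉Δ)) , ↭-refl
  fits⇒extends (d ∷ M) xs fits
    with ys , zs , refl ← ∈-∃++ (∈-mult d xs (ℕ.≤-trans (subst (1 ≤_) (sym (mult-here d M)) (s≤s z≤n)) (proj₁ (fits d))))
    with X , X∈Δ , ρ ← fits⇒extends M (ys ++ zs) (λ e →
           ℕ.+-cancelˡ-≤ (hit e d) _ _ (subst (mult e (d ∷ M) ≤_) (mult-↭ e (↭.shift d ys zs)) (proj₁ (fits e)))
         , λ ∉Δ → ℕ.+-cancelˡ-≤ (hit e d) _ _ (subst (_≤ mult e (d ∷ M)) (mult-↭ e (↭.shift d ys zs)) (proj₂ (fits e) ∉Δ)))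
    = X , X∈Δ , ↭-trans (↭.shift d ys zs) (↭-prep d ρ)

  extends? : ∀ M xs → Dec (Extends M xs)
  extends? [] xs = map′ (λ p → xs , p , ↭-refl) (λ (X , X∈Δ , ρ) → ↭.All-resp-↭ (↭-sym ρ) X∈Δ) (All.all? ∈Δ? xs)
  extends? (d ∷ M) xs with Any.any? (λ x → d ≟ᵈ x) xs
  ... | no d∉ = no λ (X , _ , ρ) → d∉ (↭.∈-resp-↭ (↭-sym ρ) (here refl))
  ... | yes d∈ with ys , zs , refl ← ∈-∃++ d∈ = map′
    (λ (X , p , ρ) → X , p , ↭-trans (↭.shift d ys zs) (↭-prep d ρ))
    (λ (X , p , ρ) → X , p , ↭.drop-∷ (↭-trans (↭-sym (↭.shift d ys zs)) ρ))
    (extends? M (ys ++ zs))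

  mult-map-filter : ∀ {n} (f : Fin n → ColoredDegree c) {P : Pred (Fin n) 0ℓ} (P? : Decidable P) d →
    mult d (map f (filter P? (allFin n))) ≡ count (λ v → P? v ×-dec f v ≟ᵈ d)
  mult-map-filter {n} f P? d = go (allFin n)
    where
    go : ∀ vs → mult d (map f (filter P? vs)) ≡ length (filter (λ v → P? v ×-dec f v ≟ᵈ d) vs)
    go [] = refl
    go (v ∷ vs) with P? v
    ... | no _ = go vs
    ... | yes _ with f v ≟ᵈ d
    ... | yes _ = cong suc (go vs)
    ... | no _ = go vs

-- The condition `C*` expressed on colorings with isolated vertices.

zeros : ∀ {c} → ColoredDegree c
zeros = Vec.replicate _ 0

colorDegree : ∀ {c n} → Coloring c n → Fin n → ColoredDegree c
colorDegree F = coloredDegree (graph F)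

degreeCount : ∀ {c n} → Coloring c n → ColoredDegree c → ℕ
degreeCount F d = count (λ v → colorDegree F v ≟ᵈ d)

-- C* for dropIsolated: the degree zeros is exempt since isolated vertices are dropped.
record Good {c n} (M : List (ColoredDegree c)) (F : Coloring c n) : Set where
  field
    enough    : ∀ {d} → d ≢ zeros → mult d M ≤ degreeCount F d
    exact     : ∀ {d} → d ≢ zeros → ¬ d ∈Δ → degreeCount F d ≤ mult d M
    connected : ∀ i → Coloring.Connected F i

module DropIsolated {c n} (F : Coloring c n) where
  open Coloring F
  private
    G = dropIsolated (graph F)
    module G = ColoredGraph G

  Endpoint : Pred (Fin n) 0ℓ
  Endpoint u = ∃₂ λ i v → Color i u v

  endpoint? : Decidable Endpoint
  endpoint? u = any? λ i → any? λ v → color? i u v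

  open Enumeration endpoint?

  degree-enum : ∀ x → coloredDegree G x ≡ colorDegree F (enum x)
  degree-enum x = Vec.tabulate-cong λ i → ℕ.≤-antisym
    (count-inj (G.color? i x) (color? i (enum x)) (λ y _ → enum y) (λ y h → h) (λ _ _ _ _ → enum-injective))
    (count-inj (color? i (enum x)) (G.color? i x) (λ v h → index (i , _ , symm i h))
      (λ v h → subst (Color i (enum x)) (sym (enum-index (i , _ , symm i h))) h)
      (λ v w h k e → trans (sym (enum-index (i , _ , symm i h))) (trans (cong enum e) (enum-index (i , _ , symm i k)))))

  DS-enum : DS G ≡ map (colorDegree F) (filter endpoint? (allFin n))
  DS-enum = trans (List.map-cong degree-enum (allFin _))
    (trans (List.map-∘ (allFin _)) (cong (map (colorDegree F)) (map-lookup-allFin (filter endpoint? (allFin n)))))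

  nonzero-endpoint : ∀ {u} → colorDegree F u ≢ zeros → Endpoint u
  nonzero-endpoint {u} ne with endpoint? u
  ... | yes e = e
  ... | no ¬e = contradiction (vec-ext λ i → trans (lookup-degree F u i)
                  (trans (count-none (color? i u) λ v h → ¬e (i , v , h)) (sym (Vec.lookup-replicate i 0)))) ne

  endpoint-nonzero : ∀ {u} → Endpoint u → colorDegree F u ≢ zeros
  endpoint-nonzero {u} (i , v , h) e = pos-degree h (trans (sym (lookup-degree F u i))
    (trans (cong (λ d → Vec.lookup d i) e) (Vec.lookup-replicate i 0)))

  mult-DS : ∀ {d} → d ≢ zeros → mult d (DS G) ≡ degreeCount F d
  mult-DS {d} ne = trans (cong (mult d) DS-enum) (trans (mult-map-filter (colorDegree F) endpoint? d)
    (count-≐ (λ v → endpoint? v ×-dec colorDegree F v ≟ᵈ d) (λ v → colorDegree F v ≟ᵈ d) proj₂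
      λ e → nonzero-endpoint (λ z → ne (trans (sym e) z)) , e))

  mult-DS-zeros : mult zeros (DS G) ≡ 0
  mult-DS-zeros = trans (cong (mult zeros) DS-enum) (trans (mult-map-filter (colorDegree F) endpoint? zeros)
    (count-none (λ v → endpoint? v ×-dec colorDegree F v ≟ᵈ zeros) λ v (p , e) → endpoint-nonzero p e))

  connected-enum : ∀ {i} → ColorConnected G i → Connected i
  connected-enum {i} conn {u} {u′} {v} {v′} h k =
    subst₂ (Star (Color i)) (enum-index pu) (enum-index pv)
      (Star.gmap enum id (conn {index pu} {index pu′} {index pv} {index pv′}
        (subst₂ (Color i) (sym (enum-index pu)) (sym (enum-index pu′)) h)
        (subst₂ (Color i) (sym (enum-index pv)) (sym (enum-index pv′)) k)))
    where
    pu  = i , u′ , h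
    pu′ = i , u , symm i h
    pv  = i , v′ , k
    pv′ = i , v , symm i k

  connected-drop : ∀ {i} → Connected i → ColorConnected G i
  connected-drop {i} conn {x} {_} {y} h k = lifts (conn h k) refl refl
    where
    lifts : ∀ {u v x y} → Star (Color i) u v → u ≡ enum x → v ≡ enum y → Star (G.Color i) x y
    lifts {x = x} ε e f = subst (Star (G.Color i) x) (enum-injective (trans (sym e) f)) ε
    lifts (_◅_ {j = w} h s) refl f = subst (Color i _) (sym (enum-index p)) h ◅ lifts s (sym (enum-index p)) f
      where p = i , _ , symm i h

  module _ {M : List (ColoredDegree c)} (M-zeros : mult zeros M ≡ 0) where
    C*⇒good : C* M G → Good M F
    C*⇒good C = record
      { enough    = λ {d} ne → subst (mult d M ≤_) (mult-DS ne) (proj₁ (fits d))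
      ; exact     = λ {d} ne ∉Δ → subst (_≤ mult d M) (mult-DS ne) (proj₂ (fits d) ∉Δ)
      ; connected = λ i {u} {u′} {v} {v′} → connected-enum {i} (C*.connected C i) {u} {u′} {v} {v′} }
      where
      fits : Fits M (λ d → mult d (DS G))
      fits = extends⇒fits (C*.degrees C)

    good⇒C* : Good M F → C* M G
    good⇒C* good = record
      { degrees   = fits⇒extends M (DS G) fits
      ; connected = λ i → connected-drop (Good.connected good i) }
      where
      fits : Fits M (λ d → mult d (DS G))
      fits d with d ≟ᵈ zeros
      ... | yes refl = ℕ.≤-reflexive (trans M-zeros (sym mult-DS-zeros))
                     , λ _ → ℕ.≤-trans (ℕ.≤-reflexive mult-DS-zeros) z≤n
      ... | no ne = subst (mult d M ≤_) (sym (mult-DS ne)) (Good.enough good ne)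
                  , λ ∉Δ → subst (_≤ mult d M) (sym (mult-DS ne)) (Good.exact good ne ∉Δ)

    -- `Good` quantifies over infinitely many degrees, so its decision goes through the finite list
    -- of degrees and `extends?`.
    good? : Dec (Good M F)
    good? = map′ (λ (e , conn) → C*⇒good record { degrees = e ; connected = λ i → connected-drop (λ {u} {u′} {v} {v′} → conn i u u′ v v′) })
      (λ g → C*.degrees (good⇒C* g) , λ i u u′ v v′ → Good.connected g i)
      (extends? M (DS G) ×-dec all? λ i → all? λ u → all? λ u′ → all? λ v → all? λ v′ →
        color? i u u′ →-dec (color? i v v′ →-dec star? (color? i) u v))

good-resp : ∀ {c n M} {F F′ : Coloring c n} → (∀ i {u v} → Coloring.Color F i u v → Coloring.Color F′ i u v) →
            (∀ i {u v} → Coloring.Color F′ i u v → Coloring.Color F i u v) → Good M F → Good M F′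
good-resp {M = M} {F} {F′} to from good = record
  { enough    = λ {d} ne → subst (mult d M ≤_) (same d) (Good.enough good ne)
  ; exact     = λ {d} ne ∉Δ → subst (_≤ mult d M) (same d) (Good.exact good ne ∉Δ)
  ; connected = λ i → connected-⇔ (to i) (from i) (Good.connected good i) }
  where
  same-degree : ∀ v → colorDegree F v ≡ colorDegree F′ v
  same-degree v = Vec.tabulate-cong λ i → count-≐ (Coloring.color? F i v) (Coloring.color? F′ i v) (to i) (from i)
  same : ∀ d → degreeCount F d ≡ degreeCount F′ d
  same d = count-≐ (λ v → colorDegree F v ≟ᵈ d) (λ v → colorDegree F′ v ≟ᵈ d)
             (λ {v} e → trans (sym (same-degree v)) e) (λ {v} e → trans (same-degree v) e)

-- Decision diagrams by Myhill–Nerode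

maximum-≤ : ∀ {n N} (f : Fin n → ℕ) → (∀ i → f i ≤ N) → maximum f ≤ N
maximum-≤ f h = max≤v⁺ {xs = map f (allFin _)} z≤n (All.map⁺ (All.tabulate λ {i} _ → h i))

≤-maximum : ∀ {n} (f : Fin n → ℕ) i → f i ≤ maximum f
≤-maximum f i = All.lookup (xs≤max 0 (map f (allFin _))) (∈-map⁺ f (∈-allFin i))

least : ∀ {n} {P : Pred (Fin n) 0ℓ} → Decidable P → ∃ P → ∃ λ x → P x × (∀ y → y Fin.< x → ¬ P y)
least {suc n} {P} P? (x , p) with P? zero
... | yes p₀ = zero , p₀ , λ _ ()
... | no ¬p₀ with x | p
... | zero  | p = contradiction p ¬p₀
... | suc x | p with least (P? ∘ suc) (x , p)
... | y , q , min = suc y , q , λ { zero _ → ¬p₀ ; (suc z) (s≤s z<y) → min z z<y }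

module Words (c m : ℕ) where
  -- A letter is the number of the arc taken at an edge: `zero` leaves the edge uncolored, `suc j`
  -- gives it color `j`.
  Word : Set
  Word = Fin m → Fin (suc c)

  abstract
    splice : ℕ → Word → Word → Word
    splice i x r k with toℕ k ℕ.<? i
    ... | yes _ = x k
    ... | no _  = r k

    splice-< : ∀ {i x r k} → toℕ k < i → splice i x r k ≡ x k
    splice-< {i} {x} {r} {k} h with toℕ k ℕ.<? i
    ... | yes _ = refl
    ... | no ¬h = contradiction h ¬h

    splice-≥ : ∀ {i x r k} → i ≤ toℕ k → splice i x r k ≡ r k
    splice-≥ {i} {x} {r} {k} h with toℕ k ℕ.<? i
    ... | yes h′ = contradiction h (ℕ.<⇒≱ h′)
    ... | no _ = refl

    splice-cong : ∀ i {x x′ r r′} → (∀ k → x k ≡ x′ k) → (∀ k → r k ≡ r′ k) → ∀ k → splice i x r k ≡ splice i x′ r′ k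
    splice-cong i e e′ k with toℕ k ℕ.<? i
    ... | yes _ = e k
    ... | no _  = e′ k

  update : Word → Fin m → Fin (suc c) → Word
  update x i j k = if does (k ≟ i) then j else x k

  update-here : ∀ x i j → update x i j i ≡ j
  update-here x i j with i ≟ i
  ... | yes _ = refl
  ... | no ne = contradiction refl ne

  update-else : ∀ x {i} j {k} → k ≢ i → update x i j k ≡ x k
  update-else x {i} j {k} ne with k ≟ i
  ... | yes e = contradiction e ne
  ... | no _ = refl

  update-same : ∀ x i k → update x i (x i) k ≡ x k
  update-same x i k with k ≟ i
  ... | yes refl = refl
  ... | no _ = refl

  -- The letter at edge `i` may be counted as the last one of the prefix or as the first one of the
  -- rest. This links a node to its successors.
  splice-update : ∀ x r i j k → splice (suc (toℕ i)) (update x i j) r k ≡ splice (toℕ i) x (update r i j) k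
  splice-update x r i j k with ℕ.<-cmp (toℕ k) (toℕ i)
  ... | tri< k<i k≢i _ = trans (splice-< (ℕ.m<n⇒m<1+n k<i)) (trans (update-else x j (k≢i ∘ cong toℕ)) (sym (splice-< k<i)))
  ... | tri≈ _ e _ with Fin.toℕ-injective e
  ... | refl = trans (splice-< ℕ.≤-refl) (trans (update-here x k j) (sym (trans (splice-≥ ℕ.≤-refl) (update-here r k j))))
  splice-update x r i j k | tri> _ k≢i i<k =
    trans (splice-≥ i<k) (sym (trans (splice-≥ (ℕ.<⇒≤ i<k)) (update-else r j (k≢i ∘ cong toℕ))))

module Nerode {c m : ℕ} (P : Words.Word c m → Set) where
  open Words c m

  -- A full word represents its prefix of length `i`; `splice` overwrites the remaining letters.
  Live : ℕ → Word → Set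
  Live i x = ∃ λ r → P (splice i x r)

  record _∼[_]_ (x : Word) (i : ℕ) (y : Word) : Set where
    constructor equivalent
    field
      future : ∀ r → P (splice i x r) ⇔ P (splice i y r)

  open _∼[_]_ public

module Diagram {c m : ℕ} (P : Words.Word c m → Set) (P? : Decidable P)
  (resp : ∀ {f g} → (∀ k → f k ≡ g k) → P f → P g) where
  open Words c m
  open Nerode P

  private
    W = suc c ^ m

    word : Fin W → Word
    word = Fin.finToFun

    splice-respʳ : ∀ i x {r r′} → (∀ k → r k ≡ r′ k) → P (splice i x r) → P (splice i x r′)
    splice-respʳ i x {r} {r′} e = resp (splice-cong i (λ _ → refl) e)

    splice-respˡ : ∀ i {x x′} r → (∀ k → x k ≡ x′ k) → P (splice i x r) → P (splice i x′ r)
    splice-respˡ i r e = resp (splice-cong i e λ _ → refl)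

  private
    abstract
      live? : ∀ i x → Dec (Live i x)
      live? i x = map′ (λ (r , h) → word r , h)
        (λ (r , h) → Fin.funToFin r , splice-respʳ i x (λ k → sym (Fin.finToFun-funToFin r k)) h)
        (any? λ r → P? (splice i x (word r)))

      _∼?[_]_ : ∀ x i y → Dec (x ∼[ i ] y)
      x ∼?[ i ] y = map′
        (λ h → equivalent λ r → mk⇔
          (λ p → splice-respʳ i y (Fin.finToFun-funToFin r) (proj₁ (h (Fin.funToFin r)) (splice-respʳ i x (λ k → sym (Fin.finToFun-funToFin r k)) p)))
          (λ p → splice-respʳ i x (Fin.finToFun-funToFin r) (proj₂ (h (Fin.funToFin r)) (splice-respʳ i y (λ k → sym (Fin.finToFun-funToFin r k)) p))))
        (λ h r → ⇔-to (future h (word r)) , ⇔-from (future h (word r)))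
        (all? λ r → (P? (splice i x (word r)) →-dec P? (splice i y (word r)))
              ×-dec (P? (splice i y (word r)) →-dec P? (splice i x (word r))))

    ∼-sym : ∀ {i x y} → x ∼[ i ] y → y ∼[ i ] x
    ∼-sym h = equivalent λ r → mk⇔ (⇔-from (future h r)) (⇔-to (future h r))

    ∼-trans : ∀ {i x y z} → x ∼[ i ] y → y ∼[ i ] z → x ∼[ i ] z
    ∼-trans h k = equivalent λ r → mk⇔ (⇔-to (future k r) ∘ ⇔-to (future h r)) (⇔-from (future h r) ∘ ⇔-from (future k r))

    ∼-≗ : ∀ i {x y} → (∀ k → x k ≡ y k) → x ∼[ i ] y
    ∼-≗ i e = equivalent λ r → mk⇔ (splice-respˡ i r e) (splice-respˡ i r (sym ∘ e))

    ∼-zero : ∀ {x y} → x ∼[ 0 ] y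
    ∼-zero = equivalent λ r → mk⇔ (resp λ k → trans (splice-≥ z≤n) (sym (splice-≥ z≤n))) (resp λ k → trans (splice-≥ z≤n) (sym (splice-≥ z≤n)))

    ∼-live : ∀ {i x y} → x ∼[ i ] y → Live i x → Live i y
    ∼-live h (r , p) = r , ⇔-to (future h r) p

    ∼-update : ∀ {i x y} j → x ∼[ toℕ i ] y → update x i j ∼[ suc (toℕ i) ] update y i j
    ∼-update {i} {x} {y} j h = equivalent λ r → mk⇔
      (λ p → resp (sym ∘ splice-update y r i j) (⇔-to (future h (update r i j)) (resp (splice-update x r i j) p)))
      (λ p → resp (sym ∘ splice-update x r i j) (⇔-from (future h (update r i j)) (resp (splice-update y r i j) p)))

    -- Nodes are the live prefixes that are least in their Nerode class.
    Canonical : Fin m × Fin W → Set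
    Canonical (i , x) = Live (toℕ i) (word x) × (∀ y → y Fin.< x → ¬ word y ∼[ toℕ i ] word x)

    canonical? : Decidable Canonical
    canonical? (i , x) = live? (toℕ i) (word x) ×-dec all? λ y → y <? x →-dec ¬? (word y ∼?[ toℕ i ] word x)

    node? : Decidable (λ z → Canonical (Fin.remQuot {m} W z))
    node? z = canonical? (Fin.remQuot {m} W z)

  abstract
    size : ℕ
    size = count node?

    label : Fin size → Fin m
    label α = proj₁ (Fin.remQuot {m} W (Enumeration.enum node? α))

    private
      prefixIndex : Fin size → Fin W
      prefixIndex α = proj₂ (Fin.remQuot {m} W (Enumeration.enum node? α))

    prefix : Fin size → Word
    prefix α = word (prefixIndex α)

    prefix-live : ∀ α → Live (toℕ (label α)) (prefix α)
    prefix-live α = proj₁ (Enumeration.enum-∈ node? α)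

    node-unique : ∀ {α β} → label α ≡ label β → prefix α ∼[ toℕ (label α) ] prefix β → α ≡ β
    node-unique {α} {β} e h = Enumeration.enum-injective node?
      (trans (sym (Fin.combine-remQuot {m} W _)) (trans (cong₂ Fin.combine e same-prefix) (Fin.combine-remQuot {m} W _)))
      where
      same-prefix : prefixIndex α ≡ prefixIndex β
      same-prefix = by-order (Fin.<-cmp (prefixIndex α) (prefixIndex β))
        where
        by-order : Tri (prefixIndex α Fin.< prefixIndex β) (prefixIndex α ≡ prefixIndex β) (prefixIndex β Fin.< prefixIndex α) →
                   prefixIndex α ≡ prefixIndex β
        by-order (tri≈ _ eq _) = eq
        by-order (tri< lt _ _) = contradiction (subst (λ i → prefix α ∼[ toℕ i ] prefix β) e h) (proj₂ (Enumeration.enum-∈ node? β) _ lt)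
        by-order (tri> _ _ gt) = contradiction (∼-sym h) (proj₂ (Enumeration.enum-∈ node? α) _ gt)

    find : ∀ i x → Live (toℕ i) x → ∃ λ α → label α ≡ i × prefix α ∼[ toℕ i ] x
    find i x live = from-least (least (λ y → word y ∼?[ toℕ i ] x) (Fin.funToFin x , ∼-≗ (toℕ i) (Fin.finToFun-funToFin x)))
      where
      from-least : (∃ λ y → word y ∼[ toℕ i ] x × (∀ z → z Fin.< y → ¬ word z ∼[ toℕ i ] x)) →
                   ∃ λ α → label α ≡ i × prefix α ∼[ toℕ i ] x
      from-least (y , h , min) = Enumeration.index node? canonical
        , trans (cong proj₁ at) (cong proj₁ (Fin.remQuot-combine {m} i y))
        , subst (λ z → word z ∼[ toℕ i ] x) (sym (trans (cong proj₂ at) (cong proj₂ (Fin.remQuot-combine {m} i y)))) h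
        where
        canonical : Canonical (Fin.remQuot {m} W (Fin.combine i y))
        canonical = subst Canonical (sym (Fin.remQuot-combine i y))
          (∼-live (∼-sym h) live , λ z z<y k → min z z<y (∼-trans k h))
        at : Fin.remQuot {m} W (Enumeration.enum node? (Enumeration.index node? canonical)) ≡ Fin.remQuot {m} W (Fin.combine i y)
        at = cong (Fin.remQuot {m} W) (Enumeration.enum-index node? canonical)

  private
    -- Prefixes without accepted completion lead straight to `⊥ₜ`. So every inner node is live, and
    -- `width-≤` may restrict states to live prefixes.
    data Target (i : ℕ) (x : Word) : Node size → Set where
      top  : m ≤ i → P x → Target i x ⊤ₜ
      dead : ¬ Live i x → Target i x ⊥ₜ
      node : ∀ α → toℕ (label α) ≡ i → prefix α ∼[ i ] x → Target i x (inner α)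

    splice-full : ∀ {i} x r k → m ≤ i → splice i x r k ≡ x k
    splice-full x r k m≤i = splice-< (ℕ.<-≤-trans (Fin.toℕ<n k) m≤i)

    target : ∀ i x → ∃ (Target i x)
    target i x with i ℕ.<? m
    ... | no i≮m with P? x
    ... | yes p = ⊤ₜ , top (ℕ.≮⇒≥ i≮m) p
    ... | no ¬p = ⊥ₜ , dead λ (r , h) → ¬p (resp (λ k → splice-full x r k (ℕ.≮⇒≥ i≮m)) h)
    target i x | yes i<m with live? i x
    ... | no ¬l = ⊥ₜ , dead ¬l
    ... | yes l with find (Fin.fromℕ< i<m) x (subst (λ i → Live i x) (sym (Fin.toℕ-fromℕ< i<m)) l)
    ... | α , e , h = inner α , node α (trans (cong toℕ e) (Fin.toℕ-fromℕ< i<m)) (subst (λ i → prefix α ∼[ i ] x) (Fin.toℕ-fromℕ< i<m) h)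

    target-hits : ∀ {i x t} α → Target i x t → toℕ (label α) ≡ i → prefix α ∼[ i ] x → t ≡ inner α
    target-hits α (top m≤i _)  refl h = contradiction (Fin.toℕ<n (label α)) (ℕ.≤⇒≯ m≤i)
    target-hits α (dead ¬l)    refl h = contradiction (∼-live h (prefix-live α)) ¬l
    target-hits α (node β e k) refl h = cong inner (node-unique (Fin.toℕ-injective e)
      (subst (λ i → prefix β ∼[ i ] prefix α) (sym e) (∼-trans k (∼-sym h))))

    target-label : ∀ {i x t β} → Target i x t → t ≡ inner β → toℕ (label β) ≡ i
    target-label (node β e _) refl = e

    step-word : (α : Fin size) → Fin (suc c) → Word
    step-word α j = update (prefix α) (label α) j

    arc : Fin size → Fin (suc c) → Node size
    arc α j = proj₁ (target (suc (toℕ (label α))) (step-word α j))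

    arc-target : ∀ α j → Target (suc (toℕ (label α))) (step-word α j) (arc α j)
    arc-target α j = proj₂ (target (suc (toℕ (label α))) (step-word α j))

    root : Node size
    -- All words are equivalent at level 0, so the constant word stands for the empty prefix.
    root = proj₁ (target 0 (λ _ → zero))

    root-target : Target 0 (λ _ → zero) root
    root-target = proj₂ (target 0 (λ _ → zero))

    -- Dropping the last letter of the prefix gives a predecessor. It is live because the dropped
    -- letter can be put in front of a completion, and the arc for that letter leads back to `α`
    -- since equivalence is preserved by appending a letter.
    incoming : ∀ α {i} → toℕ (label α) ≡ suc i → ∃₂ λ β j → arc β j ≡ inner α
    incoming α {i} e = from-predecessor e′ (find i′ (prefix α) live)
      where
      i<m : i < m
      i<m = ℕ.<-trans (ℕ.n<1+n i) (subst (_< m) e (Fin.toℕ<n (label α)))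
      i′ = Fin.fromℕ< i<m
      e′ : toℕ (label α) ≡ suc (toℕ i′)
      e′ = trans e (cong suc (sym (Fin.toℕ-fromℕ< i<m)))
      live : Live (toℕ i′) (prefix α)
      live with subst (λ k → Live k (prefix α)) e′ (prefix-live α)
      ... | r , p = update r i′ (prefix α i′) , resp (splice-update (prefix α) r i′ (prefix α i′))
              (splice-respˡ (suc (toℕ i′)) r (sym ∘ update-same (prefix α) i′) p)
      from-predecessor : ∀ {k} → toℕ (label α) ≡ suc (toℕ k) → (∃ λ β → label β ≡ k × prefix β ∼[ toℕ k ] prefix α) →
                         ∃₂ λ β j → arc β j ≡ inner α
      from-predecessor e′ (β , refl , h) = β , prefix α (label β) , target-hits α (arc-target β _) e′
        (∼-trans (∼-≗ (suc (toℕ (label β))) (sym ∘ update-same (prefix α) (label β))) (∼-update _ (∼-sym h)))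

    -- Arcs raise the level, so none enters level 0, where all words are equivalent and the root is
    -- the only node. Nodes on higher levels are covered by `incoming`.
    unique : ∀ α → root ≡ inner α ⇔ (∀ β j → arc β j ≢ inner α)
    unique α = mk⇔
      (λ e β j e′ → ℕ.0≢1+n (trans (sym (target-label root-target e)) (target-label (arc-target β j) e′)))
      (λ no-arc → at-root no-arc (toℕ (label α)) refl)
      where
      at-root : (∀ β j → arc β j ≢ inner α) → ∀ k → toℕ (label α) ≡ k → root ≡ inner α
      at-root no-arc zero    e = target-hits α root-target e ∼-zero
      at-root no-arc (suc k) e = let β , j , h = incoming α e in contradiction h (no-arc β j)

  diagram : DD c m
  diagram = record
    { size = size ; label = label ; arc = arc
    ; level = λ {α} {j} e → target-label (arc-target α j) e
    ; root = root ; unique = unique }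

  open DD diagram using (Path; end; step; Uses; _represents_; RepresentsFamily; width)

  private
    -- Arcs skip no edge, so a path from level `i` to `⊤ₜ` spells exactly the letters from `i` on;
    -- `Uses` is the graph of this partial word.
    sound : ∀ {i x t} → Target i x t → (p : Path t) →
            ∃ λ r → P (splice i x r) × (∀ j k → Uses p j k ⇔ (i ≤ toℕ k × r k ≡ j))
    sound {x = x} (top m≤i px) end = x , resp (λ k → sym (splice-full x x k m≤i)) px
      , λ j k → mk⇔ (λ ()) λ (i≤k , _) → contradiction (Fin.toℕ<n k) (ℕ.≤⇒≯ (ℕ.≤-trans m≤i i≤k))
    sound (node .α refl h) (step α j p) with sound (arc-target α j) p
    ... | r , q , uses = update r (label α) j , ⇔-to (future h _) (resp (splice-update (prefix α) r (label α) j) q) , λ j′ k → mk⇔ (to j′ k) (from j′ k)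
      where
      to : ∀ j′ k → Uses (step α j p) j′ k → toℕ (label α) ≤ toℕ k × update r (label α) j k ≡ j′
      to j′ k (inj₁ (refl , refl)) = ℕ.≤-refl , update-here r (label α) j
      to j′ k (inj₂ u) with ⇔-to (uses j′ k) u
      ... | lt , e = ℕ.<⇒≤ lt , trans (update-else r j (λ { refl → ℕ.<-irrefl refl lt })) e
      from : ∀ j′ k → toℕ (label α) ≤ toℕ k × update r (label α) j k ≡ j′ → Uses (step α j p) j′ k
      from j′ k (le , e) with k ≟ label α
      ... | yes refl = inj₁ (e , refl)
      ... | no ne = inj₂ (⇔-from (uses j′ k) (ℕ.≤∧≢⇒< le (λ e′ → ne (sym (Fin.toℕ-injective e′))) , e))

    -- `n` is the number of edges still to be read. The recursion is on `n` because the path is only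
    -- being built, while `sound` recurses on a given path.
    complete : ∀ n {i x t} → i + n ≡ m → Target i x t → ∀ r → P (splice i x r) →
               ∃ λ (p : Path t) → ∀ j k → Uses p j k ⇔ (i ≤ toℕ k × r k ≡ j)
    complete n _ (top m≤i px) r _ = end , λ j k → mk⇔ (λ ()) λ (i≤k , _) → contradiction (Fin.toℕ<n k) (ℕ.≤⇒≯ (ℕ.≤-trans m≤i i≤k))
    complete n _ (dead ¬l) r q = contradiction (r , q) ¬l
    complete zero {i} e (node α refl h) r q = contradiction (trans (sym (ℕ.+-identityʳ _)) e) (ℕ.<⇒≢ (Fin.toℕ<n (label α)))
    complete (suc n) e (node α refl h) r q with complete n (trans (sym (ℕ.+-suc _ n)) e) (arc-target α (r (label α))) r
        (resp (sym ∘ splice-update (prefix α) r (label α) (r (label α)))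
          (splice-respʳ (toℕ (label α)) (prefix α) (sym ∘ update-same r (label α)) (⇔-from (future h r) q)))
    ... | p , uses = step α (r (label α)) p , λ j k → mk⇔ (to j k) (from j k)
      where
      to : ∀ j k → Uses (step α (r (label α)) p) j k → toℕ (label α) ≤ toℕ k × r k ≡ j
      to j k (inj₁ (refl , refl)) = ℕ.≤-refl , refl
      to j k (inj₂ u) with ⇔-to (uses j k) u
      ... | lt , e = ℕ.<⇒≤ lt , e
      from : ∀ j k → toℕ (label α) ≤ toℕ k × r k ≡ j → Uses (step α (r (label α)) p) j k
      from j k (le , e) with k ≟ label α
      ... | yes refl = inj₁ (e , refl)
      ... | no ne = inj₂ (⇔-from (uses j k) (ℕ.≤∧≢⇒< le (λ e′ → ne (sym (Fin.toℕ-injective e′))) , e))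

  Encodes : Word → ColoredSubset c m → Set
  Encodes f B = ∀ j k → k ∈ ColoredSubset.D B j ⇔ f k ≡ suc j

  encoding : ∀ B → ∃ λ f → Encodes f B
  encoding B = f , λ j k → mk⇔ (to j k) (from j k)
    where
    open ColoredSubset B
    f : Word
    f k with any? (λ j → k ∈? D j)
    ... | yes (j , _) = suc j
    ... | no _ = zero
    to : ∀ j k → k ∈ D j → f k ≡ suc j
    to j k h with any? (λ j → k ∈? D j)
    ... | no ¬h = contradiction (j , h) ¬h
    ... | yes (j′ , h′) with j′ ≟ j
    ... | yes refl = refl
    ... | no ne = contradiction h (disjoint ne h′)
    from : ∀ j k → f k ≡ suc j → k ∈ D j
    from j k e with any? (λ j → k ∈? D j)
    from j k refl | yes (_ , h) = h

  diagram-represents : ∀ {Q : ColoredSubset c m → Set} → (∀ B f → Encodes f B → Q B ⇔ P f) → RepresentsFamily Q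
  diagram-represents {Q} Q⇔P B = mk⇔ to from
    where
    f = proj₁ (encoding B)
    enc = proj₂ (encoding B)
    to : (∃ λ p → p represents B) → Q B
    to (p , rep) with sound root-target p
    ... | r , q , uses = ⇔-from (Q⇔P B r λ j k → mk⇔
      (λ h → proj₂ (⇔-to (uses (suc j) k) (⇔-to (rep j k) h)))
      (λ e → ⇔-from (rep j k) (⇔-from (uses (suc j) k) (z≤n , e)))) (resp (λ k → splice-≥ z≤n) q)
    from : Q B → ∃ λ p → p represents B
    from qB with complete m refl root-target f (resp (λ k → sym (splice-≥ z≤n)) (⇔-to (Q⇔P B f enc) qB))
    ... | p , uses = p , λ j k → mk⇔
      (λ h → ⇔-from (uses (suc j) k) (z≤n , ⇔-to (enc j k) h))
      (λ u → ⇔-from (enc j k) (proj₂ (⇔-to (uses (suc j) k) u)))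

  -- Distinct nodes of one level have inequivalent prefixes, so any state that determines the class
  -- is injective on the level.
  width-≤ : ∀ {N} (state : ∀ (i : Fin m) x → Live (toℕ i) x → Fin N) →
            (∀ i x y l l′ → state i x l ≡ state i y l′ → x ∼[ toℕ i ] y) → width ≤ N
  width-≤ {N} state state-∼ = maximum-≤ _ λ i → subst (count (λ α → label α ≟ i) ≤_) (count-full N {λ _ → ⊤} (λ _ → yes tt) (λ _ → tt))
    (count-inj (λ α → label α ≟ i) (λ _ → yes tt) (λ α _ → state (label α) (prefix α) (prefix-live α)) (λ _ _ → tt) inj)
    where
    inj : ∀ {i} α β (p : label α ≡ i) (q : label β ≡ i) →
          state (label α) (prefix α) (prefix-live α) ≡ state (label β) (prefix β) (prefix-live β) → α ≡ β
    inj α β refl q e = node-unique (sym q) (at (prefix-live β) q e)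
      where
      at : ∀ {j} (l : Live (toℕ j) (prefix β)) → j ≡ label α →
           state (label α) (prefix α) (prefix-live α) ≡ state j (prefix β) l → prefix α ∼[ toℕ (label α) ] prefix β
      at l refl = state-∼ (label α) (prefix α) (prefix β) (prefix-live α) l

-- Multiplicities in the profile

module Profile {a b : ℕ} (1≤a : 1 ≤ a) (1≤b : 1 ≤ b) where
  M : List (ColoredDegree a)
  M = M⟨ a , b ⟩

  μ : Fin a → ColoredDegree a
  μ = mono b

  𝟏 : ColoredDegree a
  𝟏 = ones

  b≢0 : b ≢ 0
  b≢0 e = ℕ.<⇒≢ 1≤b (sym e)

  mono≢zeros : ∀ i → μ i ≢ zeros
  mono≢zeros i e = b≢0 (trans (sym (lookup-mono b i)) (trans (cong (λ d → Vec.lookup d i) e) (Vec.lookup-replicate i 0)))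

  ones≢zeros : 𝟏 ≢ zeros
  ones≢zeros e = differ (Fin.fromℕ< 1≤a)
    where
    differ : ¬ Fin a
    differ i with () ← trans (sym (lookup-ones i)) (trans (cong (λ d → Vec.lookup d i) e) (Vec.lookup-replicate i 0))

  mono-injective : ∀ {i j} → μ i ≡ μ j → i ≡ j
  mono-injective {i} {j} e with i ≟ j
  ... | yes eq = eq
  ... | no ne = contradiction (trans (sym (lookup-mono b i)) (trans (cong (λ d → Vec.lookup d i) e) (lookup-mono-else b ne))) b≢0

  ones∉Δ : ¬ 𝟏 ∈Δ
  ones∉Δ (i , two , _) with () ← trans (sym (lookup-ones i)) two

  ones≡mono⇒b≡1 : ∀ {i} → μ i ≡ 𝟏 → b ≡ 1
  ones≡mono⇒b≡1 {i} e = trans (sym (lookup-mono b i)) (trans (cong (λ d → Vec.lookup d i) e) (lookup-ones i))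

  private
    mult-map : ∀ {n} (f : Fin n → ColoredDegree a) d → mult d (map f (allFin n)) ≡ count (λ i → f i ≟ᵈ d)
    mult-map {n} f d = go (allFin n)
      where
      go : ∀ is → mult d (map f is) ≡ length (filter (λ i → f i ≟ᵈ d) is)
      go [] = refl
      go (i ∷ is) with f i ≟ᵈ d
      ... | yes _ = cong suc (go is)
      ... | no _  = go is

    mult-replicate : ∀ (d : ColoredDegree a) n → mult d (replicate n d) ≡ n
    mult-replicate d zero    = refl
    mult-replicate d (suc n) = trans (mult-here d (replicate n d)) (cong suc (mult-replicate d n))

    mult-replicate-else : ∀ {d e : ColoredDegree a} n → e ≢ d → mult d (replicate n e) ≡ 0
    mult-replicate-else zero    ne = refl
    mult-replicate-else {d} {e} (suc n) ne = trans (mult-skip (replicate n e) ne) (mult-replicate-else n ne)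

    mult-M¹-mono : ∀ i → mult (μ i) (M¹ a b) ≡ 1
    mult-M¹-mono i = trans (mult-map (μ) (μ i))
      (count-unique-1 (λ j → μ j ≟ᵈ μ i) refl mono-injective)

    mult-M¹-else : ∀ {d} → (∀ i → μ i ≢ d) → mult d (M¹ a b) ≡ 0
    mult-M¹-else {d} ne = trans (mult-map (μ) d) (count-none (λ j → μ j ≟ᵈ d) ne)

  mult-mono : ∀ i → μ i ≢ 𝟏 → mult (μ i) M ≡ 1
  mult-mono i ne = trans (mult-++ (μ i) (M¹ a b) (M² a b)) (cong₂ _+_ (mult-M¹-mono i) (mult-replicate-else b (ne ∘ sym)))

  mult-ones : (∀ i → μ i ≢ 𝟏) → mult 𝟏 M ≡ b
  mult-ones ne = trans (mult-++ 𝟏 (M¹ a b) (M² a b)) (cong₂ _+_ (mult-M¹-else ne) (mult-replicate 𝟏 b))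

  mult-mono-ones : ∀ i → μ i ≡ 𝟏 → mult 𝟏 M ≡ 2
  mult-mono-ones i e = trans (mult-++ 𝟏 (M¹ a b) (M² a b)) (cong₂ _+_
    (trans (cong (λ d → mult d (M¹ a b)) (sym e)) (mult-M¹-mono i))
    (trans (mult-replicate 𝟏 b) (ones≡mono⇒b≡1 e)))

  b≤mult-ones : b ≤ mult 𝟏 M
  b≤mult-ones = subst (b ≤_) (sym (mult-++ 𝟏 (M¹ a b) (M² a b)))
    (ℕ.≤-trans (ℕ.≤-reflexive (sym (mult-replicate 𝟏 b))) (ℕ.m≤n+m _ _))

  1≤mult-mono : ∀ i → 1 ≤ mult (μ i) M
  1≤mult-mono i = subst (1 ≤_) (sym (mult-++ (μ i) (M¹ a b) (M² a b)))
    (ℕ.≤-trans (ℕ.≤-reflexive (sym (mult-M¹-mono i))) (ℕ.m≤m+n _ _))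

  mult-else : ∀ {d} → (∀ i → μ i ≢ d) → 𝟏 ≢ d → mult d M ≡ 0
  mult-else {d} ne ne′ = trans (mult-++ d (M¹ a b) (M² a b)) (cong₂ _+_ (mult-M¹-else ne) (mult-replicate-else b ne′))

  mult-zeros : mult zeros M ≡ 0
  mult-zeros = mult-else mono≢zeros ones≢zeros

  -- `is-both` occurs only for `a = b = 1`, where the common degree of the center and the unit has
  -- multiplicity 2.
  data InProfile (d : ColoredDegree a) : Set where
    is-center  : ∀ i → μ i ≡ d → 𝟏 ≢ d → InProfile d
    is-unit    : (∀ i → μ i ≢ d) → 𝟏 ≡ d → InProfile d
    is-both    : ∀ i → μ i ≡ d → 𝟏 ≡ d → InProfile d
    is-neither : mult d M ≡ 0 → InProfile d

  in-profile : ∀ d → InProfile d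
  in-profile d with any? (λ i → μ i ≟ᵈ d) | 𝟏 ≟ᵈ d
  ... | yes (i , e) | yes e′ = is-both i e e′
  ... | yes (i , e) | no ne  = is-center i e ne
  ... | no ¬c       | yes e′ = is-unit (λ i e → ¬c (i , e)) e′
  ... | no ¬c       | no ne  = is-neither (mult-else (λ i e → ¬c (i , e)) ne)

  -- An admissible number of vertices of degree 𝟏 is determined by its residue modulo b + 1,
  -- except for a = b = 1, where one also has to know whether it is positive.
  module Match (f f′ : ColoredDegree a → ℕ)
    (bounded : ∀ {d} → d ≢ zeros → ¬ d ∈Δ → f d ≤ mult d M) (bounded′ : ∀ {d} → d ≢ zeros → ¬ d ∈Δ → f′ d ≤ mult d M)
    (units : f 𝟏 % suc b ≡ f′ 𝟏 % suc b)
    (centers : ∀ i → 1 ≤ f (μ i) → 1 ≤ f′ (μ i)) (centers′ : ∀ i → 1 ≤ f′ (μ i) → 1 ≤ f (μ i)) where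

    private
      ≤1 : ∀ {k l} → k ≤ 1 → l ≤ 1 → (1 ≤ k → 1 ≤ l) → (1 ≤ l → 1 ≤ k) → k ≡ l
      ≤1 {zero}  {zero}  _ _ _ _ = refl
      ≤1 {zero}  {suc l} _ _ _ h with () ← h (s≤s z≤n)
      ≤1 {suc k} {zero}  _ _ h _ with () ← h (s≤s z≤n)
      ≤1 {suc zero} {suc zero} _ _ _ _ = refl
      ≤1 {suc zero} {suc (suc l)} _ (s≤s ()) _ _
      ≤1 {suc (suc k)} (s≤s ()) _ _ _

      ≤2 : ∀ {k l} → k ≤ 2 → l ≤ 2 → k % 2 ≡ l % 2 → (1 ≤ k → 1 ≤ l) → (1 ≤ l → 1 ≤ k) → k ≡ l
      ≤2 {0} {0} _ _ _ _ _ = refl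
      ≤2 {1} {1} _ _ _ _ _ = refl
      ≤2 {2} {2} _ _ _ _ _ = refl
      ≤2 {0} {2} _ _ _ _ h with () ← h (s≤s z≤n)
      ≤2 {2} {0} _ _ _ h _ with () ← h (s≤s z≤n)
      ≤2 {suc (suc (suc _))} (s≤s (s≤s ())) _ _ _ _
      ≤2 {l = suc (suc (suc _))} _ (s≤s (s≤s ())) _ _ _

    match : ∀ {d} → d ≢ zeros → ¬ d ∈Δ → f d ≡ f′ d
    match {d} d≢0 ∉Δ with in-profile d
    ... | is-neither e = trans (zero-≤ e (bounded d≢0 ∉Δ)) (sym (zero-≤ e (bounded′ d≢0 ∉Δ)))
      where
      zero-≤ : ∀ {k l} → l ≡ 0 → k ≤ l → k ≡ 0
      zero-≤ refl = ℕ.n≤0⇒n≡0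
    ... | is-center i refl ne = ≤1 (subst (f d ≤_) (mult-mono i (ne ∘ sym)) (bounded d≢0 ∉Δ))
                                   (subst (f′ d ≤_) (mult-mono i (ne ∘ sym)) (bounded′ d≢0 ∉Δ)) (centers i) (centers′ i)
    ... | is-unit ne refl = trans (sym (m<n⇒m%n≡m (s≤s (subst (f d ≤_) (mult-ones ne) (bounded d≢0 ∉Δ)))))
                                  (trans units (m<n⇒m%n≡m (s≤s (subst (f′ d ≤_) (mult-ones ne) (bounded′ d≢0 ∉Δ)))))
    ... | is-both i e refl = ≤2 (subst (f d ≤_) (mult-mono-ones i e) (bounded d≢0 ∉Δ)) (subst (f′ d ≤_) (mult-mono-ones i e) (bounded′ d≢0 ∉Δ))
            (subst (λ n → f 𝟏 % suc n ≡ f′ 𝟏 % suc n) (ones≡mono⇒b≡1 e) units)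
            (subst (λ d → 1 ≤ f d → 1 ≤ f′ d) e (centers i)) (subst (λ d → 1 ≤ f′ d → 1 ≤ f d) e (centers′ i))

    -- Degrees in Δ may exceed their multiplicity in `M`, so only the lower bound has to be carried
    -- over. It has content only for a center degree with `b = 2`; the multiplicity is then 1, and
    -- the center bit decides.
    match-enough : ∀ {d} r → d ∈Δ → mult d M ≤ f d + r → mult d M ≤ f′ d + r
    match-enough {d} r ∈Δ h with in-profile d
    ... | is-neither e = subst (_≤ f′ d + r) (sym e) z≤n
    ... | is-unit _ refl = contradiction ∈Δ ones∉Δ
    ... | is-both _ _ refl = contradiction ∈Δ ones∉Δ
    ... | is-center i refl ne = subst (_≤ f′ d + r) (sym one) (positive r (subst (_≤ f d + r) one h))
      where
      one = mult-mono i (ne ∘ sym)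
      positive : ∀ r → 1 ≤ f d + r → 1 ≤ f′ d + r
      positive zero    h = subst (1 ≤_) (sym (ℕ.+-identityʳ _)) (centers i (subst (1 ≤_) (ℕ.+-identityʳ _) h))
      positive (suc r) h = subst (1 ≤_) (sym (ℕ.+-suc (f′ d) r)) (s≤s z≤n)

-- Colored subgraphs of a host graph as words

module Host {a b : ℕ} (1≤a : 1 ≤ a) (1≤b : 1 ≤ b) {G : Graph} {m : ℕ} (O : EdgeOrdering G m) where
  open EdgeOrdering O
  open Profile 1≤a 1≤b public
  open Words a m

  n = Graph.order G

  EdgeIn : Pred (Fin m) 0ℓ → Word → Fin a → Rel (Fin n) 0ℓ
  EdgeIn In f c u v = ∃ λ k → In k × f k ≡ suc c × ends k ≐ (u , v)

  edge-map : ∀ {In In′ : Pred (Fin m) 0ℓ} {f f′ : Word} → (∀ {k} → In k → In′ k × f k ≡ f′ k) →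
             ∀ {c u v} → EdgeIn In f c u v → EdgeIn In′ f′ c u v
  edge-map to (k , p , e , h) = k , proj₁ (to p) , trans (sym (proj₂ (to p))) e , h

  module Subword (In : Pred (Fin m) 0ℓ) (in? : Decidable In) (f : Word) where
    Edge : Fin a → Rel (Fin n) 0ℓ
    Edge = EdgeIn In f

    edge? : ∀ c → Decidable₂ (Edge c)
    edge? c u v = any? λ k → in? k ×-dec f k ≟ suc c ×-dec ends k ≐? (u , v)

    edge-symm : ∀ c → Symmetric (Edge c)
    edge-symm c (k , p , e , h) = k , p , e , ≐-swapʳ h

    edge-incident : ∀ {c u v} → Edge c u v → ∃ λ k → In k × Incident u k
    edge-incident (k , p , _ , inj₁ (e , _)) = k , p , inj₁ (sym e)
    edge-incident (k , p , _ , inj₂ (_ , e)) = k , p , inj₂ (sym e)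

    letter-edge : ∀ {c k} → In k → f k ≡ suc c → Edge c (proj₁ (ends k)) (proj₂ (ends k))
    letter-edge {k = k} p e = k , p , e , inj₁ (refl , refl)

    subword : Coloring a n
    subword = record
      { Color    = Edge
      ; color?   = edge?
      ; symm     = edge-symm
      ; irrefl   = λ c (k , _ , _ , h) → irr k h
      ; disjoint = λ ne (k , _ , e , h) (l , _ , e′ , h′) → disj ne e e′ (distinct (≐-joinʳ h h′)) }
      where
      irr : ∀ k {u} → ¬ (ends k ≐ (u , u))
      irr k (inj₁ (p , q)) = Graph.irrefl G (subst₂ (Graph.Adj G) p q (isEdge k))
      irr k (inj₂ (p , q)) = Graph.irrefl G (subst₂ (Graph.Adj G) p q (isEdge k))
      disj : ∀ {c c′ k l} → c ≢ c′ → f k ≡ suc c → f l ≡ suc c′ → ¬ (k ≡ l)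
      disj ne e e′ refl with refl ← trans (sym e) e′ = ne refl

  module Whole f = Subword (λ _ → ⊤) (λ _ → yes tt) f

  whole : Word → Coloring a n
  whole = Whole.subword

  Accepted : Word → Set
  Accepted f = Good M (whole f)

  accepted? : Decidable Accepted
  accepted? f = DropIsolated.good? (whole f) mult-zeros

  accepted-resp : ∀ {f g} → (∀ k → f k ≡ g k) → Accepted f → Accepted g
  accepted-resp e = good-resp (λ _ → edge-map λ {k} _ → tt , e k) (λ _ → edge-map λ {k} _ → tt , sym (e k))

  open Diagram Accepted accepted? accepted-resp public
  open Nerode Accepted public

  family : ∀ B f → Encodes f B → C* M (edgeInduced O B) ⇔ Accepted f
  family B f enc = mk⇔
    (λ C → good-resp {F = coloring (spanning O B)} {whole f}
      (λ i (k , p , h) → k , tt , ⇔-to (enc i k) p , h) (λ i (k , _ , p , h) → k , ⇔-from (enc i k) p , h)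
      (DropIsolated.C*⇒good (coloring (spanning O B)) mult-zeros C))
    (λ g → DropIsolated.good⇒C* (coloring (spanning O B)) mult-zeros (good-resp {F = whole f} {coloring (spanning O B)}
      (λ i (k , _ , p , h) → k , ⇔-from (enc i k) p , h) (λ i (k , p , h) → k , tt , ⇔-to (enc i k) p , h) g))

  module At (i : Fin m) where
    Earlier Later : Pred (Fin m) 0ℓ
    Earlier k = toℕ k < toℕ i
    Later k = toℕ i ≤ toℕ k

    module Past x = Subword Earlier (λ k → toℕ k ℕ.<? toℕ i) x
    module Future r = Subword Later (λ k → toℕ i ℕ.≤? toℕ k) r

    pastGraph futureGraph : Word → Coloring a n
    pastGraph = Past.subword
    futureGraph = Future.subword

    Open : Pred (Fin n) 0ℓ
    Open u = ∃ λ k → Later k × Incident u k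

    open? : Decidable Open
    open? u = any? λ k → toℕ i ℕ.≤? toℕ k ×-dec incident? u k

    prefixDegree : Word → Fin n → ColoredDegree a
    prefixDegree x = colorDegree (pastGraph x)

    closedCount : Word → ColoredDegree a → ℕ
    closedCount x d = count λ u → ¬? (open? u) ×-dec prefixDegree x u ≟ᵈ d

    module _ (x r : Word) where
      private
        f = splice (toℕ i) x r

      splice⁺ : ∀ {c u v} → Past.Edge x c u v ⊎ Future.Edge r c u v → Whole.Edge f c u v
      splice⁺ (inj₁ h) = edge-map {f = x} {f} (λ lt → tt , sym (splice-< lt)) h
      splice⁺ (inj₂ h) = edge-map {f = r} {f} (λ le → tt , sym (splice-≥ le)) h

      splice⁻ : ∀ {c u v} → Whole.Edge f c u v → Past.Edge x c u v ⊎ Future.Edge r c u v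
      splice⁻ (k , _ , e , h) with toℕ k ℕ.<? toℕ i
      ... | yes lt = inj₁ (k , lt , trans (sym (splice-< lt)) e , h)
      ... | no ¬lt = inj₂ (k , ℕ.≮⇒≥ ¬lt , trans (sym (splice-≥ (ℕ.≮⇒≥ ¬lt))) e , h)

      past-future : ∀ {c c′ u v} → Past.Edge x c u v → ¬ Future.Edge r c′ u v
      past-future (k , lt , _ , h) (l , le , _ , h′) with refl ← distinct (≐-joinʳ h h′) = ℕ.<⇒≱ lt le

      splice-degree : ∀ c u → Coloring.degree (whole f) c u ≡ Coloring.degree (pastGraph x) c u + Coloring.degree (futureGraph r) c u
      splice-degree c u = count-split (Coloring.color? (whole f) c u) (Coloring.color? (pastGraph x) c u) (Coloring.color? (futureGraph r) c u)
        (Coloring.color? (pastGraph x) c u) (λ _ h → h)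
        (λ h ¬p → [ (λ p → contradiction p ¬p) , id ]′ (splice⁻ h)) (λ h → splice⁺ (inj₁ h) , h)
        (λ h → splice⁺ (inj₂ h) , λ p → past-future p h)

      splice-colorDegree : ∀ u → colorDegree (whole f) u ≡ tabulate λ c → Vec.lookup (prefixDegree x u) c + Coloring.degree (futureGraph r) c u
      splice-colorDegree u = Vec.tabulate-cong λ c → trans (splice-degree c u)
        (cong (_+ Coloring.degree (futureGraph r) c u) (sym (lookup-degree (pastGraph x) u c)))

      closed-degree : ∀ {u} → ¬ Open u → colorDegree (whole f) u ≡ prefixDegree x u
      closed-degree {u} ¬open = vec-ext λ c → trans (lookup-degree (whole f) u c) (trans (splice-degree c u)
        (trans (cong (Coloring.degree (pastGraph x) c u +_) (count-none (Coloring.color? (futureGraph r) c u) λ v h → ¬open (Future.edge-incident r h)))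
          (trans (ℕ.+-identityʳ _) (sym (lookup-degree (pastGraph x) u c)))))

      openCount : ColoredDegree a → ℕ
      openCount d = count λ u → open? u ×-dec colorDegree (whole f) u ≟ᵈ d

      degreeCount-split : ∀ d → degreeCount (whole f) d ≡ closedCount x d + openCount d
      degreeCount-split d = count-split (λ u → colorDegree (whole f) u ≟ᵈ d)
        (λ u → ¬? (open? u) ×-dec prefixDegree x u ≟ᵈ d) (λ u → open? u ×-dec colorDegree (whole f) u ≟ᵈ d) (λ u → ¬? (open? u))
        (λ e ¬o → ¬o , trans (sym (closed-degree ¬o)) e)
        (λ {u} e ¬¬o → decidable-stable (open? u) ¬¬o , e)
        (λ (¬o , e) → trans (closed-degree ¬o) e , ¬o)
        (λ (o , e) → e , λ ¬o → ¬o o)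

      closed≤ : Accepted f → ∀ {d} → d ≢ zeros → ¬ d ∈Δ → closedCount x d ≤ mult d M
      closed≤ good {d} ne ∉Δ = ℕ.≤-trans (subst (closedCount x d ≤_) (sym (degreeCount-split d)) (ℕ.m≤m+n _ _)) (Good.exact good ne ∉Δ)

    open-degree : ∀ x {u} → Open u → ¬ Frontier i u → prefixDegree x u ≡ zeros
    open-degree x {u} o ¬φ = vec-ext λ c → trans (lookup-degree (pastGraph x) u c)
      (trans (count-none (Coloring.color? (pastGraph x) c u) λ v h → ¬φ (Past.edge-incident x h , o)) (sym (Vec.lookup-replicate c 0)))

    -- What a state has to remember. `started` and `centers` are the two bits for each color; being
    -- implications, they make `≼` a comparison, and equivalence uses it in both directions.
    record _≼_ (x y : Word) : Set where
      field
        degrees : ∀ {u} → Frontier i u → prefixDegree x u ≡ prefixDegree y u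
        joined  : ∀ c {u v} → Frontier i u → Frontier i v → Star (Past.Edge x c) u v → Star (Past.Edge y c) u v
        started : ∀ c {u} → Touched (Past.Edge x c) u → ∃ (Touched (Past.Edge y c))
        units   : closedCount x 𝟏 % suc b ≡ closedCount y 𝟏 % suc b
        centers : ∀ c → 1 ≤ closedCount x (μ c) → 1 ≤ closedCount y (μ c)

    module _ {x y : Word} (x≼y : x ≼ y) (y≼x : y ≼ x) (liveʸ : Live (toℕ i) y) where
      private
        r′ = proj₁ liveʸ
        goodʸ = proj₂ liveʸ
        module ≼ = _≼_ x≼y
        module ≽ = _≼_ y≼x

      -- Which colors touch a frontier vertex can be read off its degree, so the state spends no
      -- further bits on it.
      prefix-touched : ∀ {x y : Word} → x ≼ y → ∀ c {u} → Frontier i u → Touched (Past.Edge y c) u → Touched (Past.Edge x c) u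
      prefix-touched {x} {y} x≼y c {u} φ (v , h) = count-∃ (Coloring.color? (pastGraph x) c u)
        (subst (1 ≤_) (trans (sym (lookup-degree (pastGraph y) u c)) (trans (cong (λ d → Vec.lookup d c) (sym (_≼_.degrees x≼y φ))) (lookup-degree (pastGraph x) u c)))
          (count-pos (Coloring.color? (pastGraph y) c u) h))

      private
        connectedness : ∀ r → Accepted (splice (toℕ i) x r) → ∀ c → Coloring.Connected (whole (splice (toℕ i) y r)) c
        connectedness r good c = connected-⇔ (splice⁺ y r) (splice⁻ y r)
          -- The completion `r′` that keeps `y` alive serves as the second future.
          (Exchange.exchanged {A = Past.Edge x c} {Past.Edge y c} {Future.Edge r c} {Future.Edge r′ c} {Frontier i}
            (Past.edge-symm x c) (Past.edge-symm y c) (Future.edge-symm r c)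
            (λ (_ , h) (_ , k) → Past.edge-incident x h , Future.edge-incident r k)
            (λ (_ , h) (_ , k) → Past.edge-incident y h , Future.edge-incident r k)
            (λ (_ , h) (_ , k) → Past.edge-incident y h , Future.edge-incident r′ k)
            (≼.joined c) (prefix-touched x≼y c) (prefix-touched y≼x c) (≽.started c)
            (any? λ u → frontier? i u ×-dec any? (Past.edge? y c u))
            (connected-⇔ (splice⁻ x r) (splice⁺ x r) (Good.connected good c))
            (connected-⇔ (splice⁻ y r′) (splice⁺ y r′) (Good.connected goodʸ c)))

        openCounts : ∀ r d → openCount x r d ≡ openCount y r d
        openCounts r d = count-≐ (λ u → open? u ×-dec colorDegree (whole (splice (toℕ i) x r)) u ≟ᵈ d)
                                 (λ u → open? u ×-dec colorDegree (whole (splice (toℕ i) y r)) u ≟ᵈ d)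
          (λ {u} (o , e) → o , trans (sym (same u o)) e) (λ {u} (o , e) → o , trans (same u o) e)
          where
          prefixes : ∀ u → Open u → prefixDegree x u ≡ prefixDegree y u
          prefixes u o = by-cases (frontier? i u)
            where
            by-cases : Dec (Frontier i u) → prefixDegree x u ≡ prefixDegree y u
            by-cases (yes φ) = ≼.degrees φ
            by-cases (no ¬φ) = trans (open-degree x o ¬φ) (sym (open-degree y o ¬φ))
          same : ∀ u → Open u → colorDegree (whole (splice (toℕ i) x r)) u ≡ colorDegree (whole (splice (toℕ i) y r)) u
          same u o = trans (splice-colorDegree x r u) (trans (Vec.tabulate-cong λ c →
            cong (λ d → Vec.lookup d c + Coloring.degree (futureGraph r) c u) (prefixes u o)) (sym (splice-colorDegree y r u)))

      -- Unfinished vertices get the same degrees from both prefixes. Finished ones are compared by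
      -- `Match`, whose upper bounds for `y` come from the completion `r′` and not from `r`.
      exchange : ∀ r → Accepted (splice (toℕ i) x r) → Accepted (splice (toℕ i) y r)
      exchange r good = record
        { enough = λ {d} ne → subst (mult d M ≤_) (sym (splitʸ d)) (enough ne (∈Δ? d))
        ; exact  = λ {d} ne ∉Δ → subst (_≤ mult d M) (trans (splitˣ d) (trans (cong (_+ openCount x r d) (match ne ∉Δ)) (sym (splitʸ d)))) (Good.exact good ne ∉Δ)
        ; connected = connectedness r good }
        where
        open Match (closedCount x) (closedCount y) (closed≤ x r good) (closed≤ y r′ goodʸ) ≼.units ≼.centers ≽.centers
        splitˣ : ∀ d → degreeCount (whole (splice (toℕ i) x r)) d ≡ closedCount x d + openCount x r d
        splitˣ = degreeCount-split x r
        splitʸ : ∀ d → degreeCount (whole (splice (toℕ i) y r)) d ≡ closedCount y d + openCount x r d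
        splitʸ d = trans (degreeCount-split y r d) (cong (closedCount y d +_) (sym (openCounts r d)))
        enough : ∀ {d} → d ≢ zeros → Dec (d ∈Δ) → mult d M ≤ closedCount y d + openCount x r d
        enough {d} ne (yes ∈Δ) = match-enough (openCount x r d) ∈Δ (subst (mult d M ≤_) (splitˣ d) (Good.enough good ne))
        enough {d} ne (no ∉Δ)  = subst (λ k → mult d M ≤ k + openCount x r d) (match ne ∉Δ) (subst (mult d M ≤_) (splitˣ d) (Good.enough good ne))

    ≼-∼ : ∀ {x y} → x ≼ y → y ≼ x → Live (toℕ i) x → Live (toℕ i) y → x ∼[ toℕ i ] y
    ≼-∼ h k l l′ = equivalent λ r → mk⇔ (exchange h k l′ r) (exchange k h l r)

-- Final and partial degrees

fin2 : ∀ {k} → k ≤ 1 → Fin 2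
fin2 p = Fin.fromℕ< (s≤s p)

fin2-injective : ∀ {k l} (p : k ≤ 1) (q : l ≤ 1) → fin2 p ≡ fin2 q → k ≡ l
fin2-injective p q = Fin.fromℕ<-injective _ _ (s≤s p) (s≤s q)

funToFin-injective : ∀ {k l} {f g : Fin k → Fin l} → Fin.funToFin f ≡ Fin.funToFin g → ∀ i → f i ≡ g i
funToFin-injective {f = f} {g} e i = trans (sym (Fin.finToFun-funToFin f i)) (trans (cong (λ z → Fin.finToFun z i) e) (Fin.finToFun-funToFin g i))

bit : ∀ {P : Set} → Dec P → Fin 2
bit (yes _) = suc zero
bit (no _)  = zero

bit-true : ∀ {P Q : Set} (p : Dec P) (q : Dec Q) → bit p ≡ bit q → P → Q
bit-true _ (yes q) _ _ = q
bit-true (no ¬p) _ _ p = contradiction p ¬p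
bit-true (yes _) (no _) () _

least-unique : ∀ {n} {P Q : Pred (Fin n) 0ℓ} → (∀ {x} → P x → Q x) → (∀ {x} → Q x → P x) →
               ∀ {x y} → P x → (∀ z → z Fin.< x → ¬ P z) → Q y → (∀ z → z Fin.< y → ¬ Q z) → x ≡ y
least-unique to from {x} {y} p minP q minQ with Fin.<-cmp x y
... | tri≈ _ e _ = e
... | tri< lt _ _ = contradiction (to p) (minQ x lt)
... | tri> _ _ gt = contradiction (from q) (minP y gt)

module Degrees {a b : ℕ} (1≤a : 1 ≤ a) (1≤b : 1 ≤ b) where
  open Profile {a} {b} 1≤a 1≤b

  data Final (d : ColoredDegree a) : Set where
    final-zero : d ≡ zeros → Final d
    final-unit : d ≡ 𝟏 → Final d
    final-mono : ∀ t i → t ≡ b ⊎ t ≡ 2 → d ≡ mono t i → Final d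

  final : ∀ {n} {F : Coloring a n} → Good M F → ∀ u → Final (colorDegree F u)
  final {F = F} good u = by-cases (colorDegree F u ≟ᵈ zeros) (∈Δ? (colorDegree F u)) (in-profile (colorDegree F u))
    where
    d = colorDegree F u
    by-cases : Dec (d ≡ zeros) → Dec (d ∈Δ) → InProfile d → Final d
    by-cases (yes e) _ _ = final-zero e
    by-cases (no ne) (yes (i , two , zer)) _ = final-mono 2 i (inj₂ refl) (is-mono i two zer)
    by-cases (no ne) (no ∉Δ) (is-center i e _) = final-mono b i (inj₁ refl) (sym e)
    by-cases (no ne) (no ∉Δ) (is-unit _ e) = final-unit (sym e)
    by-cases (no ne) (no ∉Δ) (is-both _ _ e) = final-unit (sym e)
    by-cases (no ne) (no ∉Δ) (is-neither e) = contradiction (subst (degreeCount F d ≤_) e (Good.exact good ne ∉Δ))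
      (ℕ.<⇒≱ (count-pos (λ v → colorDegree F v ≟ᵈ d) refl))

  -- The degrees that a vertex can have in a prefix: 2 ^ a + a * b many.
  Partial : ColoredDegree a → Set
  Partial d = (∀ i → Vec.lookup d i ≤ 1) ⊎ ∃₂ λ i (e : Fin b) → d ≡ mono (suc (suc (toℕ e))) i

  -- Below `zeros` and `𝟏` all entries are at most 1. Below `mono t i` a single color occurs, with
  -- value at most `b + 1`, where `b + 1` accounts for `t = 2` with `b = 1`. Values 0 and 1 are
  -- again 0/1-vectors, and the values from 2 to `b + 1` give the `b` further codes per color.
  partial : ∀ {d D} → (∀ i → Vec.lookup d i ≤ Vec.lookup D i) → Final D → Partial d
  partial le (final-zero refl) = inj₁ λ i → ℕ.≤-trans (le i) (ℕ.≤-trans (ℕ.≤-reflexive (Vec.lookup-replicate i 0)) z≤n)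
  partial le (final-unit refl) = inj₁ λ i → ℕ.≤-trans (le i) (ℕ.≤-reflexive (lookup-ones i))
  partial {d} le (final-mono t i t∈ refl) = by-value (Vec.lookup d i) refl
    where
    else-zero : ∀ j → j ≢ i → Vec.lookup d j ≡ 0
    else-zero j ne = ℕ.n≤0⇒n≡0 (subst (Vec.lookup d j ≤_) (lookup-mono-else t ne) (le j))
    t≤ : t ≡ b ⊎ t ≡ 2 → t ≤ suc b
    t≤ (inj₁ refl) = ℕ.n≤1+n b
    t≤ (inj₂ refl) = s≤s 1≤b
    small : Vec.lookup d i ≤ 1 → ∀ j → Vec.lookup d j ≤ 1
    small le j with j ≟ i
    ... | yes refl = le
    ... | no ne = subst (_≤ 1) (sym (else-zero j ne)) z≤n
    by-value : ∀ k → Vec.lookup d i ≡ k → Partial d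
    by-value 0 e = inj₁ (small (subst (_≤ 1) (sym e) z≤n))
    by-value 1 e = inj₁ (small (subst (_≤ 1) (sym e) (s≤s z≤n)))
    by-value (suc (suc k)) e = inj₂ (i , Fin.fromℕ< k<b , is-mono i (trans e (cong (λ j → suc (suc j)) (sym (Fin.toℕ-fromℕ< k<b)))) else-zero)
      where
      k<b : k < b
      k<b = ℕ.≤-pred (ℕ.≤-trans (subst (_≤ t) e (subst (Vec.lookup d i ≤_) (lookup-mono t i) (le i))) (t≤ t∈))

  partialCode : ∀ {d} → Partial d → Fin (2 ^ a + a * b)
  partialCode (inj₁ p)           = Fin.funToFin (λ i → fin2 (p i)) ↑ˡ (a * b)
  partialCode (inj₂ (i , e , _)) = 2 ^ a ↑ʳ Fin.combine i e

  partialCode-injective : ∀ {d d′} (p : Partial d) (p′ : Partial d′) → partialCode p ≡ partialCode p′ → d ≡ d′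
  partialCode-injective (inj₁ p) (inj₁ p′) e = vec-ext λ i →
    fin2-injective (p i) (p′ i) (funToFin-injective {f = λ i → fin2 (p i)} {λ i → fin2 (p′ i)} (Fin.↑ˡ-injective (a * b) _ _ e) i)
  partialCode-injective (inj₁ p) (inj₂ _) e = contradiction e (↑ˡ≢↑ʳ _ _)
  partialCode-injective (inj₂ _) (inj₁ p) e = contradiction (sym e) (↑ˡ≢↑ʳ _ _)
  partialCode-injective (inj₂ (i , e , refl)) (inj₂ (i′ , e′ , refl)) eq
    with refl , refl ← Fin.combine-injective i e i′ e′ (Fin.↑ʳ-injective (2 ^ a) _ _ eq) = refl

-- State codes for frontiers of arbitrary size.

module Code {a b : ℕ} (1≤a : 1 ≤ a) (1≤b : 1 ≤ b) {G : Graph} {m : ℕ} (O : EdgeOrdering G m) (i : Fin m) where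
  open EdgeOrdering O
  open Host {a} {b} 1≤a 1≤b O
  open At i
  open Degrees {a} {b} 1≤a 1≤b
  open Enumeration (frontier? i)
  open Words a m

  prefix≤ : ∀ x r u c → Vec.lookup (prefixDegree x u) c ≤ Vec.lookup (colorDegree (whole (splice (toℕ i) x r)) u) c
  prefix≤ x r u c = subst₂ _≤_ (sym (lookup-degree (pastGraph x) u c))
    (trans (sym (splice-degree x r c u)) (sym (lookup-degree (whole (splice (toℕ i) x r)) u c))) (ℕ.m≤m+n _ _)

  partial-live : ∀ {x} → Live (toℕ i) x → ∀ u → Partial (prefixDegree x u)
  partial-live {x} (r , good) u = partial (prefix≤ x r u) (final good u)

  -- `W` bounds the frontiers of all levels at once, so every level uses codes of the same length;
  -- `1 ≤ W` provides a default root.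
  module Wide {W : ℕ} (1≤W : 1 ≤ W) (Φ≤W : count (frontier? i) ≤ W) where
    fill : ∀ {N} → Fin N → (Fin n → Fin N) → ∀ {k} → Dec (k < count (frontier? i)) → Fin N
    fill z h (yes p) = h (enum (Fin.fromℕ< p))
    fill z h (no _)  = z

    -- The restriction of h to the frontier, padded to length W.
    spread : ∀ {N} → Fin N → (Fin n → Fin N) → Fin (N ^ W)
    spread z h = Fin.funToFin (λ t → fill z h (toℕ {W} t ℕ.<? count (frontier? i)))

    spread-injective : ∀ {N} {z : Fin N} (h h′ : Fin n → Fin N) → spread z h ≡ spread z h′ → ∀ {u} → Frontier i u → h u ≡ h′ u
    spread-injective {N} {z} h h′ e {u} φ = at-slot (toℕ t ℕ.<? count (frontier? i))
        (funToFin-injective {f = λ t → fill z h (toℕ {W} t ℕ.<? count (frontier? i))}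
                            {λ t → fill z h′ (toℕ {W} t ℕ.<? count (frontier? i))} e t)
      where
      t : Fin W
      t = Fin.inject≤ (index φ) Φ≤W
      t≡ : toℕ t ≡ toℕ (index φ)
      t≡ = Fin.toℕ-inject≤ (index φ) Φ≤W
      slot : ∀ (p : toℕ t < count (frontier? i)) → enum (Fin.fromℕ< p) ≡ u
      slot p = trans (cong enum (Fin.toℕ-injective (trans (Fin.toℕ-fromℕ< p) t≡))) (enum-index φ)
      at-slot : (p? : Dec (toℕ t < count (frontier? i))) → fill z h p? ≡ fill z h′ p? → h u ≡ h′ u
      at-slot (yes p) e = trans (cong h (sym (slot p))) (trans e (cong h′ (slot p)))
      at-slot (no ¬p) _ = contradiction (subst (_< count (frontier? i)) (sym t≡) (Fin.toℕ<n (index φ))) ¬p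

    module Roots (x : Word) (c : Fin a) where
      Reaches : Fin n → Fin (count (frontier? i)) → Set
      Reaches u s = Star (Past.Edge x c) u (enum s)

      reaches? : ∀ u → Decidable (Reaches u)
      reaches? u s = star? (Past.edge? x c) u (enum s)

      rootOf : ∀ {u} → Dec (∃ (Reaches u)) → Fin W
      rootOf {u} (yes e) = Fin.inject≤ (proj₁ (least (reaches? u) e)) Φ≤W
      -- The default for components that miss the frontier. A frontier vertex reaches itself and so
      -- falls under the first case.
      rootOf (no _)      = Fin.fromℕ< 1≤W

      -- The first frontier vertex in the component of u.
      root : Fin n → Fin W
      root u = rootOf (any? (reaches? u))

      root-cong : ∀ {u v} → Star (Past.Edge x c) u v → root u ≡ root v
      root-cong {u} {v} s = by-cases (any? (reaches? u)) (any? (reaches? v))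
        where
        to : ∀ {w} → Reaches u w → Reaches v w
        to r = Star.reverse (Past.edge-symm x c) s ◅◅ r
        from : ∀ {w} → Reaches v w → Reaches u w
        from r = s ◅◅ r
        by-cases : (p : Dec (∃ (Reaches u))) (q : Dec (∃ (Reaches v))) → rootOf p ≡ rootOf q
        by-cases (yes e) (yes e′) = cong (λ t → Fin.inject≤ t Φ≤W)
          (least-unique to from (proj₁ (proj₂ (least (reaches? u) e))) (proj₂ (proj₂ (least (reaches? u) e)))
            (proj₁ (proj₂ (least (reaches? v) e′))) (proj₂ (proj₂ (least (reaches? v) e′))))
        by-cases (yes (w , r)) (no ¬e) = contradiction (w , to r) ¬e
        by-cases (no ¬e) (yes (w , r)) = contradiction (w , from r) ¬e
        by-cases (no _)  (no _) = refl

      root-injective : ∀ {u v} → Frontier i u → Frontier i v → root u ≡ root v → Star (Past.Edge x c) u v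
      root-injective {u} {v} φ ψ = by-cases (any? (reaches? u)) (any? (reaches? v))
        where
        by-cases : (p : Dec (∃ (Reaches u))) (q : Dec (∃ (Reaches v))) → rootOf p ≡ rootOf q → Star (Past.Edge x c) u v
        by-cases (yes e) (yes e′) eq = proj₁ (proj₂ (least (reaches? u) e)) ◅◅
          subst (λ w → Star (Past.Edge x c) w v) (cong enum (sym (Fin.inject≤-injective Φ≤W Φ≤W _ _ eq)))
            (Star.reverse (Past.edge-symm x c) (proj₁ (proj₂ (least (reaches? v) e′))))
        by-cases (no ¬e) _ _ = contradiction (index φ , subst (Star (Past.Edge x c) u) (sym (enum-index φ)) ε) ¬e
        by-cases _ (no ¬e) _ = contradiction (index ψ , subst (Star (Past.Edge x c) v) (sym (enum-index ψ)) ε) ¬e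

    open Roots using (root; root-cong; root-injective)

    stateCount : ℕ
    stateCount = (W ^ W) ^ a * (2 ^ a * 2 ^ a) * (2 ^ a + a * b) ^ W * suc b

    started? : ∀ x c → Dec (∃ (Touched (Past.Edge x c)))
    started? x c = any? λ u → any? λ v → Past.edge? x c u v

    center? : ∀ x c → Dec (1 ≤ closedCount x (μ c))
    center? x c = 1 ℕ.≤? closedCount x (μ c)

    zeroPartial : Partial zeros
    zeroPartial = inj₁ λ c → ℕ.≤-trans (ℕ.≤-reflexive (Vec.lookup-replicate c 0)) z≤n

    rootsCode : Word → Fin ((W ^ W) ^ a)
    rootsCode x = Fin.funToFin λ c → spread (Fin.fromℕ< 1≤W) (root x c)

    bitsCode : Word → Fin (2 ^ a * 2 ^ a)
    bitsCode x = Fin.combine (Fin.funToFin λ c → bit (started? x c)) (Fin.funToFin λ c → bit (center? x c))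

    degreesCode : ∀ x → Live (toℕ i) x → Fin ((2 ^ a + a * b) ^ W)
    degreesCode x l = spread (partialCode zeroPartial) (λ u → partialCode (partial-live l u))

    unitsCode : Word → Fin (suc b)
    unitsCode x = Fin.fromℕ< (m%n<n (closedCount x 𝟏) (suc b))

    state : ∀ x → Live (toℕ i) x → Fin stateCount
    state x l = Fin.combine (Fin.combine (Fin.combine (rootsCode x) (bitsCode x)) (degreesCode x l)) (unitsCode x)

    codes-≼ : ∀ {x y} (l : Live (toℕ i) x) (l′ : Live (toℕ i) y) → rootsCode x ≡ rootsCode y → bitsCode x ≡ bitsCode y →
              degreesCode x l ≡ degreesCode y l′ → unitsCode x ≡ unitsCode y → x ≼ y
    codes-≼ {x} {y} l l′ roots bits degs units = record
      { degrees = λ {u} φ → partialCode-injective (partial-live l u) (partial-live l′ u)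
          (spread-injective (λ u → partialCode (partial-live l u)) (λ u → partialCode (partial-live l′ u)) degs φ)
      ; joined  = λ c φ ψ s → root-injective y c φ ψ (trans (sym (same-root c φ)) (trans (root-cong x c s) (same-root c ψ)))
      ; started = λ c t → bit-true (started? x c) (started? y c)
          (funToFin-injective {f = λ c → bit (started? x c)} {λ c → bit (started? y c)} (proj₁ two-bits) c) (_ , t)
      ; units   = Fin.fromℕ<-injective _ _ (m%n<n (closedCount x 𝟏) (suc b)) (m%n<n (closedCount y 𝟏) (suc b)) units
      ; centers = λ c → bit-true (center? x c) (center? y c)
          (funToFin-injective {f = λ c → bit (center? x c)} {λ c → bit (center? y c)} (proj₂ two-bits) c) }
      where
      two-bits : _ × _
      two-bits = Fin.combine-injective (Fin.funToFin λ c → bit (started? x c)) (Fin.funToFin λ c → bit (center? x c))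
                                       (Fin.funToFin λ c → bit (started? y c)) (Fin.funToFin λ c → bit (center? y c)) bits
      same-root : ∀ c {u} → Frontier i u → root x c u ≡ root y c u
      same-root c = spread-injective (root x c) (root y c)
        (funToFin-injective {f = λ c → spread (Fin.fromℕ< 1≤W) (root x c)} {λ c → spread (Fin.fromℕ< 1≤W) (root y c)} roots c)

    state-∼ : ∀ x y l l′ → state x l ≡ state y l′ → x ∼[ toℕ i ] y
    state-∼ x y l l′ e =
      let e₁ , units = Fin.combine-injective (Fin.combine (Fin.combine (rootsCode x) (bitsCode x)) (degreesCode x l)) (unitsCode x)
                                             (Fin.combine (Fin.combine (rootsCode y) (bitsCode y)) (degreesCode y l′)) (unitsCode y) e
          e₂ , degs  = Fin.combine-injective (Fin.combine (rootsCode x) (bitsCode x)) (degreesCode x l)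
                                             (Fin.combine (rootsCode y) (bitsCode y)) (degreesCode y l′) e₁
          roots , bits = Fin.combine-injective (rootsCode x) (bitsCode x) (rootsCode y) (bitsCode y) e₂
      in ≼-∼ (codes-≼ l l′ roots bits degs units) (codes-≼ l′ l (sym roots) (sym bits) (sym degs) (sym units)) l l′

-- Frontiers with at most one vertex

distinct⇒2≤ : ∀ {n} {i j : Fin n} → i ≢ j → 2 ≤ n
distinct⇒2≤ {suc zero} {zero} {zero} ne = contradiction refl ne
distinct⇒2≤ {suc (suc n)} ne = s≤s (s≤s z≤n)

-- Take the vertex at which the first edge of `B` leaves, or the end of the path if there is none.
crossing : ∀ {n} {A B : Rel (Fin n) 0ℓ} → Symmetric A → ∀ {u v} → Touched A u → Touched B v → Star (A ∪ B) u v →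
           ∃ λ w → Touched A w × Touched B w
crossing symA s t ε = _ , s , t
crossing symA s t (inj₁ h ◅ p) = crossing symA (_ , symA h) t p
crossing symA s t (inj₂ h ◅ p) = _ , s , (_ , h)

module NarrowCode {a b : ℕ} (1≤a : 1 ≤ a) (a≤b : a ≤ b) {G : Graph} {m : ℕ} (O : EdgeOrdering G m) (i : Fin m)
  (Φ≤1 : count (EdgeOrdering.frontier? O i) ≤ 1) where
  open EdgeOrdering O
  private
    1≤b : 1 ≤ b
    1≤b = ℕ.≤-trans 1≤a a≤b

  open Host {a} {b} 1≤a 1≤b O
  open At i
  open Degrees {a} {b} 1≤a 1≤b
  open Code {a} {b} 1≤a 1≤b O i using (prefix≤)
  open Words a m

  frontier-unique : ∀ {u v} → Frontier i u → Frontier i v → v ≡ u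
  frontier-unique = count-≤1-unique (frontier? i) Φ≤1

  Started : Word → Set
  Started x = ∃ λ k → Earlier k × x k ≢ zero

  started? : Decidable Started
  started? x = any? λ k → toℕ k ℕ.<? toℕ i ×-dec ¬? (x k ≟ zero)

  Proceeds : Word → Set
  Proceeds r = ∃ λ k → Later k × r k ≢ zero

  proceeds? : Decidable Proceeds
  proceeds? r = any? λ k → toℕ i ℕ.≤? toℕ k ×-dec ¬? (r k ≟ zero)

  Extensible : Word → Set
  Extensible x = ∃ λ r → Accepted (splice (toℕ i) x r) × Proceeds r

  extensible? : Decidable Extensible
  extensible? x = map′ (λ (r , h) → Fin.finToFun r , h)
    (λ (r , good , k , le , ne) → Fin.funToFin r
       , accepted-resp (splice-cong (toℕ i) (λ _ → refl) (λ k → sym (Fin.finToFun-funToFin r k))) good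
       , k , le , λ e → ne (trans (sym (Fin.finToFun-funToFin r k)) e))
    (any? {n = suc a ^ m} λ r → accepted? (splice (toℕ i) x (Fin.finToFun r)) ×-dec proceeds? (Fin.finToFun r))

  letter : ∀ {k} {f : Word} → f k ≢ zero → ∃ λ c → f k ≡ suc c
  letter {k} {f} ne with f k
  ... | zero  = contradiction refl ne
  ... | suc c = c , refl

  -- The situation of a nonempty prefix with a nonempty completion: a color c continues
  -- through the only frontier vertex, and all other colors lie on the side of the units.
  record Shape (x : Word) : Set where
    field
      c         : Fin a
      v         : Fin n
      frontier  : Frontier i v
      s         : ℕ
      s≤b       : suc s ≤ b
      degree    : prefixDegree x v ≡ mono (suc s) c
      starts    : ∃ (Touched (Past.Edge x c))
      started⇒  : ∀ {j} → j ≢ c → ∃ (Touched (Past.Edge x j)) → 1 ≤ closedCount x 𝟏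
      started⇐  : ∀ {j} → j ≢ c → 1 ≤ closedCount x 𝟏 → ∃ (Touched (Past.Edge x j))
      center⇒   : ∀ {j} → j ≢ c → 1 ≤ closedCount x (μ j) → 1 ≤ closedCount x 𝟏
      center⇐   : ∀ {j} → j ≢ c → 1 ≤ closedCount x 𝟏 → 1 ≤ closedCount x (μ j)
      center⇒s  : 1 ≤ closedCount x (μ c) → s ≡ 0
      units≤b   : ∀ {j} → j ≢ c → closedCount x 𝟏 ≤ b

  module Through (x r : Word) (good : Accepted (splice (toℕ i) x r)) where
    private
      f = splice (toℕ i) x r
      F = whole f
      module F = Coloring F

      -- This is one of the places where `a ≤ b` enters: a second color forces `b` to be at least 2,
      -- and then the degrees of centers and units differ.
      b≢1 : ∀ {j k : Fin a} → j ≢ k → b ≢ 1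
      b≢1 ne refl = ℕ.<⇒≱ (distinct⇒2≤ ne) a≤b

      μ≢𝟏 : ∀ {j k : Fin a} → j ≢ k → ∀ l → μ l ≢ 𝟏
      μ≢𝟏 ne l e = b≢1 ne (ones≡mono⇒b≡1 e)

      degree-edge : ∀ {c u} → Vec.lookup (colorDegree F u) c ≢ 0 → ∃ (F.Color c u)
      degree-edge {c} {u} ne = count-∃ (F.color? c u) (ℕ.n≢0⇒n>0 λ e → ne (trans (lookup-degree F u c) e))

      edge-degree : ∀ {c u w} → F.Color c u w → Vec.lookup (colorDegree F u) c ≢ 0
      edge-degree {c} {u} h e = F.pos-degree h (trans (sym (lookup-degree F u c)) e)

      unit-edge : ∀ {u} → colorDegree F u ≡ 𝟏 → ∀ c → ∃ (F.Color c u)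
      unit-edge e c = degree-edge λ z → ℕ.1+n≢0 (trans (sym (lookup-ones c)) (trans (cong (λ d → Vec.lookup d c) (sym e)) z))

      past-edge : ∀ {c u} → Vec.lookup (prefixDegree x u) c ≢ 0 → ∃ (Past.Edge x c u)
      past-edge {c} {u} ne = count-∃ (Past.edge? x c u) (ℕ.n≢0⇒n>0 λ e → ne (trans (lookup-degree (pastGraph x) u c) e))

      has-unit : ∃ λ u → colorDegree F u ≡ 𝟏
      has-unit = count-∃ (λ u → colorDegree F u ≟ᵈ 𝟏) (ℕ.≤-trans (ℕ.≤-trans 1≤b b≤mult-ones) (Good.enough good ones≢zeros))

      two-sided : ∀ {c c′ u} → Touched (Past.Edge x c) u → Touched (Future.Edge r c′) u → Frontier i u
      two-sided (_ , h) (_ , k) = Past.edge-incident x h , Future.edge-incident r k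

      shared : ∀ {c} → ∃ (Touched (Past.Edge x c)) → ∃ (Touched (Future.Edge r c)) →
               ∃ λ u → Touched (Past.Edge x c) u × Touched (Future.Edge r c) u
      shared {c} (u , w , h) (u′ , w′ , h′) = crossing (Past.edge-symm x c) (w , h) (w′ , h′)
        (Star.map (splice⁻ x r) (Good.connected good c (splice⁺ x r (inj₁ h)) (splice⁺ x r (inj₂ h′))))

    -- Otherwise `c` occurs only in the past and `c′` only in the future. Every unit has an edge of
    -- each and thus lies in the frontier; but there are at least `b` units, and two colors give
    -- `b ≥ a ≥ 2`.
    shared-color : ∀ {c c′} → ∃ (Touched (Past.Edge x c)) → ∃ (Touched (Future.Edge r c′)) →
                   ∃ λ c → ∃ (Touched (Past.Edge x c)) × ∃ (Touched (Future.Edge r c))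
    shared-color {c} {c′} p q = by-cases (any? λ j → past? j ×-dec future? j)
      where
      past? : ∀ j → Dec (∃ (Touched (Past.Edge x j)))
      past? j = any? λ u → any? λ w → Past.edge? x j u w
      future? : ∀ j → Dec (∃ (Touched (Future.Edge r j)))
      future? j = any? λ u → any? λ w → Future.edge? r j u w
      by-cases : Dec (∃ λ j → ∃ (Touched (Past.Edge x j)) × ∃ (Touched (Future.Edge r j))) →
                 ∃ λ j → ∃ (Touched (Past.Edge x j)) × ∃ (Touched (Future.Edge r j))
      by-cases (yes found) = found
      by-cases (no ¬found) = contradiction 2≤1 λ { (s≤s ()) }
        where
        c≢c′ : c ≢ c′
        c≢c′ refl = ¬found (c , p , q)
        past-side : ∀ {u} → ∃ (F.Color c u) → Touched (Past.Edge x c) u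
        past-side (w , h) = [ (w ,_) , (λ k → contradiction (c , p , _ , w , k) ¬found) ]′ (splice⁻ x r h)
        future-side : ∀ {u} → ∃ (F.Color c′ u) → Touched (Future.Edge r c′) u
        future-side (w , h) = [ (λ k → contradiction (c′ , (_ , w , k) , q) ¬found) , (w ,_) ]′ (splice⁻ x r h)
        2≤1 : 2 ≤ 1
        2≤1 = ℕ.≤-trans (ℕ.≤-trans (distinct⇒2≤ c≢c′) a≤b) (ℕ.≤-trans (ℕ.≤-trans b≤mult-ones (Good.enough good ones≢zeros))
          (ℕ.≤-trans (count-⊆ (λ u → colorDegree F u ≟ᵈ 𝟏) (frontier? i)
            λ e → two-sided (past-side (unit-edge e c)) (future-side (unit-edge e c′))) Φ≤1))

    module _ {c} (p : ∃ (Touched (Past.Edge x c))) (q : ∃ (Touched (Future.Edge r c))) where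
      private
        v = proj₁ (shared p q)
        pv : Touched (Past.Edge x c) v
        pv = proj₁ (proj₂ (shared p q))
        qv : Touched (Future.Edge r c) v
        qv = proj₂ (proj₂ (shared p q))
        φ : Frontier i v
        φ = two-sided pv qv

        past-degree : ℕ
        past-degree = Vec.lookup (prefixDegree x v) c

        1≤past : 1 ≤ past-degree
        1≤past = subst (1 ≤_) (sym (lookup-degree (pastGraph x) v c)) (count-pos (Past.edge? x c v) (proj₂ pv))

        past<final : suc past-degree ≤ Vec.lookup (colorDegree F v) c
        past<final = subst₂ _≤_ (trans (ℕ.+-comm _ 1) (cong suc (sym (lookup-degree (pastGraph x) v c))))
          (trans (sym (splice-degree x r c v)) (sym (lookup-degree F v c)))
          (ℕ.+-monoʳ-≤ (Coloring.degree (pastGraph x) c v) (count-pos (Future.edge? r c v) (proj₂ qv)))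

        -- An edge of color `c` on either side gives `v` degree at least 2 in `c`, which excludes
        -- `zeros`, units and degrees concentrated on another color.
        final-v : ∃ λ t → (t ≡ b ⊎ t ≡ 2) × colorDegree F v ≡ mono t c
        final-v = by-kind (final good v)
          where
          too-small : ∀ {k} → Vec.lookup (colorDegree F v) c ≡ k → k ≤ 1 → ⊥
          too-small e le = ℕ.<⇒≱ (ℕ.≤-trans (s≤s 1≤past) past<final) (ℕ.≤-trans (ℕ.≤-reflexive e) le)
          by-kind : Final (colorDegree F v) → ∃ λ t → (t ≡ b ⊎ t ≡ 2) × colorDegree F v ≡ mono t c
          by-kind (final-zero e) = ⊥-elim (too-small (trans (cong (λ d → Vec.lookup d c) e) (Vec.lookup-replicate c 0)) z≤n)
          by-kind (final-unit e) = ⊥-elim (too-small (trans (cong (λ d → Vec.lookup d c) e) (lookup-ones c)) ℕ.≤-refl)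
          by-kind (final-mono t k t∈ e) with c ≟ k
          ... | yes refl = t , t∈ , e
          ... | no ne = ⊥-elim (too-small (trans (cong (λ d → Vec.lookup d c) e) (lookup-mono-else t ne)) z≤n)

        t = proj₁ final-v
        t∈ = proj₁ (proj₂ final-v)
        deg-v : colorDegree F v ≡ mono t c
        deg-v = proj₂ (proj₂ final-v)

        past<t : suc past-degree ≤ t
        past<t = subst (suc past-degree ≤_) (trans (cong (λ d → Vec.lookup d c) deg-v) (lookup-mono t c)) past<final

        other-zero : ∀ {j} → j ≢ c → Vec.lookup (colorDegree F v) j ≡ 0
        other-zero ne = trans (cong (λ d → Vec.lookup d _) deg-v) (lookup-mono-else t ne)

        not-v : ∀ {j u} → j ≢ c → ∃ (F.Color j u) → u ≢ v
        not-v ne (w , h) refl = edge-degree h (other-zero ne)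

        -- Away from v a vertex with an edge in the past has all its edges there.
        closed : ∀ {u w j} → u ≢ v → Past.Edge x j u w → ¬ Open u
        closed ne h o = ne (frontier-unique φ (Past.edge-incident x h , o))

        -- A color present on both sides has to pass through the only frontier vertex `v`, where `c`
        -- is the only color.
        one-sided : ∀ {j} → j ≢ c → ∃ (Touched (Past.Edge x j)) → ¬ ∃ (Touched (Future.Edge r j))
        one-sided ne P Q = let u , pu , qu = shared P Q in
          not-v ne (_ , splice⁺ x r (inj₁ (proj₂ pu))) (frontier-unique φ (two-sided pu qu))

        -- All of color `j` lies in the past and avoids `v`, so every vertex with an edge of color
        -- `j` is finished. In particular the units and the center of `j`, which an accepted
        -- coloring must have, are finished together.
        closed-vertex : ∀ {j d} → j ≢ c → ∃ (Touched (Past.Edge x j)) → (∃ λ u → colorDegree F u ≡ d) → Vec.lookup d j ≢ 0 →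
                        1 ≤ closedCount x d
        closed-vertex {j} {d} ne P (u , e) d≢0 = count-pos (λ u → ¬? (open? u) ×-dec prefixDegree x u ≟ᵈ d)
          (¬o , trans (sym (closed-degree x r ¬o)) e)
          where
          edge : ∃ (F.Color j u)
          edge = degree-edge λ z → d≢0 (trans (cong (λ d → Vec.lookup d j) (sym e)) z)
          ¬o : ¬ Open u
          ¬o = [ closed (not-v ne edge) , (λ k → contradiction (u , _ , k) (one-sided ne P)) ]′ (splice⁻ x r (proj₂ edge))

        closed-started : ∀ {j d} → 1 ≤ closedCount x d → Vec.lookup d j ≢ 0 → ∃ (Touched (Past.Edge x j))
        closed-started {j} {d} h d≢0 = let u , _ , e = count-∃ (λ u → ¬? (open? u) ×-dec prefixDegree x u ≟ᵈ d) h in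
          u , past-edge λ z → d≢0 (trans (cong (λ d → Vec.lookup d j) (sym e)) z)

        𝟏≢0 : ∀ j → Vec.lookup 𝟏 j ≢ 0
        𝟏≢0 j e = ℕ.1+n≢0 (trans (sym (lookup-ones j)) e)

        μ≢0 : ∀ j → Vec.lookup (μ j) j ≢ 0
        μ≢0 j e = b≢0 (trans (sym (lookup-mono b j)) e)

        has-center : ∀ j → ∃ λ u → colorDegree F u ≡ μ j
        has-center j = count-∃ (λ u → colorDegree F u ≟ᵈ μ j) (ℕ.≤-trans (1≤mult-mono j) (Good.enough good (mono≢zeros j)))

        -- Two past edges at `v` and one future edge give `t ≥ 3`, hence `t = b`. Then `v` would be
        -- a second vertex of degree `μ c` beside the finished one, but for `b ≥ 3` this degree is
        -- outside Δ and has multiplicity 1.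
        center-past : 1 ≤ closedCount x (μ c) → past-degree ≤ 1
        center-past h = ℕ.≮⇒≥ λ 2≤past → absurd (ℕ.≤-trans (s≤s 2≤past) past<t) t∈
          where
          absurd : 3 ≤ t → t ≡ b ⊎ t ≡ 2 → ⊥
          absurd 3≤t (inj₂ e) = ℕ.<⇒≱ 3≤t (ℕ.≤-reflexive e)
          absurd 3≤t (inj₁ e) = ℕ.<⇒≱ (count-two (λ u → colorDegree F u ≟ᵈ μ c) u≢v (trans (closed-degree x r (proj₁ (proj₂ finished))) (proj₂ (proj₂ finished)))
                                        (trans deg-v (cong (λ t → mono t c) e)))
                                  (ℕ.≤-trans (Good.exact good (mono≢zeros c) ∉Δ) (ℕ.≤-reflexive (mult-mono c μc≢𝟏)))
            where
            finished = count-∃ (λ u → ¬? (open? u) ×-dec prefixDegree x u ≟ᵈ μ c) h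
            u≢v : proj₁ finished ≢ v
            u≢v eq = proj₁ (proj₂ finished) (subst Open (sym eq) (proj₂ φ))
            3≤b : 3 ≤ b
            3≤b = subst (3 ≤_) e 3≤t
            μc≢𝟏 : μ c ≢ 𝟏
            μc≢𝟏 e = ℕ.<⇒≱ 3≤b (ℕ.≤-trans (ℕ.≤-reflexive (ones≡mono⇒b≡1 e)) (s≤s z≤n))
            ∉Δ : ¬ μ c ∈Δ
            ∉Δ (k , two , _) with k ≟ c
            ... | yes refl = ℕ.<⇒≱ 3≤b (ℕ.≤-reflexive (trans (sym (lookup-mono b c)) two))
            ... | no ne = ℕ.0≢1+n (trans (sym (lookup-mono-else b ne)) two)

      shape : Shape x
      shape = by-value past-degree refl
        where
        t≤ : t ≡ b ⊎ t ≡ 2 → t ≤ suc b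
        t≤ (inj₁ e) = ℕ.≤-trans (ℕ.≤-reflexive e) (ℕ.n≤1+n b)
        t≤ (inj₂ e) = ℕ.≤-trans (ℕ.≤-reflexive e) (s≤s 1≤b)
        by-value : ∀ k → past-degree ≡ k → Shape x
        by-value zero e = contradiction 1≤past (ℕ.<⇒≱ (s≤s (ℕ.≤-reflexive e)))
        by-value (suc s) e = record
          { c = c ; v = v ; frontier = φ ; s = s
          ; s≤b      = ℕ.≤-pred (ℕ.≤-trans (subst (λ k → suc k ≤ t) e past<t) (t≤ t∈))
          ; degree   = is-mono c e λ j ne → ℕ.n≤0⇒n≡0 (ℕ.≤-trans (prefix≤ x r v j) (ℕ.≤-reflexive (other-zero ne)))
          ; starts   = p
          ; started⇒ = λ {j} ne P → closed-vertex ne P has-unit (𝟏≢0 j)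
          ; started⇐ = λ {j} ne h → closed-started h (𝟏≢0 j)
          ; center⇒  = λ {j} ne h → closed-vertex ne (closed-started h (μ≢0 j)) has-unit (𝟏≢0 j)
          ; center⇐  = λ {j} ne h → closed-vertex ne (closed-started h (𝟏≢0 j)) (has-center j) (μ≢0 j)
          ; center⇒s = λ h → ℕ.n≤0⇒n≡0 (ℕ.≤-pred (subst (_≤ 1) e (center-past h)))
          ; units≤b  = λ ne → ℕ.≤-trans (closed≤ x r good ones≢zeros ones∉Δ) (ℕ.≤-reflexive (mult-ones (μ≢𝟏 ne))) }

  extensible-shape : ∀ {x} → Started x → Extensible x → Shape x
  extensible-shape {x} (k , lt , ne) (r , good , k′ , le , ne′) = from-letters (letter {k} {x} ne) (letter {k′} {r} ne′)
    where
    open Through x r good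
    from-letters : (∃ λ c → x k ≡ suc c) → (∃ λ c → r k′ ≡ suc c) → Shape x
    from-letters (c , e) (c′ , e′) = let j , p , q = shared-color (_ , _ , Past.letter-edge x lt e) (_ , _ , Future.letter-edge r le e′)
                                     in shape p q

module NarrowState {a b : ℕ} (1≤a : 1 ≤ a) (a≤b : a ≤ b) {G : Graph} {m : ℕ} (O : EdgeOrdering G m) (i : Fin m)
  (Φ≤1 : count (EdgeOrdering.frontier? O i) ≤ 1) where
  open EdgeOrdering O
  private
    1≤b : 1 ≤ b
    1≤b = ℕ.≤-trans 1≤a a≤b

  open Host {a} {b} 1≤a 1≤b O
  open At i
  open NarrowCode {a} {b} 1≤a a≤b O i Φ≤1
  open Words a m

  -- Blank prefixes are all equivalent. Live stuck prefixes are too: each accepts the empty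
  -- completion and no other. So each of these two kinds costs one state, and only `through` needs
  -- further data.
  data Class (x : Word) : Set where
    blank   : ¬ Started x → Class x
    stuck   : Started x → ¬ Extensible x → Class x
    through : Shape x → Class x

  classify : ∀ x → Class x
  classify x = by-cases (started? x) (extensible? x)
    where
    by-cases : Dec (Started x) → Dec (Extensible x) → Class x
    by-cases (no ¬s) _       = blank ¬s
    by-cases (yes s) (no ¬e) = stuck s ¬e
    by-cases (yes s) (yes e) = through (extensible-shape s e)

  blank-∼ : ∀ {x y} → ¬ Started x → ¬ Started y → x ∼[ toℕ i ] y
  blank-∼ {x} {y} ¬s ¬s′ = equivalent λ r → mk⇔ (accepted-resp (agree ¬s ¬s′ r)) (accepted-resp (agree ¬s′ ¬s r))
    where
    empty : ∀ {x} → ¬ Started x → ∀ {k} → toℕ k < toℕ i → x k ≡ zero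
    empty {x} ¬s {k} lt = decidable-stable (x k ≟ zero) λ ne → ¬s (k , lt , ne)
    agree : ∀ {x y} → ¬ Started x → ¬ Started y → ∀ r k → splice (toℕ i) x r k ≡ splice (toℕ i) y r k
    agree ¬s ¬s′ r k with toℕ k ℕ.<? toℕ i
    ... | yes lt = trans (splice-< lt) (trans (trans (empty ¬s lt) (sym (empty ¬s′ lt))) (sym (splice-< lt)))
    ... | no ¬lt = trans (splice-≥ (ℕ.≮⇒≥ ¬lt)) (sym (splice-≥ (ℕ.≮⇒≥ ¬lt)))

  stuck-∼ : ∀ {x y} → ¬ Extensible x → ¬ Extensible y → Live (toℕ i) x → Live (toℕ i) y → x ∼[ toℕ i ] y
  stuck-∼ {x} {y} ¬e ¬e′ l l′ = equivalent λ r → mk⇔ (move ¬e ¬e′ l′) (move ¬e′ ¬e l)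
    where
    empty : ∀ {x r} → ¬ Extensible x → Accepted (splice (toℕ i) x r) → ∀ {k} → toℕ i ≤ toℕ k → r k ≡ zero
    empty {x} {r} ¬e good {k} le = decidable-stable (r k ≟ zero) λ ne → ¬e (r , good , k , le , ne)
    move : ∀ {x y r} → ¬ Extensible x → ¬ Extensible y → Live (toℕ i) y → Accepted (splice (toℕ i) x r) → Accepted (splice (toℕ i) y r)
    move {x} {y} {r} ¬e ¬e′ (r′ , good′) good = accepted-resp agree good′
      where
      agree : ∀ k → splice (toℕ i) y r′ k ≡ splice (toℕ i) y r k
      agree k with toℕ k ℕ.<? toℕ i
      ... | yes lt = trans (splice-< lt) (sym (splice-< lt))
      ... | no ¬lt = let le = ℕ.≮⇒≥ ¬lt in
        trans (splice-≥ le) (trans (trans (empty ¬e′ good′ le) (sym (empty ¬e good le))) (sym (splice-≥ le)))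

  -- For a color other than `c`, both bits say whether there is a finished unit. The number of
  -- finished units is at most `b` when such a color exists, so its residue settles this. For `c`
  -- itself the data is passed explicitly, and `joined` is trivial for one frontier vertex.
  shape-≼ : ∀ {x y} (S : Shape x) (T : Shape y) → Shape.c S ≡ Shape.c T → Shape.s S ≡ Shape.s T →
            (1 ≤ closedCount x (μ (Shape.c S)) → 1 ≤ closedCount y (μ (Shape.c S))) → closedCount x 𝟏 % suc b ≡ closedCount y 𝟏 % suc b → x ≼ y
  shape-≼ {x} {y} S T same-c same-s same-center units = record
    { degrees = λ {u} φ → trans (cong (prefixDegree x) (frontier-unique S.frontier φ)) (trans S.degree
        (trans (cong₂ (λ s → mono (suc s)) same-s same-c) (trans (sym T.degree) (cong (prefixDegree y) (sym (frontier-unique T.frontier φ))))))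
    ; joined  = λ c φ ψ _ → subst (Star (Past.Edge y c) _) (sym (frontier-unique φ ψ)) ε
    ; started = λ j {u} t → started j u t (j ≟ S.c)
    ; units   = units
    ; centers = λ j h → centers j h (j ≟ S.c) }
    where
    module S = Shape S
    module T = Shape T
    to-T : ∀ {j} → j ≢ S.c → j ≢ T.c
    to-T ne e = ne (trans e (sym same-c))
    transfer : ∀ {j} → j ≢ S.c → 1 ≤ closedCount x 𝟏 → 1 ≤ closedCount y 𝟏
    transfer ne = subst (1 ≤_) (trans (sym (m<n⇒m%n≡m (s≤s (S.units≤b ne)))) (trans units (m<n⇒m%n≡m (s≤s (T.units≤b (to-T ne))))))
    started : ∀ j u → Touched (Past.Edge x j) u → Dec (j ≡ S.c) → ∃ (Touched (Past.Edge y j))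
    started j u t (yes e) = subst (λ c → ∃ (Touched (Past.Edge y c))) (sym (trans e same-c)) T.starts
    started j u t (no ne) = T.started⇐ (to-T ne) (transfer ne (S.started⇒ ne (u , t)))
    centers : ∀ j → 1 ≤ closedCount x (μ j) → Dec (j ≡ S.c) → 1 ≤ closedCount y (μ j)
    centers j h (yes refl) = same-center h
    centers j h (no ne) = T.center⇐ (to-T ne) (transfer ne (S.center⇒ ne h))

  center? : ∀ {x} (S : Shape x) → Dec (1 ≤ closedCount x (μ (Shape.c S)))
  center? {x} S = 1 ℕ.≤? closedCount x (μ (Shape.c S))

  -- The color is stored as a 0/1-vector with a single 1. This leaves the zero vector free for blank
  -- and stuck prefixes within the summand `2 ^ a`.
  indicator : Fin a → Fin (2 ^ a)
  indicator c = Fin.funToFin (λ j → bit (j ≟ c))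

  nothing : Fin (2 ^ a)
  nothing = Fin.funToFin {a} {2} (λ _ → zero)

  bit-yes : ∀ {P : Set} (p? : Dec P) → P → bit p? ≡ suc zero
  bit-yes (yes _) _ = refl
  bit-yes (no ¬p) p = contradiction p ¬p

  indicator≢nothing : ∀ c → nothing ≢ indicator c
  indicator≢nothing c e with () ← trans (funToFin-injective {f = λ _ → zero} {λ j → bit (j ≟ c)} e c) (bit-yes (c ≟ c) refl)

  indicator-injective : ∀ {c c′} → indicator c ≡ indicator c′ → c ≡ c′
  indicator-injective {c} {c′} e = bit-true (c ≟ c) (c ≟ c′) (funToFin-injective {f = λ j → bit (j ≟ c)} {λ j → bit (j ≟ c′)} e c) refl

  -- If the center of the color c is finished, then the frontier vertex has degree 1 so far.
  shapeCode : ∀ {x} (S : Shape x) → Dec (1 ≤ closedCount x (μ (Shape.c S))) → Fin (2 ^ a + a * b)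
  shapeCode S (yes _) = indicator (Shape.c S) ↑ˡ (a * b)
  shapeCode S (no _)  = 2 ^ a ↑ʳ Fin.combine (Shape.c S) (Fin.fromℕ< (Shape.s≤b S))

  code₁ : ∀ {x} → Class x → Fin (2 ^ a + a * b)
  code₁ (blank _)   = nothing ↑ˡ (a * b)
  code₁ (stuck _ _) = nothing ↑ˡ (a * b)
  code₁ (through S) = shapeCode S (center? S)

  code₂ : ∀ {x} → Class x → Fin (suc b)
  -- Blank and stuck prefixes share `code₁`; the two extreme values of the second code separate them
  -- because `b` is positive.
  code₂ (blank _)   = zero
  code₂ (stuck _ _) = Fin.fromℕ b
  code₂ {x} (through S) = Fin.fromℕ< (m%n<n (closedCount x 𝟏) (suc b))

  shapeCode-≼ : ∀ {x y} (S : Shape x) (T : Shape y) (z : Dec (1 ≤ closedCount x (μ (Shape.c S)))) (z′ : Dec (1 ≤ closedCount y (μ (Shape.c T)))) →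
                shapeCode S z ≡ shapeCode T z′ → closedCount x 𝟏 % suc b ≡ closedCount y 𝟏 % suc b → x ≼ y
  shapeCode-≼ {x} {y} S T (yes p) (yes q) e = shape-≼ S T c≡ (trans (Shape.center⇒s S p) (sym (Shape.center⇒s T q)))
    λ _ → subst (λ c → 1 ≤ closedCount y (μ c)) (sym c≡) q
    where c≡ = indicator-injective (Fin.↑ˡ-injective (a * b) _ _ e)
  shapeCode-≼ S T (yes _) (no _) e = contradiction e (↑ˡ≢↑ʳ _ _)
  shapeCode-≼ S T (no _) (yes _) e = contradiction (sym e) (↑ˡ≢↑ʳ _ _)
  shapeCode-≼ S T (no ¬p) (no _) e = shape-≼ S T (proj₁ both)
    (Fin.fromℕ<-injective _ _ (Shape.s≤b S) (Shape.s≤b T) (proj₂ both)) λ p → contradiction p ¬p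
    where both = Fin.combine-injective (Shape.c S) (Fin.fromℕ< (Shape.s≤b S)) (Shape.c T) (Fin.fromℕ< (Shape.s≤b T)) (Fin.↑ʳ-injective (2 ^ a) _ _ e)

  nothing≢shapeCode : ∀ {x} (S : Shape x) z → nothing ↑ˡ (a * b) ≢ shapeCode S z
  nothing≢shapeCode S (yes _) e = indicator≢nothing (Shape.c S) (Fin.↑ˡ-injective (a * b) _ _ e)
  nothing≢shapeCode S (no _)  = ↑ˡ≢↑ʳ _ _

  zero≢fromℕ : Fin.zero ≢ Fin.fromℕ b
  zero≢fromℕ e = ℕ.<⇒≢ 1≤b (trans (cong toℕ e) (Fin.toℕ-fromℕ b))

  codes-∼ : ∀ {x y} (p : Class x) (q : Class y) → Live (toℕ i) x → Live (toℕ i) y → code₁ p ≡ code₁ q → code₂ p ≡ code₂ q → x ∼[ toℕ i ] y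
  codes-∼ (blank s)    (blank s′)   _ _ _ _ = blank-∼ s s′
  codes-∼ (stuck _ e)  (stuck _ e′) l l′ _ _ = stuck-∼ e e′ l l′
  codes-∼ (blank _)    (stuck _ _)  _ _ _ e = contradiction e zero≢fromℕ
  codes-∼ (stuck _ _)  (blank _)    _ _ _ e = contradiction (sym e) zero≢fromℕ
  codes-∼ (blank _)    (through S)  _ _ e _ = contradiction e (nothing≢shapeCode S (center? S))
  codes-∼ (stuck _ _)  (through S)  _ _ e _ = contradiction e (nothing≢shapeCode S (center? S))
  codes-∼ (through S)  (blank _)    _ _ e _ = contradiction (sym e) (nothing≢shapeCode S (center? S))
  codes-∼ (through S)  (stuck _ _)  _ _ e _ = contradiction (sym e) (nothing≢shapeCode S (center? S))
  codes-∼ {x} {y} (through S) (through T) l l′ e e′ =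
    ≼-∼ (shapeCode-≼ S T (center? S) (center? T) e units) (shapeCode-≼ T S (center? T) (center? S) (sym e) (sym units)) l l′
    where
    units : closedCount x 𝟏 % suc b ≡ closedCount y 𝟏 % suc b
    units = Fin.fromℕ<-injective _ _ (m%n<n (closedCount x 𝟏) (suc b)) (m%n<n (closedCount y 𝟏) (suc b)) e′

  state : ∀ x → Live (toℕ i) x → Fin ((2 ^ a + a * b) * suc b)
  state x _ = Fin.combine (code₁ (classify x)) (code₂ (classify x))

  state-∼ : ∀ x y l l′ → state x l ≡ state y l′ → x ∼[ toℕ i ] y
  state-∼ x y l l′ e = let e₁ , e₂ = Fin.combine-injective (code₁ (classify x)) (code₂ (classify x)) (code₁ (classify y)) (code₂ (classify y)) e
                       in codes-∼ (classify x) (classify y) l l′ e₁ e₂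

  -- With an empty frontier no prefix has a `Shape`, and the bound `b + 1` is at least 2, which
  -- suffices for the two remaining classes.
  module Empty (Φ≤0 : count (frontier? i) ≤ 0) where
    closed-class : ∀ {x} → Class x → Fin (suc b)
    closed-class (blank _)   = zero
    closed-class (stuck _ _) = Fin.fromℕ b
    closed-class (through S) = contradiction (ℕ.≤-trans (count-pos (frontier? i) (Shape.frontier S)) Φ≤0) λ ()

    closed-class-∼ : ∀ {x y} (p : Class x) (q : Class y) → Live (toℕ i) x → Live (toℕ i) y → closed-class p ≡ closed-class q → x ∼[ toℕ i ] y
    closed-class-∼ (blank s)   (blank s′)   _ _ _ = blank-∼ s s′
    closed-class-∼ (stuck _ e) (stuck _ e′) l l′ _ = stuck-∼ e e′ l l′
    closed-class-∼ (blank _)   (stuck _ _)  _ _ e = contradiction e zero≢fromℕ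
    closed-class-∼ (stuck _ _) (blank _)    _ _ e = contradiction (sym e) zero≢fromℕ
    closed-class-∼ (through S) _ _ _ _ = contradiction (ℕ.≤-trans (count-pos (frontier? i) (Shape.frontier S)) Φ≤0) λ ()
    closed-class-∼ _ (through S) _ _ _ = contradiction (ℕ.≤-trans (count-pos (frontier? i) (Shape.frontier S)) Φ≤0) λ ()

-- The width

≤2^⌈log₂⌉ : ∀ n → n ≤ 2 ^ ⌈log₂ n ⌉
≤2^⌈log₂⌉ n = go n (<-wellFounded n)
  where
  go : ∀ n → Acc _<_ n → n ≤ 2 ^ ⌈log₂ n ⌉
  go 0 _ = z≤n
  go 1 _ = s≤s z≤n
  go n@(suc (suc k)) (acc rec) = begin
    n                                  ≡⟨ ℕ.⌊n/2⌋+⌈n/2⌉≡n n ⟨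
    ⌊ n /2⌋ + ⌈ n /2⌉                  ≤⟨ ℕ.+-monoˡ-≤ ⌈ n /2⌉ (ℕ.⌊n/2⌋≤⌈n/2⌉ n) ⟩
    ⌈ n /2⌉ + ⌈ n /2⌉                  ≡⟨ cong (⌈ n /2⌉ +_) (ℕ.+-identityʳ ⌈ n /2⌉) ⟨
    2 * ⌈ n /2⌉                        ≤⟨ ℕ.*-monoʳ-≤ 2 (go ⌈ n /2⌉ (rec (ℕ.⌈n/2⌉<n k))) ⟩
    2 * 2 ^ ⌈log₂ ⌈ n /2⌉ ⌉            ≡⟨ cong (λ l → 2 * 2 ^ l) (⌈log₂⌈n/2⌉⌉≡⌈log₂n⌉∸1 n) ⟩
    2 ^ suc (⌈log₂ n ⌉ ∸ 1)            ≡⟨ cong (2 ^_) (ℕ.m+[n∸m]≡n {1} (⌈log₂⌉-mono-≤ {2} {n} (s≤s (s≤s z≤n)))) ⟩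
    2 ^ ⌈log₂ n ⌉                      ∎
    where open ℕ.≤-Reasoning

module Bounds (a b : ℕ) where
  D : ℕ
  D = 2 ^ a + a * b

  narrow-bound : ∀ W → D ^ W * suc b ≤ widthBound 2 a b W
  narrow-bound W = ℕ.*-mono-≤ (ℕ.m≤n*m (D ^ W) (2 ^ (2 * (a * W * ⌈log₂ W ⌉))) {{ℕ.m^n≢0 2 (2 * (a * W * ⌈log₂ W ⌉))}}) (ℕ.≤-reflexive (ℕ.+-comm 1 b))

  -- The origin of the constant 2: with `E = a * W * L`, the roots take one factor `2 ^ E` and the
  -- two bits per color another.
  wide-bound : ∀ W → 2 ≤ W → (W ^ W) ^ a * (2 ^ a * 2 ^ a) * D ^ W * suc b ≤ widthBound 2 a b W
  wide-bound W 2≤W = ℕ.*-mono-≤ (ℕ.*-monoˡ-≤ (D ^ W) factor) (ℕ.≤-reflexive (ℕ.+-comm 1 b))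
    where
    open ℕ.≤-Reasoning
    L = ⌈log₂ W ⌉
    E = a * W * L
    -- This absorbs the bits `2 ^ (a + a)` and is where a frontier bound of at least 2 is used; for
    -- `W` at most 1 the product `W * L` is 0.
    2≤W*L : 2 ≤ W * L
    2≤W*L = ℕ.*-mono-≤ {2} {W} {1} {L} 2≤W (⌈log₂⌉-mono-≤ {2} {W} 2≤W)
    roots : (W ^ W) ^ a ≤ 2 ^ E
    roots = begin
      (W ^ W) ^ a         ≤⟨ ℕ.^-monoˡ-≤ a (ℕ.^-monoˡ-≤ W (≤2^⌈log₂⌉ W)) ⟩
      ((2 ^ L) ^ W) ^ a   ≡⟨ cong (_^ a) (ℕ.^-*-assoc 2 L W) ⟩
      (2 ^ (L * W)) ^ a   ≡⟨ ℕ.^-*-assoc 2 (L * W) a ⟩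
      2 ^ (L * W * a)     ≡⟨ cong (2 ^_) (trans (cong (_* a) (ℕ.*-comm L W)) (trans (ℕ.*-comm (W * L) a) (sym (ℕ.*-assoc a W L)))) ⟩
      2 ^ E               ∎
    bits : 2 ^ a * 2 ^ a ≤ 2 ^ E
    bits = begin
      2 ^ a * 2 ^ a   ≡⟨ ℕ.^-distribˡ-+-* 2 a a ⟨
      2 ^ (a + a)     ≤⟨ ℕ.^-monoʳ-≤ 2 (begin
        a + a           ≡⟨ trans (cong (a +_) (sym (ℕ.+-identityʳ a))) (ℕ.*-comm 2 a) ⟩
        a * 2           ≤⟨ ℕ.*-monoʳ-≤ a 2≤W*L ⟩
        a * (W * L)     ≡⟨ ℕ.*-assoc a W L ⟨
        E               ∎) ⟩
      2 ^ E           ∎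
    factor : (W ^ W) ^ a * (2 ^ a * 2 ^ a) ≤ 2 ^ (2 * E)
    factor = begin
      (W ^ W) ^ a * (2 ^ a * 2 ^ a)   ≤⟨ ℕ.*-mono-≤ roots bits ⟩
      2 ^ E * 2 ^ E                   ≡⟨ ℕ.^-distribˡ-+-* 2 E E ⟨
      2 ^ (E + E)                     ≡⟨ cong (λ k → 2 ^ (E + k)) (ℕ.+-identityʳ E) ⟨
      2 ^ (2 * E)                     ∎

module _ {a b : ℕ} (1≤a : 1 ≤ a) (a≤b : a ≤ b) {G : Graph} {m : ℕ} (O : EdgeOrdering G m) where
  open EdgeOrdering O
  private
    1≤b : 1 ≤ b
    1≤b = ℕ.≤-trans 1≤a a≤b

  open Host {a} {b} 1≤a 1≤b O
  open Bounds a b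

  frontier≤ : ∀ {W} → maxFrontier ≡ W → ∀ i → count (frontier? i) ≤ W
  frontier≤ e i = ℕ.≤-trans (≤-maximum (λ i → count (frontier? i)) i) (ℕ.≤-reflexive e)

  width-bound : ∀ W → maxFrontier ≡ W → DD.width diagram ≤ widthBound 2 a b W
  width-bound 0 e = ℕ.≤-trans
    (width-≤ (λ i x l → closed-class i (classify i x)) (λ i x y l l′ → closed-class-∼ i (classify i x) (classify i y) l l′))
    (ℕ.≤-trans (ℕ.≤-reflexive (sym (ℕ.*-identityˡ (suc b)))) (narrow-bound 0))
    where
    module N i = NarrowState {a} {b} 1≤a a≤b O i (ℕ.≤-trans (frontier≤ e i) z≤n)
    open N using (classify)
    open module E i = N.Empty i (frontier≤ e i) using (closed-class; closed-class-∼)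
  width-bound 1 e = ℕ.≤-trans (width-≤ N.state N.state-∼)
    (ℕ.≤-trans (ℕ.≤-reflexive (cong (_* suc b) (sym (ℕ.*-identityʳ D)))) (narrow-bound 1))
    where module N i = NarrowState {a} {b} 1≤a a≤b O i (frontier≤ e i)
  width-bound W@(suc (suc _)) e = ℕ.≤-trans (width-≤ S.state S.state-∼) (wide-bound W (s≤s (s≤s z≤n)))
    where module S i = Code.Wide {a} {b} 1≤a 1≤b O i {W} (s≤s z≤n) (frontier≤ e i)

  decision-diagram : ∃ λ (Z : DD a m) →
    DD.RepresentsFamily Z (λ B → C* M⟨ a , b ⟩ (edgeInduced O B)) × DD.width Z ≤ widthBound 2 a b maxFrontier
  decision-diagram = diagram , diagram-represents family , width-bound maxFrontier refl

theorem5 : (∀ a b → 1 ≤ a → a ≤ b → IsExtendedProfile M⟨ a , b ⟩ (K a b))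
    ×
    (∃ λ C → ∀ a b → 1 ≤ a → a ≤ b →
    ∀ (G : Graph) (m : ℕ) (O : EdgeOrdering G m) →
    ∃ λ (Z : DD a m) →
    DD.RepresentsFamily Z (λ B → C* M⟨ a , b ⟩ (edgeInduced O B))
    × DD.width Z ≤ widthBound C a b (EdgeOrdering.maxFrontier O))
theorem5 = (λ a b 1≤a a≤b → extended-profile a b (ℕ.≤-trans 1≤a a≤b))
         , 2 , λ a b 1≤a a≤b G m O → decision-diagram 1≤a a≤b O
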